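{- Let $\Gamma$ be a non-elementary, torsion-free hyperbolic group. Then the elementary theory of $\Gamma$ is not equational: there exists a definable set $D(p,q)$ in $\Gamma$ which is not in the Boolean algebra generated by equational sets (for the same partition of the variables into $p$ and $q$).
   Context: Equationality is in the sense of G. Srour. For a definable set $D(p,q)$ in a structure $M$, write $D(p,q_0)=\{p_0:(p_0,q_0)\in D\}$. $D(p,q)$ is equational if there is a constant $N_D$ such that for every finite sequence $q_1,\dots,q_m$ for which $\big\{\bigcap_{i=1}^{j} D(p,q_i)\big\}_{j=1}^{m}$ is strictly decreasing, one has $m\le N_D$. A theory is equational if every definable set $D(p,q)$ (for every partition of its variables) is a Boolean combination of equational sets with the same partition of variables. -}

module Defs where

open import Level using (Level; _⊔_)
open import Data.Nat using (ℕ; zero; suc; _+_; _≤_; _<_)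
  renaming (_⊔_ to _⊔ℕ_)
open import Data.Integer using (ℤ; +_; -[1+_])
open import Data.Fin using (Fin; zero; suc)
open import Data.List using (List; []; _∷_; length)
open import Data.Bool using (Bool; true; false)
open import Data.Product using (Σ; ∃; _×_; _,_)
open import Data.Sum using (_⊎_)
open import Data.Empty using (⊥)
open import Relation.Nullary using (¬_)
open import Data.Vec.Functional using (Vector) renaming (_++_ to _++ᵥ_)
open import Algebra.Bundles using (Group)

module _ {c ℓ : Level} (G : Group c ℓ) where
  open Group G renaming (Carrier to Γ)

  pow : Γ → ℕ → Γ
  pow g zero    = ε
  pow g (suc n) = g ∙ pow g n

  zpow : Γ → ℤ → Γ
  zpow g (+ n)      = pow g n
  zpow g -[1+ n ]   = (pow g (suc n)) ⁻¹

  TorsionFree : Set (c ⊔ ℓ)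
  TorsionFree = ∀ (g : Γ) (n : ℕ) → pow g (suc n) ≈ ε → g ≈ ε

  -- Elementary (= virtually cyclic): some cyclic subgroup ⟨a⟩ has
  -- finite index, i.e. finitely many cosets r_i⟨a⟩ cover Γ.
  VirtuallyCyclic : Set (c ⊔ ℓ)
  VirtuallyCyclic =
    Σ Γ λ a → Σ ℕ λ k → Σ (Fin k → Γ) λ r →
      ∀ (g : Γ) → Σ (Fin k) λ i → Σ ℤ λ z → g ≈ r i ∙ zpow a z

  NonElementary : Set (c ⊔ ℓ)
  NonElementary = ¬ VirtuallyCyclic

  module _ {k : ℕ} (S : Fin k → Γ) where
    evalWord : List (Fin k × Bool) → Γ
    evalWord []                 = ε
    evalWord ((i , true)  ∷ w) = S i ∙ evalWord w
    evalWord ((i , false) ∷ w) = (S i ⁻¹) ∙ evalWord w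

    WordLen≤ : Γ → ℕ → Set ℓ
    WordLen≤ g n = Σ (List (Fin k × Bool)) λ w → (length w ≤ n) × (evalWord w ≈ g)

    Generates : Set (c ⊔ ℓ)
    Generates = ∀ (g : Γ) → Σ ℕ λ n → WordLen≤ g n

    Dist : Γ → Γ → ℕ → Set ℓ
    Dist g h n = WordLen≤ (g ⁻¹ ∙ h) n × (∀ m → WordLen≤ (g ⁻¹ ∙ h) m → n ≤ m)

    FourPoint : ℕ → Set (c ⊔ ℓ)
    FourPoint δ = ∀ (x y z w : Γ) (dxy dzw dxz dyw dxw dyz : ℕ) →
      Dist x y dxy → Dist z w dzw → Dist x z dxz →
      Dist y w dyw → Dist x w dxw → Dist y z dyz →
      dxy + dzw ≤ ((dxz + dyw) ⊔ℕ (dxw + dyz)) + (δ + δ)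

  Hyperbolic : Set (c ⊔ ℓ)
  Hyperbolic = Σ ℕ λ k → Σ (Fin k → Γ) λ S →
    Generates S × Σ ℕ λ δ → FourPoint S δ

data Term (n : ℕ) : Set where
  var  : Fin n → Term n
  one  : Term n
  mul  : Term n → Term n → Term n
  inv  : Term n → Term n

data Formula : ℕ → Set where
  _≐_   : ∀ {n} → Term n → Term n → Formula n
  ff    : ∀ {n} → Formula n
  neg   : ∀ {n} → Formula n → Formula n
  conj  : ∀ {n} → Formula n → Formula n → Formula n
  disj  : ∀ {n} → Formula n → Formula n → Formula n
  ex    : ∀ {n} → Formula (suc n) → Formula n
  all   : ∀ {n} → Formula (suc n) → Formula n

module Semantics {c ℓ : Level} (G : Group c ℓ) where
  open Group G renaming (Carrier to Γ)

  extend : ∀ {n} → Γ → (Fin n → Γ) → Fin (suc n) → Γ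
  extend a ρ zero    = a
  extend a ρ (suc i) = ρ i

  evalT : ∀ {n} → (Fin n → Γ) → Term n → Γ
  evalT ρ (var i)   = ρ i
  evalT ρ one       = ε
  evalT ρ (mul s t) = evalT ρ s ∙ evalT ρ t
  evalT ρ (inv t)   = evalT ρ t ⁻¹

  Sat : ∀ {n} → (Fin n → Γ) → Formula n → Set (c ⊔ ℓ)
  Sat ρ (s ≐ t)    = Level.Lift (c ⊔ ℓ) (evalT ρ s ≈ evalT ρ t)
  Sat ρ ff         = Level.Lift (c ⊔ ℓ) ⊥
  Sat ρ (neg φ)    = ¬ Sat ρ φ
  Sat ρ (conj φ ψ) = Sat ρ φ × Sat ρ ψ
  Sat ρ (disj φ ψ) = Sat ρ φ ⊎ Sat ρ ψ
  Sat ρ (ex φ)     = Σ Γ λ a → Sat (extend a ρ) φ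
  Sat ρ (all φ)    = ∀ (a : Γ) → Sat (extend a ρ) φ

  _∈D[_,_] : ∀ {n m} → Formula (n + m) → Vector Γ n → Vector Γ m → Set (c ⊔ ℓ)
  φ ∈D[ p , q ] = Sat (p ++ᵥ q) φ

  InPrefix : ∀ {n m} → Formula (n + m) → (ℕ → Vector Γ m) → ℕ → Vector Γ n → Set (c ⊔ ℓ)
  InPrefix {n} {m} φ qs j p = ∀ i → i ≤ j → _∈D[_,_] {n} {m} φ p (qs i)

  -- q₀,…,q_{L-1}: the chain ⋂_{i≤j} D(p,q_i), j = 0..L-1, is strictly
  -- decreasing (each next intersection loses some point of the previous one).
  StrictlyDecreasing : ∀ {n m} → Formula (n + m) → (ℕ → Vector Γ m) → ℕ → Set (c ⊔ ℓ)
  StrictlyDecreasing {n} {m} φ qs L =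
    ∀ j → suc j < L → Σ (Vector Γ n) λ p →
      InPrefix {n} {m} φ qs j p × ¬ InPrefix {n} {m} φ qs (suc j) p

  Equational : ∀ {n m} → Formula (n + m) → Set (c ⊔ ℓ)
  Equational {n} {m} φ = Σ ℕ λ N → ∀ (L : ℕ) (qs : ℕ → Vector Γ m) →
    StrictlyDecreasing {n} {m} φ qs L → L ≤ N

data BoolComb (k : ℕ) : Set where
  atom  : Formula k → BoolComb k
  bneg  : BoolComb k → BoolComb k
  band  : BoolComb k → BoolComb k → BoolComb k
  bor   : BoolComb k → BoolComb k → BoolComb k

toFormula : ∀ {k} → BoolComb k → Formula k
toFormula (atom φ)  = φ
toFormula (bneg b)  = neg (toFormula b)
toFormula (band b d) = conj (toFormula b) (toFormula d)
toFormula (bor b d)  = disj (toFormula b) (toFormula d)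

module BoolSem {c ℓ : Level} (G : Group c ℓ) where
  open Group G renaming (Carrier to Γ)
  open Semantics G

  AllAtoms : ∀ {k} → (Formula k → Set (c ⊔ ℓ)) → BoolComb k → Set (c ⊔ ℓ)
  AllAtoms P (atom φ)   = P φ
  AllAtoms P (bneg b)   = AllAtoms P b
  AllAtoms P (band b d) = AllAtoms P b × AllAtoms P d
  AllAtoms P (bor b d)  = AllAtoms P b × AllAtoms P d

  InEqBoolAlg : ∀ {n m} → Formula (n + m) → Set (c ⊔ ℓ)
  InEqBoolAlg {n} {m} φ = Σ (BoolComb (n + m)) λ b →
    AllAtoms (Equational {n} {m}) b ×
    (∀ (p : Vector Γ n) (q : Vector Γ m) →
       (_∈D[_,_] {n} {m} φ p q → _∈D[_,_] {n} {m} (toFormula b) p q) ×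
       (_∈D[_,_] {n} {m} (toFormula b) p q → _∈D[_,_] {n} {m} φ p q))

{-# OPTIONS --safe #-}
module Submission where

-- Proof idea.  Let c be loxodromic with centralizer C malnormal, f ∉ C, and
-- T = { w z w⁻¹ c w | w ∈ Γ, 1 ≠ z ∈ C }; T is definable from c and f.  Use as p and q conjugates of the
-- frame (c , f) by g and h.  Formulas without parameters are invariant under inner automorphisms, so an atom
-- of a Boolean combination becomes a subset E of Γ, tested at g⁻¹h, and equationality of the atom says: if
-- e ∉ E, no long sequence (xᵢ) has xᵢ xₖ⁻¹ e ∈ E for all k < i.  Choose e so that as many atoms as possible fail
-- at e.  By Ramsey's theorem every long sequence then has k < i such that the same atoms fail at xᵢ xₖ⁻¹ e, so that
-- the Boolean combination has the same truth value at e and at xᵢ xₖ⁻¹ e.  It is therefore enough to have,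
-- for every e, a sequence all of whose xᵢ xₖ⁻¹ e lie outside T, and one for which they all lie in T.
-- The second is easy: with w = c⁻¹e and xᵢ = w cⁱ w⁻¹ one gets xᵢ xₖ⁻¹ e = w cⁱ⁻ᵏ w⁻¹ c w.
-- For the first take xᵢ = (f c^Nᵢ)⁷ with Nᵢ growing fast.  If (f c^N)⁷ g = w z w⁻¹ c w, compare the long
-- projections of the two sides to the translates of the axis of c: the left side has seven of them, all
-- positive, whereas on the right those of w, w⁻¹ and w cannot cancel each other, so by the signs w has
-- essentially none and only six cosets of C are left for the seven projections.
open import Defs
open import Level using (Level; _⊔_; lift)
open import Function using (_∘_; id)
open import Data.Nat using (ℕ; zero; suc; _+_; _*_; _∸_; _≤_; _<_; _≤?_; z≤n; s≤s)
open import Data.Nat.Properties using (≤-refl; ≤-reflexive; ≤-trans; m≤m+n; m≤n+m; +-monoʳ-≤; +-monoˡ-≤; +-mono-≤; ≰⇒>)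
import Data.Nat.Properties as ℕₚ
open import Data.Nat.Induction using (<-wellFounded)
open import Data.Nat.Tactic.RingSolver using (solve)
open import Data.Integer as ℤ using (ℤ; +_; -[1+_]; _⊖_; ∣_∣)
import Data.Integer.Properties as ℤₚ
import Data.Integer.Tactic.RingSolver as ℤ-Solver
open import Data.Bool using (Bool; true; false; not)
import Data.Bool.Properties as Boolₚ
open import Data.Fin as Fin using (Fin; zero; suc; toℕ; _≟_)
import Data.Fin.Properties as Finₚ
open import Data.List as List using (List; []; _∷_; _++_; length; take; drop; upTo; allFin; cartesianProduct; cartesianProductWith)
import Data.List.Properties as Listₚ
open import Data.List.Membership.Propositional using (_∈_)
open import Data.List.Membership.Propositional.Properties using (∈-cartesianProduct⁺; ∈-cartesianProductWith⁺; ∈-allFin)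
open import Data.List.Relation.Unary.All as All using (All)
open import Data.List.Relation.Unary.AllPairs as AllPairs using (AllPairs)
import Data.List.Relation.Unary.AllPairs.Properties as AllPairsₚ
open import Data.List.Relation.Unary.Any as Any using (here; there)
open import Data.List.Relation.Unary.Any.Properties using (lookup-index)
open import Data.Vec using (Vec; lookup) renaming ([] to []ᵥ; _∷_ to infixr 5 _∷ᵥ_)
open import Data.Vec.Functional using (Vector) renaming (_++_ to _++ᶠ_)
open import Data.Product using (Σ; ∃; ∃₂; _×_; _,_; proj₁; proj₂)
open import Data.Sum using (_⊎_; inj₁; inj₂)
open import Data.Unit using (⊤; tt)
open import Data.Empty using (⊥; ⊥-elim)
open import Relation.Nullary using (¬_; Dec; yes; no)
open import Relation.Nullary.Decidable using (decidable-stable)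
open import Relation.Binary.PropositionalEquality as ≡ using (_≡_; _≢_; refl)
open import Induction.WellFounded using (Acc; acc)
open import Algebra.Bundles using (Group)

-- Equationality protects only failing atoms: the Ramsey argument finds a pair at which what failed
-- at e still fails. Atoms true at e are controlled by maximality alone, since one more failure
-- would enlarge the failing set. The second component f of a frame is needed because c determines a
-- conjugating element only up to C. By malnormality the pair (c , f) has trivial centralizer, so x
-- can be recovered from its frame. The obstacle in the geometric half is that nothing is known
-- about w, which occurs in w z w⁻¹ c w twice with one sign and once with the other. Two facts make
-- up for this: w cannot have long projections on two lines that differ by a nontrivial element of
-- C, and the left side has no long negative projection on any line. The element c is a power of a
-- loxodromic h, chosen central in the commensurator of ⟨h⟩, so that commensurator and centralizer
-- of c agree; malnormality of C rests on this. Equality in Γ is not assumed decidable, so lengths,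
-- nearest points and case distinctions exist only under double negation. This is harmless where the
-- goal is a numerical inequality or a negation.

em : ∀ {a} {X : Set a} → ¬ ¬ (X ⊎ ¬ X)
em k = k (inj₂ λ x → k (inj₁ x))

¬¬-∀Fin : ∀ {p n} {P : Fin n → Set p} → (∀ i → ¬ ¬ P i) → ¬ ¬ (∀ i → P i)
¬¬-∀Fin {n = zero}  h k = k λ ()
¬¬-∀Fin {n = suc n} h k = h zero λ p₀ → ¬¬-∀Fin (h ∘ suc) λ ps →
  k λ { zero → p₀ ; (suc i) → ps i }

least : ∀ {p} {P : ℕ → Set p} {n} → P n → ¬ ¬ (∃ λ m → P m × ∀ k → P k → m ≤ k)
least {P = P} {n} pn = go n (<-wellFounded n) pn
  where
  go : ∀ n → Acc _<_ n → P n → ¬ ¬ (∃ λ m → P m × ∀ k → P k → m ≤ k)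
  go n (acc rs) pn κ = em {X = ∃ λ k → k < n × P k} λ
    { (inj₁ (k , k<n , pk)) → go k (rs k<n) pk κ
    ; (inj₂ none) → κ (n , pn , λ k pk → ℕₚ.≮⇒≥ λ k<n → none (k , k<n , pk)) }

-- A certificate for linear inequalities: `L ≤ R` is a sum of hypotheses, `k` is the slack, and the
-- remaining identity is left to the ring solver.
lin : ∀ {l r L R} k → L ≤ R → l + R + k ≡ r + L → l ≤ r
lin {l} {r} {L} {R} k h e = ℕₚ.+-cancelʳ-≤ R l r
  (≤-trans (m≤m+n (l + R) k) (≤-trans (≤-reflexive e) (+-monoʳ-≤ r h)))

lin⊥ : ∀ {L R} k → L ≤ R → L ≡ suc (R + k) → ⊥
lin⊥ {L} {R} k h refl = ℕₚ.1+n≰n (≤-trans h (m≤m+n R k))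

≤-stable : ∀ {m n} → ¬ ¬ (m ≤ n) → m ≤ n
≤-stable {m} {n} = decidable-stable (m ≤? n)

-- Free reduction as a solver for group identities

infixl 7 _·_
infix  8 _⁻

_·_ : ∀ {n} → Term n → Term n → Term n
_·_ = mul

_⁻ : ∀ {n} → Term n → Term n
_⁻ = inv

x₀ : ∀ {n} → Term (1 + n)
x₀ = var zero
x₁ : ∀ {n} → Term (2 + n)
x₁ = var (suc zero)
x₂ : ∀ {n} → Term (3 + n)
x₂ = var (suc (suc zero))
x₃ : ∀ {n} → Term (4 + n)
x₃ = var (suc (suc (suc zero)))
x₄ : ∀ {n} → Term (5 + n)
x₄ = var (suc (suc (suc (suc zero))))
x₅ : ∀ {n} → Term (6 + n)
x₅ = var (suc (suc (suc (suc (suc zero)))))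

Word : ℕ → Set
Word n = List (Fin n × Bool)

infixr 5 _◂_
_◂_ : ∀ {n} → Fin n × Bool → Word n → Word n
l ◂ [] = l ∷ []
(i , b) ◂ ((j , b′) ∷ w) with i ≟ j | b Boolₚ.≟ b′
... | yes _ | no _  = w
... | yes _ | yes _ = (i , b) ∷ (j , b′) ∷ w
... | no _  | _     = (i , b) ∷ (j , b′) ∷ w

-- The Boolean is a sign: `t`, or its inverse for `false`, is multiplied letter by letter onto the
-- front of `w`, cancelling on the way.
reduce : ∀ {n} → Bool → Term n → Word n → Word n
reduce b     (var i)   w = (i , b) ◂ w
reduce b     one       w = w
reduce true  (mul s t) w = reduce true s (reduce true t w)
reduce false (mul s t) w = reduce false t (reduce false s w)
reduce b     (inv t)   w = reduce (not b) t w

module GroupLemmas {c ℓ : Level} (G : Group c ℓ) where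
  open Group G public renaming (Carrier to Γ; refl to ≈-refl; sym to ≈-sym; trans to ≈-trans; reflexive to ≈-reflexive)
  open import Algebra.Properties.Group G public using (⁻¹-involutive; ⁻¹-anti-homo-∙; ε⁻¹≈ε)
  open Semantics G using (evalT) public
  open import Relation.Binary.Reasoning.Setoid setoid

  signed : Bool → Γ → Γ
  signed true  g = g
  signed false g = g ⁻¹

  module _ {n : ℕ} (ρ : Fin n → Γ) where
    ⟦_⟧ : Word n → Γ
    ⟦_⟧ = evalWord G ρ

    ∷-sound : ∀ i b w → ⟦ (i , b) ∷ w ⟧ ≈ signed b (ρ i) ∙ ⟦ w ⟧
    ∷-sound i true  w = ≈-refl
    ∷-sound i false w = ≈-refl

    cancel : ∀ b b′ g h → ¬ b ≡ b′ → signed b g ∙ (signed b′ g ∙ h) ≈ h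
    cancel true  true  g h b≢ = ⊥-elim (b≢ refl)
    cancel true  false g h b≢ = ≈-trans (≈-sym (assoc _ _ _)) (≈-trans (∙-congʳ (inverseʳ g)) (identityˡ h))
    cancel false true  g h b≢ = ≈-trans (≈-sym (assoc _ _ _)) (≈-trans (∙-congʳ (inverseˡ g)) (identityˡ h))
    cancel false false g h b≢ = ⊥-elim (b≢ refl)

    ◂-sound : ∀ i b w → ⟦ (i , b) ◂ w ⟧ ≈ signed b (ρ i) ∙ ⟦ w ⟧
    ◂-sound i b [] = ∷-sound i b []
    ◂-sound i b ((j , b′) ∷ w) with i ≟ j | b Boolₚ.≟ b′
    ... | yes refl | no b≢ = ≈-sym (≈-trans (∙-congˡ (∷-sound i b′ w)) (cancel b b′ (ρ i) ⟦ w ⟧ b≢))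
    ... | yes _ | yes _ = ∷-sound i b _
    ... | no _  | _     = ∷-sound i b _

    reduce-sound : ∀ b t w → ⟦ reduce b t w ⟧ ≈ signed b (evalT ρ t) ∙ ⟦ w ⟧
    reduce-sound b (var i) w = ◂-sound i b w
    reduce-sound true  one w = ≈-sym (identityˡ _)
    reduce-sound false one w = ≈-sym (≈-trans (∙-congʳ ε⁻¹≈ε) (identityˡ _))
    reduce-sound true (mul s t) w = begin
      ⟦ reduce true s (reduce true t w) ⟧    ≈⟨ reduce-sound true s _ ⟩
      evalT ρ s ∙ ⟦ reduce true t w ⟧        ≈⟨ ∙-congˡ (reduce-sound true t w) ⟩
      evalT ρ s ∙ (evalT ρ t ∙ ⟦ w ⟧)        ≈⟨ assoc _ _ _ ⟨
      evalT ρ s ∙ evalT ρ t ∙ ⟦ w ⟧          ∎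
    reduce-sound false (mul s t) w = begin
      ⟦ reduce false t (reduce false s w) ⟧         ≈⟨ reduce-sound false t _ ⟩
      evalT ρ t ⁻¹ ∙ ⟦ reduce false s w ⟧           ≈⟨ ∙-congˡ (reduce-sound false s w) ⟩
      evalT ρ t ⁻¹ ∙ (evalT ρ s ⁻¹ ∙ ⟦ w ⟧)         ≈⟨ assoc _ _ _ ⟨
      evalT ρ t ⁻¹ ∙ evalT ρ s ⁻¹ ∙ ⟦ w ⟧           ≈⟨ ∙-congʳ (⁻¹-anti-homo-∙ _ _) ⟨
      (evalT ρ s ∙ evalT ρ t) ⁻¹ ∙ ⟦ w ⟧            ∎
    reduce-sound true  (inv t) w = reduce-sound false t w
    reduce-sound false (inv t) w = ≈-trans (reduce-sound true t w) (∙-congʳ (≈-sym (⁻¹-involutive _)))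

  -- Terms with the same free reduction agree in every group, so for explicit terms `refl` is the
  -- whole certificate.
  group! : ∀ {n} (xs : Vec Γ n) (s t : Term n) → reduce true s [] ≡ reduce true t [] →
           evalT (lookup xs) s ≈ evalT (lookup xs) t
  group! xs s t e = begin
    evalT ρ s                      ≈⟨ identityʳ _ ⟨
    evalT ρ s ∙ ε                  ≈⟨ reduce-sound ρ true s [] ⟨
    evalWord G ρ (reduce true s []) ≡⟨ ≡.cong (evalWord G ρ) e ⟩
    evalWord G ρ (reduce true t []) ≈⟨ reduce-sound ρ true t [] ⟩
    evalT ρ t ∙ ε                  ≈⟨ identityʳ _ ⟩
    evalT ρ t                      ∎
    where ρ = lookup xs

  pow-+ : ∀ g m n → pow G g (m + n) ≈ pow G g m ∙ pow G g n
  pow-+ g zero    n = ≈-sym (identityˡ _)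
  pow-+ g (suc m) n = ≈-trans (∙-congˡ (pow-+ g m n)) (≈-sym (assoc _ _ _))

  pow-comm : ∀ g m n → pow G g m ∙ pow G g n ≈ pow G g n ∙ pow G g m
  pow-comm g m n = begin
    pow G g m ∙ pow G g n ≈⟨ pow-+ g m n ⟨
    pow G g (m + n)       ≡⟨ ≡.cong (pow G g) (ℕₚ.+-comm m n) ⟩
    pow G g (n + m)       ≈⟨ pow-+ g n m ⟩
    pow G g n ∙ pow G g m ∎

  pow-cong : ∀ {g h} n → g ≈ h → pow G g n ≈ pow G h n
  pow-cong zero    e = ≈-refl
  pow-cong (suc n) e = ∙-cong e (pow-cong n e)

  pow-* : ∀ g m n → pow G (pow G g m) n ≈ pow G g (n * m)
  pow-* g m zero    = ≈-refl
  pow-* g m (suc n) = ≈-trans (∙-congˡ (pow-* g m n)) (≈-sym (pow-+ g m (n * m)))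

  zpow-⊖ : ∀ g m n → zpow G g (m ⊖ n) ≈ pow G g m ∙ pow G g n ⁻¹
  zpow-⊖ g m       zero    = ≈-sym (≈-trans (∙-congˡ ε⁻¹≈ε) (identityʳ _))
  zpow-⊖ g zero    (suc n) = ≈-sym (identityˡ _)
  zpow-⊖ g (suc m) (suc n) = begin
    zpow G g (suc m ⊖ suc n)                    ≡⟨ ≡.cong (zpow G g) (ℤₚ.[1+m]⊖[1+n]≡m⊖n m n) ⟩
    zpow G g (m ⊖ n)                            ≈⟨ zpow-⊖ g m n ⟩
    pow G g m ∙ pow G g n ⁻¹
      ≈⟨ group! (g ∷ᵥ pow G g m ∷ᵥ pow G g n ∷ᵥ []ᵥ) (x₁ · x₂ ⁻) (x₁ · x₀ · (x₂ · x₀) ⁻) refl ⟩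
    pow G g m ∙ g ∙ (pow G g n ∙ g) ⁻¹          ≈⟨ ∙-cong (comm₁ m) (⁻¹-cong (comm₁ n)) ⟩
    g ∙ pow G g m ∙ (g ∙ pow G g n) ⁻¹          ∎
    where
    comm₁ : ∀ k → pow G g k ∙ g ≈ g ∙ pow G g k
    comm₁ k = begin
      pow G g k ∙ g           ≈⟨ ∙-congˡ (identityʳ g) ⟨
      pow G g k ∙ pow G g 1   ≈⟨ pow-comm g k 1 ⟩
      pow G g 1 ∙ pow G g k   ≈⟨ ∙-congʳ (identityʳ g) ⟩
      g ∙ pow G g k           ∎

  zpow-+ : ∀ g i j → zpow G g (i ℤ.+ j) ≈ zpow G g i ∙ zpow G g j
  zpow-+ g (+ m)    (+ n)    = pow-+ g m n
  zpow-+ g (+ m)    -[1+ n ] = zpow-⊖ g m (suc n)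
  zpow-+ g -[1+ m ] (+ n)    = begin
    zpow G g (n ⊖ suc m)                ≈⟨ zpow-⊖ g n (suc m) ⟩
    B ∙ A ⁻¹                            ≈⟨ group! (A ∷ᵥ B ∷ᵥ []ᵥ) (x₁ · x₀ ⁻) (x₀ ⁻ · (x₀ · x₁) · x₀ ⁻) refl ⟩
    A ⁻¹ ∙ (A ∙ B) ∙ A ⁻¹               ≈⟨ ∙-congʳ (∙-congˡ (pow-comm g (suc m) n)) ⟩
    A ⁻¹ ∙ (B ∙ A) ∙ A ⁻¹               ≈⟨ group! (A ∷ᵥ B ∷ᵥ []ᵥ) (x₀ ⁻ · (x₁ · x₀) · x₀ ⁻) (x₀ ⁻ · x₁) refl ⟩
    A ⁻¹ ∙ B                            ∎
    where
    A = pow G g (suc m)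
    B = pow G g n
  zpow-+ g -[1+ m ] -[1+ n ] = begin
    pow G g (suc (suc (m + n))) ⁻¹          ≡⟨ ≡.cong (λ k → pow G g k ⁻¹) (≡.cong suc (≡.trans (≡.cong suc (ℕₚ.+-comm m n)) (≡.sym (ℕₚ.+-suc n m)))) ⟩
    pow G g (suc n + suc m) ⁻¹              ≈⟨ ⁻¹-cong (pow-+ g (suc n) (suc m)) ⟩
    (pow G g (suc n) ∙ pow G g (suc m)) ⁻¹  ≈⟨ ⁻¹-anti-homo-∙ _ _ ⟩
    pow G g (suc m) ⁻¹ ∙ pow G g (suc n) ⁻¹ ∎

  zpow-neg : ∀ g i → zpow G g (ℤ.- i) ≈ zpow G g i ⁻¹
  zpow-neg g i = begin
    zpow G g (ℤ.- i)                                ≈⟨ group! (A ∷ᵥ B ∷ᵥ []ᵥ) x₁ (x₀ ⁻ · (x₀ · x₁)) refl ⟩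
    A ⁻¹ ∙ (A ∙ B)                                  ≈⟨ ∙-congˡ (zpow-+ g i (ℤ.- i)) ⟨
    A ⁻¹ ∙ zpow G g (i ℤ.- i)                       ≡⟨ ≡.cong (λ k → A ⁻¹ ∙ zpow G g k) (ℤₚ.+-inverseʳ i) ⟩
    A ⁻¹ ∙ ε                                        ≈⟨ identityʳ _ ⟩
    A ⁻¹                                            ∎
    where
    A = zpow G g i
    B = zpow G g (ℤ.- i)

  intertwine-inv : ∀ {x A B} → x ∙ A ≈ B ∙ x → x ∙ A ⁻¹ ≈ B ⁻¹ ∙ x
  intertwine-inv {x} {A} {B} e = begin
    x ∙ A ⁻¹                     ≈⟨ group! (x ∷ᵥ A ∷ᵥ B ∷ᵥ []ᵥ) (x₀ · x₁ ⁻) (x₂ ⁻ · (x₂ · x₀) · x₁ ⁻) refl ⟩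
    B ⁻¹ ∙ (B ∙ x) ∙ A ⁻¹        ≈⟨ ∙-congʳ (∙-congˡ e) ⟨
    B ⁻¹ ∙ (x ∙ A) ∙ A ⁻¹        ≈⟨ group! (x ∷ᵥ A ∷ᵥ B ∷ᵥ []ᵥ) (x₂ ⁻ · (x₀ · x₁) · x₁ ⁻) (x₂ ⁻ · x₀) refl ⟩
    B ⁻¹ ∙ x                     ∎

  intertwine-∙ : ∀ {x A B A′ B′} → x ∙ A ≈ B ∙ x → x ∙ A′ ≈ B′ ∙ x → x ∙ (A ∙ A′) ≈ (B ∙ B′) ∙ x
  intertwine-∙ {x} {A} {B} {A′} {B′} e e′ = begin
    x ∙ (A ∙ A′)    ≈⟨ assoc _ _ _ ⟨
    x ∙ A ∙ A′      ≈⟨ ∙-congʳ e ⟩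
    B ∙ x ∙ A′      ≈⟨ assoc _ _ _ ⟩
    B ∙ (x ∙ A′)    ≈⟨ ∙-congˡ e′ ⟩
    B ∙ (B′ ∙ x)    ≈⟨ assoc _ _ _ ⟨
    (B ∙ B′) ∙ x    ∎

  intertwine-pow : ∀ {x A B} n → x ∙ A ≈ B ∙ x → x ∙ pow G A n ≈ pow G B n ∙ x
  intertwine-pow zero    e = ≈-trans (identityʳ _) (≈-sym (identityˡ _))
  intertwine-pow (suc n) e = intertwine-∙ e (intertwine-pow n e)

  intertwine-zpow : ∀ {x A B} i → x ∙ A ≈ B ∙ x → x ∙ zpow G A i ≈ zpow G B i ∙ x
  intertwine-zpow (+ n)    e = intertwine-pow n e
  intertwine-zpow -[1+ n ] e = intertwine-inv (intertwine-pow (suc n) e)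

  zpow-*-pow : ∀ g i n → pow G (zpow G g i) n ≈ zpow G g (i ℤ.* + n)
  zpow-*-pow g i zero    = ≈-reflexive (≡.cong (zpow G g) (≡.sym (ℤₚ.*-zeroʳ i)))
  zpow-*-pow g i (suc n) = begin
    zpow G g i ∙ pow G (zpow G g i) n     ≈⟨ ∙-congˡ (zpow-*-pow g i n) ⟩
    zpow G g i ∙ zpow G g (i ℤ.* + n)     ≈⟨ zpow-+ g i (i ℤ.* + n) ⟨
    zpow G g (i ℤ.+ i ℤ.* + n)            ≡⟨ ≡.cong (zpow G g) (ℤₚ.*-suc i (+ n)) ⟨
    zpow G g (i ℤ.* + suc n)              ∎

  zpow-* : ∀ g i j → zpow G (zpow G g i) j ≈ zpow G g (i ℤ.* j)
  zpow-* g i (+ n)    = zpow-*-pow g i n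
  zpow-* g i -[1+ n ] = begin
    pow G (zpow G g i) (suc n) ⁻¹      ≈⟨ ⁻¹-cong (zpow-*-pow g i (suc n)) ⟩
    zpow G g (i ℤ.* + suc n) ⁻¹        ≈⟨ zpow-neg g (i ℤ.* + suc n) ⟨
    zpow G g (ℤ.- (i ℤ.* + suc n))     ≡⟨ ≡.cong (zpow G g) (ℤₚ.neg-distribʳ-* i (+ suc n)) ⟩
    zpow G g (i ℤ.* -[1+ n ])          ∎

  -- The commensurator of ⟨g⟩ lies in the centralizer of `g`. The double negation is there because
  -- centrality will be obtained from nearest points, which exist only classically.
  CentralCommensurator : Γ → Set (c ⊔ ℓ)
  CentralCommensurator g = ∀ x i j → i ≢ + 0 → x ∙ zpow G g i ≈ zpow G g j ∙ x → ¬ ¬ (x ∙ g ≈ g ∙ x)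

-- The word metric, and the inequalities between lengths used with it

module MetricArithmetic where
  abstract
    two-sided : ∀ n m δ → n + n + n ≤ n + m + (δ + δ) → n + n ≤ m + (δ + δ)
    two-sided n m δ le = lin 0 le (solve (n ∷ m ∷ δ ∷ []))

    not-backtracking : ∀ n s δ → n + n + n ≤ s + n + (δ + δ) → s ≤ n + (δ + δ + δ) → 7 * δ < n → ⊥
    not-backtracking n s δ p q r = lin⊥ (δ + δ) (+-mono-≤ p (+-mono-≤ q r)) (solve (n ∷ s ∷ δ ∷ []))

    below : ∀ n x δ → suc x ≤ n + (δ + δ + δ) + 1 → x ≤ n + (δ + δ + δ)
    below n x δ p = lin 0 p (solve (x ∷ n ∷ δ ∷ []))

    first-turn : ∀ n m m′ δ → m + m′ ≤ n + n + (δ + δ) → n + n ≤ m + (δ + δ) → n + n ≤ m′ + (δ + δ) → 7 * δ < n → ⊥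
    first-turn n m m′ δ p q r s = lin⊥ (8 * δ + 1) (+-mono-≤ (+-mono-≤ p (+-mono-≤ q r)) (+-mono-≤ s s))
      (solve (n ∷ m ∷ m′ ∷ δ ∷ []))

    second-turn : ∀ n m m′ t δ → m + m′ ≤ t + n + (δ + δ) → t + m ≤ m + n + (δ + δ) →
      n + n ≤ m + (δ + δ) → n + n ≤ m′ + (δ + δ) → 7 * δ < n → ⊥
    second-turn n m m′ t δ p p′ q r s = lin⊥ (6 * δ + 1) (+-mono-≤ (+-mono-≤ (+-mono-≤ p p′) (+-mono-≤ q r)) (+-mono-≤ s s))
      (solve (n ∷ m ∷ m′ ∷ t ∷ δ ∷ []))

    square-long : ∀ n m m′ t q δ → m + m′ ≤ t + n + (δ + δ) → t + m ≤ q + n + (δ + δ) →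
      n + n ≤ m + (δ + δ) → n + n ≤ m′ + (δ + δ) → 7 * δ < n → m + (δ + δ + δ) + 1 ≤ q
    square-long n m m′ t q δ p p′ u r s = lin (3 * δ + 1) (+-mono-≤ (+-mono-≤ (+-mono-≤ p p′) (+-mono-≤ u r)) (+-mono-≤ s s))
      (solve (n ∷ m ∷ m′ ∷ t ∷ q ∷ δ ∷ []))

    growth₀ : ∀ x y m δ → y + (δ + δ + δ) + 1 ≤ m → m ≤ y + y → x ≤ 0 → x + δ + 1 ≤ y
    growth₀ x y m δ p q r = lin (δ + δ) (+-mono-≤ (+-mono-≤ p q) r) (solve (x ∷ y ∷ m ∷ δ ∷ []))

    growth⊥ : ∀ x z m n δ → n + x ≤ m + z + (δ + δ) → m + (δ + δ + δ) + 1 ≤ n → z + δ + 1 ≤ x → ⊥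
    growth⊥ x z m n δ p q r = lin⊥ (δ + δ + 1) (+-mono-≤ (+-mono-≤ p q) r) (solve (x ∷ z ∷ m ∷ n ∷ δ ∷ []))

    growth₁ : ∀ x y m n δ → n + x ≤ y + m + (δ + δ) → m + (δ + δ + δ) + 1 ≤ n → x + δ + 1 ≤ y
    growth₁ x y m n δ p q = lin 0 (+-mono-≤ p q) (solve (x ∷ y ∷ m ∷ n ∷ δ ∷ []))

    linear-step : ∀ n m z δ → n ≤ z → z + δ + 1 ≤ m → suc n ≤ m
    linear-step n m z δ p q = lin δ (+-mono-≤ p q) (solve (n ∷ m ∷ z ∷ δ ∷ []))

    additive₀ : ∀ a b m → b ≤ 0 → a + b ≤ a + m
    additive₀ a b m p = +-monoʳ-≤ a (≤-trans p z≤n)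

    additive⊥ : ∀ a b z a′ δ → a′ + b ≤ a + z + (δ + δ) → a + δ + 1 ≤ a′ → z + δ + 1 ≤ b → ⊥
    additive⊥ a b z a′ δ p q r = lin⊥ 1 (+-mono-≤ (+-mono-≤ p q) r) (solve (a ∷ b ∷ z ∷ a′ ∷ δ ∷ []))

    additive₁ : ∀ a b s a′ m δ → a′ + b ≤ s + m + (δ + δ) → a + δ + 1 ≤ a′ → a + b ≤ s + (m + (δ + δ))
    additive₁ a b s a′ m δ p q = lin (δ + 1) (+-mono-≤ p q) (solve (a ∷ b ∷ s ∷ a′ ∷ m ∷ δ ∷ []))

module WordMetric {c ℓ : Level} (G : Group c ℓ) {k : ℕ} (S : Fin k → Group.Carrier G) where
  open GroupLemmas G public

  ev : Word k → Γ
  ev = evalWord G S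

  WL : Γ → ℕ → Set ℓ
  WL = WordLen≤ G S

  Len : Γ → ℕ → Set ℓ
  Len g n = WL g n × (∀ m → WL g m → n ≤ m)

  ev-++ : ∀ v w → ev (v ++ w) ≈ ev v ∙ ev w
  ev-++ []                w = ≈-sym (identityˡ _)
  ev-++ ((i , true)  ∷ v) w = ≈-trans (∙-congˡ (ev-++ v w)) (≈-sym (assoc _ _ _))
  ev-++ ((i , false) ∷ v) w = ≈-trans (∙-congˡ (ev-++ v w)) (≈-sym (assoc _ _ _))

  flipOnto : Word k → Word k → Word k
  flipOnto []            w = w
  flipOnto ((i , b) ∷ v) w = flipOnto v ((i , not b) ∷ w)

  length-flipOnto : ∀ v w → length (flipOnto v w) ≡ length v + length w
  length-flipOnto []            w = refl
  length-flipOnto ((i , b) ∷ v) w = ≡.trans (length-flipOnto v _) (ℕₚ.+-suc _ _)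

  ev-flipOnto : ∀ v w → ev (flipOnto v w) ≈ ev v ⁻¹ ∙ ev w
  ev-flipOnto [] w = ≈-sym (≈-trans (∙-congʳ ε⁻¹≈ε) (identityˡ _))
  ev-flipOnto ((i , true) ∷ v) w = ≈-trans (ev-flipOnto v _)
    (group! (S i ∷ᵥ ev v ∷ᵥ ev w ∷ᵥ []ᵥ) (x₁ ⁻ · (x₀ ⁻ · x₂)) ((x₀ · x₁) ⁻ · x₂) refl)
  ev-flipOnto ((i , false) ∷ v) w = ≈-trans (ev-flipOnto v _)
    (group! (S i ∷ᵥ ev v ∷ᵥ ev w ∷ᵥ []ᵥ) (x₁ ⁻ · (x₀ · x₂)) ((x₀ ⁻ · x₁) ⁻ · x₂) refl)

  wl-resp : ∀ {g h n} → g ≈ h → WL g n → WL h n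
  wl-resp e (w , l , p) = w , l , ≈-trans p e

  wl-mono : ∀ {g m n} → m ≤ n → WL g m → WL g n
  wl-mono m≤n (w , l , p) = w , ≤-trans l m≤n , p

  wl-ε : WL ε 0
  wl-ε = [] , z≤n , ≈-refl

  wl-∙ : ∀ {g h m n} → WL g m → WL h n → WL (g ∙ h) (m + n)
  wl-∙ (v , l , p) (w , l′ , p′) = v ++ w ,
    ≤-trans (≤-reflexive (Listₚ.length-++ v)) (+-mono-≤ l l′) ,
    ≈-trans (ev-++ v w) (∙-cong p p′)

  wl-⁻¹ : ∀ {g n} → WL g n → WL (g ⁻¹) n
  wl-⁻¹ (v , l , p) = flipOnto v [] ,
    ≤-trans (≤-reflexive (≡.trans (length-flipOnto v []) (ℕₚ.+-identityʳ _))) l ,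
    ≈-trans (ev-flipOnto v []) (≈-trans (identityʳ _) (⁻¹-cong p))

  wl-pow : ∀ {g m} n → WL g m → WL (pow G g n) (n * m)
  wl-pow zero    h = wl-ε
  wl-pow (suc n) h = wl-∙ h (wl-pow n h)

  wl-unflip : ∀ {g n} → WL (g ⁻¹) n → WL g n
  wl-unflip h = wl-resp (⁻¹-involutive _) (wl-⁻¹ h)

  len-resp : ∀ {g h n} → g ≈ h → Len g n → Len h n
  len-resp e (l , lb) = wl-resp e l , λ m l′ → lb m (wl-resp (≈-sym e) l′)

  len-⁻¹ : ∀ {g n} → Len g n → Len (g ⁻¹) n
  len-⁻¹ (l , lb) = wl-⁻¹ l , λ m l′ → lb m (wl-unflip l′)

  len-∙ : ∀ {g h s a b} → Len (g ∙ h) s → Len g a → Len h b → s ≤ a + b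
  len-∙ (_ , lb) (l , _) (l′ , _) = lb _ (wl-∙ l l′)

  len-unique : ∀ {g m n} → Len g m → Len g n → m ≡ n
  len-unique (l , lb) (l′ , lb′) = ℕₚ.≤-antisym (lb _ l′) (lb′ _ l)

  letters : List (Fin k × Bool)
  letters = cartesianProduct (allFin k) (true ∷ false ∷ [])

  ∈-letters : ∀ l → l ∈ letters
  ∈-letters (i , true)  = ∈-cartesianProduct⁺ (∈-allFin i) (here refl)
  ∈-letters (i , false) = ∈-cartesianProduct⁺ (∈-allFin i) (there (here refl))

  wordsUpTo : ℕ → List (Word k)
  wordsUpTo zero    = [] ∷ []
  wordsUpTo (suc n) = [] ∷ cartesianProductWith _∷_ letters (wordsUpTo n)

  ∈-wordsUpTo : ∀ {n} w → length w ≤ n → w ∈ wordsUpTo n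
  ∈-wordsUpTo {zero}  []      l       = here refl
  ∈-wordsUpTo {suc n} []      l       = here refl
  ∈-wordsUpTo {suc n} (x ∷ w) (s≤s l) =
    there (∈-cartesianProductWith⁺ _∷_ (∈-letters x) (∈-wordsUpTo w l))

  #words : ℕ → ℕ
  #words n = length (wordsUpTo n)

  -- The pigeonhole principle acts on positions of words in a finite list, since equality of group
  -- elements need not be decidable.
  wl-pigeonhole : ∀ n (g : Fin (suc (#words n)) → Γ) → (∀ t → WL (g t) n) →
                  ∃₂ λ s t → s Fin.< t × g s ≈ g t
  wl-pigeonhole n g wl with Finₚ.pigeonhole ≤-refl (λ t → Any.index (mem t))
    where
    mem : ∀ t → proj₁ (wl t) ∈ wordsUpTo n
    mem t = ∈-wordsUpTo (proj₁ (wl t)) (proj₁ (proj₂ (wl t)))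
  ... | s , t , s<t , e = s , t , s<t , ≈-trans (≈-sym (val s)) (≈-trans (≈-reflexive (≡.cong ev same)) (val t))
    where
    mem : ∀ t → proj₁ (wl t) ∈ wordsUpTo n
    mem t = ∈-wordsUpTo (proj₁ (wl t)) (proj₁ (proj₂ (wl t)))
    val : ∀ t → ev (proj₁ (wl t)) ≈ g t
    val t = proj₂ (proj₂ (wl t))
    lookup-mem : ∀ t → proj₁ (wl t) ≡ List.lookup (wordsUpTo n) (Any.index (mem t))
    lookup-mem t = lookup-index (mem t)
    same : proj₁ (wl s) ≡ proj₁ (wl t)
    same = ≡.trans (lookup-mem s) (≡.trans (≡.cong (List.lookup (wordsUpTo n)) e) (≡.sym (lookup-mem t)))

  -- Finitely many instances of the closure condition suffice, so although each is known only
  -- up to double negation, they can all be assumed at once.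
  virtuallyCyclic : Generates G S → ∀ a n →
    (∀ x r → length r ≤ n → ¬ ¬ (∃₂ λ r′ z → length r′ ≤ n × ev (x ∷ r) ≈ ev r′ ∙ zpow G a z)) →
    ¬ ¬ VirtuallyCyclic G
  virtuallyCyclic gen a n step κ =
    ¬¬-∀Fin (λ t → push (step (proj₁ (at t)) (proj₂ (at t)))) λ steps →
      κ (a , #words n , (λ i → ev (List.lookup (wordsUpTo n) i)) , cover steps)
    where
    pairs = cartesianProduct letters (wordsUpTo n)
    at : Fin (length pairs) → (Fin k × Bool) × Word k
    at = List.lookup pairs
    Step : (Fin k × Bool) × Word k → Set ℓ
    Step (x , r) = length r ≤ n → ∃₂ λ r′ z → length r′ ≤ n × ev (x ∷ r) ≈ ev r′ ∙ zpow G a z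
    push : ∀ {p q} {P : Set p} {Q : Set q} → (P → ¬ ¬ Q) → ¬ ¬ (P → Q)
    push h κ′ = κ′ λ p → ⊥-elim (h p λ q → κ′ λ _ → q)
    module _ (steps : ∀ t → Step (at t)) where
      step′ : ∀ x r → Step (x , r)
      step′ x r l = ≡.subst Step (≡.sym (lookup-index mem)) (steps (Any.index mem)) l
        where mem = ∈-cartesianProduct⁺ (∈-letters x) (∈-wordsUpTo r l)
      normal : ∀ w → ∃₂ λ r z → length r ≤ n × ev w ≈ ev r ∙ zpow G a z
      normal [] = [] , + 0 , z≤n , ≈-sym (identityʳ _)
      normal (x ∷ w) with normal w
      ... | r , z , l , e with step′ x r l
      ... | r′ , z′ , l′ , e′ = r′ , z′ ℤ.+ z , l′ ,
        ≈-trans (∷-sound S (proj₁ x) (proj₂ x) w) (≈-trans (∙-congˡ e) (≈-trans (≈-sym (assoc _ _ _))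
        (≈-trans (∙-congʳ (≈-trans (≈-sym (∷-sound S (proj₁ x) (proj₂ x) r)) e′))
        (≈-trans (assoc _ _ _) (∙-congˡ (≈-sym (zpow-+ a z′ z)))))))
      cover : ∀ g → Σ (Fin (#words n)) λ i → Σ ℤ λ z → g ≈ ev (List.lookup (wordsUpTo n) i) ∙ zpow G a z
      cover g with gen g
      ... | _ , w , _ , e with normal w
      ... | r , z , l , e′ = Any.index mem , z , ≈-trans (≈-sym e) (≈-trans e′
          (∙-congʳ (≈-reflexive (≡.cong ev (lookup-index mem)))))
        where mem = ∈-wordsUpTo r l

-- Loxodromic elements of a hyperbolic group

module Hyperbolicity {c ℓ : Level} (G : Group c ℓ) {k : ℕ} (S : Fin k → Group.Carrier G)
    (gen : Generates G S) (δ : ℕ) (fourPoint : FourPoint G S δ) where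
  open WordMetric G S public

  -- A least bound exists only up to double negation when equality is undecidable; hence the
  -- frequent use of `≤-stable` below.
  len : ∀ g → ¬ ¬ (∃ λ n → Len g n)
  len g κ = least (proj₂ (gen g)) λ (m , l , lb) → κ (m , l , lb)

  -- If no element had length exactly `suc n`, prepending a letter could never leave the ball of
  -- radius `n`. The group would then be finite, hence virtually cyclic with `a = ε`.
  unbounded : NonElementary G → ∀ n → ¬ ¬ (∃ λ g → Len g (suc n))
  unbounded ne n κ = virtuallyCyclic gen ε n step ne
    where
    step : ∀ x r → length r ≤ n → ¬ ¬ (∃₂ λ r′ z → length r′ ≤ n × ev (x ∷ r) ≈ ev r′ ∙ zpow G ε z)
    step x r l κ′ = len (ev (x ∷ r)) λ (m , (w , lw , e) , lb) → decide m w lw e lb (m ≤? n)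
      where
      decide : ∀ m w → length w ≤ m → ev w ≈ ev (x ∷ r) → (∀ m′ → WL (ev (x ∷ r)) m′ → m ≤ m′) → Dec (m ≤ n) → ⊥
      decide m w lw e lb (yes m≤n) = κ′ (w , + 0 , ≤-trans lw m≤n , ≈-trans (≈-sym e) (≈-sym (identityʳ _)))
      decide m w lw e lb (no m≰n) = κ (ev (x ∷ r) , ((x ∷ r) , s≤s l , ≈-refl) ,
        λ m′ l′ → ≤-trans (≰⇒> m≰n) (lb m′ l′))

  -- The four-point condition at the corners of a path labelled `a`, `b`, `d`. The maximum becomes a
  -- choice because in the applications one alternative is usually impossible.
  quad : ∀ a b d {|a| |b| |d| |ab| |bd| |abd|} →
    Len a |a| → Len b |b| → Len d |d| → Len (a ∙ b) |ab| → Len (b ∙ d) |bd| → Len (a ∙ b ∙ d) |abd| →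
    (|ab| + |bd| ≤ |a| + |d| + (δ + δ)) ⊎ (|ab| + |bd| ≤ |abd| + |b| + (δ + δ))
  quad a b d {|a|} {|b|} {|d|} {|ab|} {|bd|} {|abd|} la lb ld lab lbd labd
    with ℕₚ.⊔-sel (|a| + |d|) (|abd| + |b|)
       | fourPoint ε (a ∙ b) a (a ∙ b ∙ d) _ _ _ _ _ _
           (len-resp (group! (a ∷ᵥ b ∷ᵥ d ∷ᵥ []ᵥ) (x₀ · x₁) (one ⁻ · (x₀ · x₁)) refl) lab)
           (len-resp (group! (a ∷ᵥ b ∷ᵥ d ∷ᵥ []ᵥ) (x₁ · x₂) (x₀ ⁻ · (x₀ · x₁ · x₂)) refl) lbd)
           (len-resp (group! (a ∷ᵥ b ∷ᵥ d ∷ᵥ []ᵥ) x₀ (one ⁻ · x₀) refl) la)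
           (len-resp (group! (a ∷ᵥ b ∷ᵥ d ∷ᵥ []ᵥ) x₂ ((x₀ · x₁) ⁻ · (x₀ · x₁ · x₂)) refl) ld)
           (len-resp (group! (a ∷ᵥ b ∷ᵥ d ∷ᵥ []ᵥ) (x₀ · x₁ · x₂) (one ⁻ · (x₀ · x₁ · x₂)) refl) labd)
           (len-resp (group! (a ∷ᵥ b ∷ᵥ d ∷ᵥ []ᵥ) (x₁ ⁻) ((x₀ · x₁) ⁻ · x₀) refl) (len-⁻¹ lb))
  ... | inj₁ e | h = inj₁ (≤-trans h (≤-reflexive (≡.cong (_+ (δ + δ)) e)))
  ... | inj₂ e | h = inj₂ (≤-trans h (≤-reflexive (≡.cong (_+ (δ + δ)) e)))

  -- A local criterion: after the four-point defect of 2δ is subtracted, the gap still leaves a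
  -- growth of `δ + 1` at every further power.
  Loxodromic : Γ → Set ℓ
  Loxodromic h = ∃₂ λ m n → Len h m × Len (h ∙ h) n × m + (δ + δ + δ) + 1 ≤ n

  private
    module Opposite (n : ℕ) (7δ<n : 7 * δ < n) {g h : Γ} (lg : Len g n) (lh : Len h n)
        (lgh : Len (g ⁻¹ ∙ h) (n + n)) where

      -- A short square means that `a` and its inverse leave the identity in nearly the same
      -- direction. As `b` leaves opposite to `a`, it is also nearly opposite to the inverse of `a`.
      product-long : ∀ {a b m s} → Len a n → Len b n → Len (a ⁻¹ ∙ b) (n + n) →
                     Len (a ∙ a) s → s ≤ n + (δ + δ + δ) → Len (a ∙ b) m → n + n ≤ m + (δ + δ)
      product-long {a} {b} {m} {s} la lb lab laa s≤ lm
        with quad (a ⁻¹) b ((a ∙ b) ⁻¹) (len-⁻¹ la) lb (len-⁻¹ lm) lab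
               (len-resp (group! (a ∷ᵥ b ∷ᵥ []ᵥ) (x₀ ⁻) (x₁ · (x₀ · x₁) ⁻) refl) (len-⁻¹ la))
               (len-resp (group! (a ∷ᵥ b ∷ᵥ []ᵥ) ((x₀ · x₀) ⁻) (x₀ ⁻ · x₁ · (x₀ · x₁) ⁻) refl) (len-⁻¹ laa))
      ... | inj₁ le = MetricArithmetic.two-sided n m δ le
      ... | inj₂ le = ⊥-elim (MetricArithmetic.not-backtracking n s δ le s≤ 7δ<n)

      -- One of `g`, `h`, `g ∙ h` will do. If the first two fail, `product-long` applies in both
      -- orders, the path labelled `g`, `h`, `g`, `h` hardly backtracks, and the square of `g ∙ h`
      -- is long.
      loxodromic : ¬ ¬ (∃ λ a → Loxodromic a)
      loxodromic κ =
        len (g ∙ g) λ (gg , lgg) → len (h ∙ h) λ (hh , lhh) →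
        len (g ∙ h) λ (m , lm) → len (h ∙ g) λ (m′ , lm′) →
        len (g ∙ h ∙ g) λ (t , lt) → len (g ∙ h ∙ g ∙ h) λ (q , lq) →
          choose lgg lhh lm lm′ lt lq (n + (δ + δ + δ) + 1 ≤? gg) (n + (δ + δ + δ) + 1 ≤? hh)
        where
        below : ∀ {x} → ¬ n + (δ + δ + δ) + 1 ≤ x → x ≤ n + (δ + δ + δ)
        below {x} ≰ = MetricArithmetic.below n x δ (≰⇒> ≰)
        choose : ∀ {gg hh m m′ t q} → Len (g ∙ g) gg → Len (h ∙ h) hh → Len (g ∙ h) m → Len (h ∙ g) m′ →
          Len (g ∙ h ∙ g) t → Len (g ∙ h ∙ g ∙ h) q →
          Dec (n + (δ + δ + δ) + 1 ≤ gg) → Dec (n + (δ + δ + δ) + 1 ≤ hh) → ⊥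
        choose lgg _ _ _ _ _ (yes p) _ = κ (g , n , _ , lg , lgg , p)
        choose _ lhh _ _ _ _ (no _) (yes p) = κ (h , n , _ , lh , lhh , p)
        choose {gg} {hh} {m} {m′} {t} {q} lgg lhh lm lm′ lt lq (no ¬p) (no ¬q) = turn₁ (quad g h g lg lh lg lm lm′ lt)
          where
          gh-long : n + n ≤ m + (δ + δ)
          gh-long = product-long lg lh lgh lgg (below ¬p) lm
          hg-long : n + n ≤ m′ + (δ + δ)
          hg-long = product-long lh lg (len-resp (group! (g ∷ᵥ h ∷ᵥ []ᵥ) ((x₀ ⁻ · x₁) ⁻) (x₁ ⁻ · x₀) refl) (len-⁻¹ lgh)) lhh (below ¬q) lm′
          turn₂ : m + m′ ≤ t + n + (δ + δ) → (t + m ≤ m + n + (δ + δ)) ⊎ (t + m ≤ q + n + (δ + δ)) → ⊥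
          turn₂ le (inj₁ le′) = MetricArithmetic.second-turn n m m′ t δ le le′ gh-long hg-long 7δ<n
          turn₂ le (inj₂ le′) = κ (g ∙ h , m , q , lm , len-resp (assoc _ _ _) lq ,
            MetricArithmetic.square-long n m m′ t q δ le le′ gh-long hg-long 7δ<n)
          turn₁ : (m + m′ ≤ n + n + (δ + δ)) ⊎ (m + m′ ≤ t + n + (δ + δ)) → ⊥
          turn₁ (inj₁ le) = MetricArithmetic.first-turn n m m′ δ le gh-long hg-long 7δ<n
          turn₁ (inj₂ le) = turn₂ le (quad (g ∙ h) g h lm lg lh lt lm lq)

  -- Two halves of a long geodesic, read from its midpoint, leave the identity in opposite directions.
  loxodromic-exists : NonElementary G → ¬ ¬ (∃ λ h → Loxodromic h)
  loxodromic-exists ne κ = unbounded ne (7 * δ + n) λ (g , (w , l , e) , lb) → split g w l e lb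
    where
    -- More than `7 * δ` leaves room for all defects; `suc (7 * δ + n)` is `n + n`, so `g` splits
    -- into two halves of length `n`.
    n = suc (7 * δ)
    split : ∀ g w → length w ≤ suc (7 * δ + n) → ev w ≈ g → (∀ m → WL g m → n + n ≤ m) → ⊥
    split g w l e lb = Opposite.loxodromic n ≤-refl (len-⁻¹ lu) lv
        (len-resp (group! (u ∷ᵥ v ∷ᵥ []ᵥ) (x₀ · x₁) (x₀ ⁻ ⁻ · x₁) refl) luv) κ
      where
      u = ev (take n w)
      v = ev (drop n w)
      uv≈g : u ∙ v ≈ g
      uv≈g = ≈-trans (≈-sym (ev-++ (take n w) (drop n w))) (≈-trans (≈-reflexive (≡.cong ev (Listₚ.take++drop≡id n w))) e)
      wu : WL u n
      wu = take n w , ≤-trans (≤-reflexive (Listₚ.length-take n w)) (ℕₚ.m⊓n≤m n _) , ≈-refl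
      wv : WL v n
      wv = drop n w , ≤-trans (≤-reflexive (Listₚ.length-drop n w)) (ℕₚ.m≤n+o⇒m∸n≤o (length w) n l) , ≈-refl
      lu : Len u n
      lu = wu , λ m wm → ℕₚ.+-cancelʳ-≤ n n m (lb _ (wl-resp uv≈g (wl-∙ wm wv)))
      lv : Len v n
      lv = wv , λ m wm → ℕₚ.+-cancelˡ-≤ n n m (lb _ (wl-resp uv≈g (wl-∙ wu wm)))
      luv : Len (u ∙ v) (n + n)
      luv = wl-∙ wu wv , λ m wm → lb m (wl-resp uv≈g wm)

  -- The powers of `h` form a quasi-geodesic. The property is stated in a form that passes directly
  -- to powers of `h`, see `pow-axis`.
  record Axis (h : Γ) : Set ℓ where
    field
      κ λₕ      : ℕ
      wl-h      : WL h λₕ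
      linear    : ∀ n {m} → Len (pow G h n) m → n ≤ m
      additive  : ∀ m n {a b s} → Len (pow G h m) a → Len (pow G h n) b → Len (pow G h (m + n)) s → a + b ≤ s + κ

  module _ {h : Γ} {m₁ m₂ : ℕ} (l₁ : Len h m₁) (l₂ : Len (h ∙ h) m₂) (gap : m₁ + (δ + δ + δ) + 1 ≤ m₂) where
    private
      len-ε : ∀ {x} → Len ε x → x ≤ 0
      len-ε (_ , lb) = lb 0 wl-ε

    -- By induction, applying `quad` to `h`, `h` and the `n`-th power: the first alternative
    -- contradicts the growth already known, the second gives the next step.
    pow-growth : ∀ n {x y} → Len (pow G h n) x → Len (pow G h (suc n)) y → x + δ + 1 ≤ y
    pow-growth zero {x} {y} lx ly with len-unique l₁ (len-resp (identityʳ h) ly)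
    ... | refl = MetricArithmetic.growth₀ x m₁ m₂ δ gap (len-∙ l₂ l₁ l₁) (len-ε lx)
    pow-growth (suc n) {x} {y} lx ly = ≤-stable λ ¬le → len (pow G h n) λ (z , lz) → ¬le (step lz)
      where
      step : ∀ {z} → Len (pow G h n) z → x + δ + 1 ≤ y
      step {z} lz with quad h h (pow G h n) l₁ l₁ lz l₂ lx (len-resp (≈-sym (assoc _ _ _)) ly)
      ... | inj₁ le = ⊥-elim (MetricArithmetic.growth⊥ x z m₁ m₂ δ le gap (pow-growth n lz lx))
      ... | inj₂ le = MetricArithmetic.growth₁ x y m₁ m₂ δ le gap

    pow-linear : ∀ n {m} → Len (pow G h n) m → n ≤ m
    pow-linear zero    _ = z≤n
    pow-linear (suc n) {m} lm = ≤-stable λ ¬le → len (pow G h n) λ (z , lz) →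
      ¬le (MetricArithmetic.linear-step n m z δ (pow-linear n lz) (pow-growth n lz lm))

    -- In `quad` with a single `h` between the two powers, growth on both sides excludes the first
    -- alternative; the second costs the length of `h` and one defect, which is the constant.
    pow-additive : ∀ m n {a b s} → Len (pow G h m) a → Len (pow G h n) b → Len (pow G h (m + n)) s →
                   a + b ≤ s + (m₁ + (δ + δ))
    pow-additive m zero {a} {b} {s} la lb ls
      with len-unique la (≡.subst (λ i → Len (pow G h i) s) (ℕₚ.+-identityʳ m) ls)
    ... | refl = MetricArithmetic.additive₀ a b (m₁ + (δ + δ)) (len-ε lb)
    pow-additive m (suc n) {a} {b} {s} la lb ls = ≤-stable λ ¬le →
      len (pow G h n) λ (z , lz) → len (pow G h (suc m)) λ (a′ , la′) → ¬le (step lz la′)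
      where
      step : ∀ {z a′} → Len (pow G h n) z → Len (pow G h (suc m)) a′ → a + b ≤ s + (m₁ + (δ + δ))
      step {z} {a′} lz la′ with quad (pow G h m) h (pow G h n) la l₁ lz
             (len-resp (≈-trans (∙-congʳ (≈-sym (identityʳ h))) (≈-trans (pow-comm h 1 m) (∙-congˡ (identityʳ h)))) la′)
             lb (len-resp (≈-trans (pow-+ h m (suc n)) (≈-sym (assoc _ _ _))) ls)
      ... | inj₁ le = ⊥-elim (MetricArithmetic.additive⊥ a b z a′ δ le (pow-growth m la la′) (pow-growth n lz lb))
      ... | inj₂ le = MetricArithmetic.additive₁ a b s a′ m₁ δ le (pow-growth m la la′)

    axis : Axis h
    axis = record { κ = m₁ + (δ + δ) ; λₕ = m₁ ; wl-h = proj₁ l₁ ; linear = pow-linear ; additive = pow-additive }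

-- Nearest-point projection to the quasi-line of powers of `h`

module LineArithmetic where
  abstract
    away-near : ∀ p r s K δ → p ≤ r → s ≤ K → p + s ≤ r + (K + (δ + δ))
    away-near p r s K δ a b = lin (δ + δ) (+-mono-≤ a b) (solve (p ∷ r ∷ s ∷ K ∷ δ ∷ []))

    away-⊥ : ∀ p q s b d κ δ → q + s ≤ p + d + (δ + δ) → p ≤ q → b + d ≤ s + κ → κ + (δ + δ) + 1 ≤ b → ⊥
    away-⊥ p q s b d κ δ u v w x = lin⊥ 0 (+-mono-≤ (+-mono-≤ u v) (+-mono-≤ w x)) (solve (p ∷ q ∷ s ∷ b ∷ d ∷ κ ∷ δ ∷ []))

    away-far : ∀ p q r s b K δ → q + s ≤ r + b + (δ + δ) → p ≤ q → b ≤ K → p + s ≤ r + (K + (δ + δ))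
    away-far p q r s b K δ u v w = lin 0 (+-mono-≤ u (+-mono-≤ v w)) (solve (p ∷ q ∷ r ∷ s ∷ b ∷ K ∷ δ ∷ []))

    bottleneck-⊥ : ∀ A B d r q K δ D → A + d ≤ r + K → B + d ≤ q + K → r + q ≤ A + B + (δ + δ) → D ≤ d → suc (K + δ) ≤ D → ⊥
    bottleneck-⊥ A B d r q K δ D u v w x y = lin⊥ 1 (+-mono-≤ (+-mono-≤ u v) (+-mono-≤ w (+-mono-≤ (+-mono-≤ x y) (+-mono-≤ x y))))
      (solve (A ∷ B ∷ d ∷ r ∷ q ∷ K ∷ δ ∷ D ∷ []))

    bottleneck-≤ : ∀ A B d r q K δ P → A + d ≤ r + K → B + d ≤ q + K → r + q ≤ P + d + (δ + δ) → A + B + d ≤ P + (K + K + (δ + δ))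
    bottleneck-≤ A B d r q K δ P u v w = lin 0 (+-mono-≤ (+-mono-≤ u v) w) (solve (A ∷ B ∷ d ∷ r ∷ q ∷ K ∷ δ ∷ P ∷ []))

    lip-far : ∀ A B d D P P′ K → A + B + d ≤ P′ + K → D ≤ d → P′ ≤ P → D ≤ P + K
    lip-far A B d D P P′ K u v w = lin (A + B) (+-mono-≤ u (+-mono-≤ v w)) (solve (A ∷ B ∷ d ∷ D ∷ P ∷ P′ ∷ K ∷ []))

    lip-near : ∀ D P K δ → D ≤ K + δ → D ≤ P + (K + K + (δ + δ))
    lip-near D P K δ u = lin (P + K + δ) u (solve (D ∷ P ∷ K ∷ δ ∷ []))

    nearer : ∀ A B d D P K → A + B + d ≤ P + K → D ≤ d → suc K ≤ D → suc A ≤ P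
    nearer A B d D P K u v w = lin B (+-mono-≤ u (+-mono-≤ v w)) (solve (A ∷ B ∷ d ∷ D ∷ P ∷ K ∷ []))

    3K⇒K : ∀ K δ D → suc (K + K + (δ + δ)) ≤ D → suc (K + δ) ≤ D
    3K⇒K K δ D u = lin (K + δ) u (solve (K ∷ δ ∷ D ∷ []))

    between : ∀ e s s₁ s₂ r₁ r₂ K → e + s₁ ≤ r₁ + K → e + s₂ ≤ r₂ + K → s ≤ s₁ + s₂ → e + e + s ≤ r₁ + r₂ + (K + K)
    between e s s₁ s₂ r₁ r₂ K u v w = lin 0 (+-mono-≤ (+-mono-≤ u v) w) (solve (e ∷ s ∷ s₁ ∷ s₂ ∷ r₁ ∷ r₂ ∷ K ∷ []))

    follow-⊥₁ : ∀ α α₂ r₁ x κ δ → r₁ + α₂ ≤ α + x + (δ + δ) → α ≤ r₁ + x → α + α ≤ α₂ + κ →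
      x + κ + (δ + δ + (δ + δ)) + 1 ≤ α → ⊥
    follow-⊥₁ α α₂ r₁ x κ δ u v w y = lin⊥ (κ + 6 * δ + 1) (+-mono-≤ (+-mono-≤ u v) (+-mono-≤ w (+-mono-≤ y y)))
      (solve (α ∷ α₂ ∷ r₁ ∷ x ∷ κ ∷ δ ∷ []))

    follow-⊥₂ : ∀ α α₂ r₁ r₂ ρ x κ δ → r₁ + α₂ ≤ α + ρ + (δ + δ) → r₂ + ρ ≤ r₁ + x + (δ + δ) → α + α ≤ α₂ + κ →
      x + κ + (δ + δ + (δ + δ)) + 1 ≤ α → ⊥
    follow-⊥₂ α α₂ r₁ r₂ ρ x κ δ u v w y = lin⊥ r₂ (+-mono-≤ (+-mono-≤ u v) (+-mono-≤ w y))
      (solve (α ∷ α₂ ∷ r₁ ∷ r₂ ∷ ρ ∷ x ∷ κ ∷ δ ∷ []))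

    follow : ∀ α α₂ r₁ r₂ ρ s e K κ δ → r₁ + α₂ ≤ α + ρ + (δ + δ) → r₂ + ρ ≤ α + s + (δ + δ) → α + α ≤ α₂ + κ →
      e + e + s ≤ r₁ + r₂ + (K + K) → e ≤ κ + (δ + δ + (δ + δ)) + (K + K)
    follow α α₂ r₁ r₂ ρ s e K κ δ u v w y = lin e (+-mono-≤ (+-mono-≤ u v) (+-mono-≤ w y))
      (solve (α ∷ α₂ ∷ r₁ ∷ r₂ ∷ ρ ∷ s ∷ e ∷ K ∷ κ ∷ δ ∷ []))

    i+[j-i] : ∀ i j → i ℤ.+ (j ℤ.- i) ≡ j
    i+[j-i] i j = ℤ-Solver.solve (i ∷ j ∷ [])

    j+-[j-i] : ∀ i j → j ℤ.+ ℤ.- (j ℤ.- i) ≡ i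
    j+-[j-i] i j = ℤ-Solver.solve (i ∷ j ∷ [])

    -[k-j]+[l-j] : ∀ j k l → ℤ.- (k ℤ.- j) ℤ.+ (l ℤ.- j) ≡ l ℤ.- k
    -[k-j]+[l-j] j k l = ℤ-Solver.solve (j ∷ k ∷ l ∷ [])

    i+[-i+-i] : ∀ i → i ℤ.+ (ℤ.- i ℤ.+ ℤ.- i) ≡ ℤ.- i
    i+[-i+-i] i = ℤ-Solver.solve (i ∷ [])

    -i-i : ∀ i → ℤ.- i ℤ.- i ≡ ℤ.- i ℤ.+ ℤ.- i
    -i-i i = ℤ-Solver.solve (i ∷ [])

    ∣i+i∣ : ∀ i → ∣ i ℤ.+ i ∣ ≡ ∣ i ∣ + ∣ i ∣
    ∣i+i∣ (+ n)    = refl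
    ∣i+i∣ -[1+ n ] = ≡.cong suc (≡.sym (ℕₚ.+-suc n n))

    ∣-∣-split : ∀ D t → t ≤ ∣ D ∣ → ∃₂ λ i j → D ≡ i ℤ.+ j × ∣ i ∣ ≡ t × ∣ D ∣ ≡ ∣ i ∣ + ∣ j ∣
    ∣-∣-split (+ n) t t≤ = + t , + (n ∸ t) , ≡.cong +_ (≡.sym (ℕₚ.m+[n∸m]≡n t≤)) , refl , ≡.sym (ℕₚ.m+[n∸m]≡n t≤)
    ∣-∣-split -[1+ n ] t t≤ = ℤ.- + t , ℤ.- + (suc n ∸ t) ,
      ≡.trans (≡.cong (λ k → ℤ.- + k) (≡.sym (ℕₚ.m+[n∸m]≡n t≤))) (ℤₚ.neg-distrib-+ (+ t) (+ (suc n ∸ t))) ,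
      ℤₚ.∣-i∣≡∣i∣ (+ t) ,
      ≡.trans (≡.sym (ℕₚ.m+[n∸m]≡n t≤)) (≡.sym (≡.cong₂ _+_ (ℤₚ.∣-i∣≡∣i∣ (+ t)) (ℤₚ.∣-i∣≡∣i∣ (+ (suc n ∸ t)))))

    n≤∣a*n∣ : ∀ a n → a ≢ + 0 → n ≤ ∣ a ℤ.* + n ∣
    n≤∣a*n∣ a n a≢0 = ≤-trans (≤-trans (≤-reflexive (≡.sym (ℕₚ.*-identityˡ n))) (ℕₚ.*-monoˡ-≤ n (ℕₚ.n≢0⇒n>0 λ e → a≢0 (ℤₚ.∣i∣≡0⇒i≡0 e))))
      (≤-reflexive (≡.sym (ℤₚ.abs-* a (+ n))))

module Line {c ℓ : Level} (G : Group c ℓ) {k : ℕ} (S : Fin k → Group.Carrier G)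
    (gen : Generates G S) (δ : ℕ) (fourPoint : FourPoint G S δ)
    (h : Group.Carrier G) (ax : Hyperbolicity.Axis G S gen δ fourPoint h) where
  open Hyperbolicity G S gen δ fourPoint public
  open Axis ax public
  open LineArithmetic
  open import Relation.Binary.Reasoning.Setoid setoid

  zp : ℤ → Γ
  zp = zpow G h

  zp-+ : ∀ i j → zp (i ℤ.+ j) ≈ zp i ∙ zp j
  zp-+ = zpow-+ h

  len-zp⇒pow : ∀ i {n} → Len (zp i) n → Len (pow G h ∣ i ∣) n
  len-zp⇒pow (+ n)    l = l
  len-zp⇒pow -[1+ n ] l = len-resp (⁻¹-involutive _) (len-⁻¹ l)

  zp-neg : ∀ i {n} → Len (zp i) n → Len (zp (ℤ.- i)) n
  zp-neg i l = len-resp (≈-sym (zpow-neg h i)) (len-⁻¹ l)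

  zp-linear : ∀ i {n} → Len (zp i) n → ∣ i ∣ ≤ n
  zp-linear i l = linear ∣ i ∣ (len-zp⇒pow i l)

  zp-upper : ∀ i {n} → Len (zp i) n → n ≤ ∣ i ∣ * λₕ
  zp-upper i l = proj₂ (len-zp⇒pow i l) _ (wl-pow ∣ i ∣ wl-h)

  zp-additive : ∀ i j {a b s} → ∣ i ℤ.+ j ∣ ≡ ∣ i ∣ + ∣ j ∣ → Len (zp i) a → Len (zp j) b → Len (zp (i ℤ.+ j)) s → a + b ≤ s + κ
  zp-additive i j {s = s} e la lb ls = additive ∣ i ∣ ∣ j ∣ (len-zp⇒pow i la) (len-zp⇒pow j lb)
    (≡.subst (λ n → Len (pow G h n) s) e (len-zp⇒pow (i ℤ.+ j) ls))

  -- The projection of a point x to the line y⟨h⟩ is y hⁱ, at distance n, when Near (x⁻¹ ∙ y) i n.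
  record Near (u : Γ) (i : ℤ) (n : ℕ) : Set ℓ where
    constructor nearest
    field
      point   : WL (u ∙ zp i) n
      minimal : ∀ j m → WL (u ∙ zp j) m → n ≤ m
  open Near public

  near-len : ∀ {u i n} → Near u i n → Len (u ∙ zp i) n
  near-len {i = i} (nearest l lb) = l , lb i

  near : ∀ u → ¬ ¬ (∃₂ λ i n → Near u i n)
  near u κ′ = least {P = λ n → ∃ λ i → WL (u ∙ zp i) n} (+ 0 , proj₂ (gen (u ∙ zp (+ 0)))) λ (n , (i , l) , lb) →
    κ′ (i , n , nearest l λ j m l′ → lb m (j , l′))

  near-resp : ∀ {u v i n} → u ≈ v → Near u i n → Near v i n
  near-resp e (nearest l lb) = nearest (wl-resp (∙-congʳ e) l) λ j m l′ → lb j m (wl-resp (∙-congʳ (≈-sym e)) l′)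

  near-shift : ∀ {u i n} d → Near u i n → Near (u ∙ zp d) (i ℤ.- d) n
  near-shift {u} {i} d (nearest l lb) = nearest
    (wl-resp (≈-trans (∙-congˡ (≈-trans (≈-reflexive (≡.cong zp (≡.sym (i+[j-i] d i)))) (zp-+ d _))) (≈-sym (assoc _ _ _))) l)
    λ j m l′ → lb (d ℤ.+ j) m (wl-resp (≈-trans (assoc _ _ _) (∙-congˡ (≈-sym (zp-+ d j)))) l′)

  -- By linear growth a power with exponent `s₀` is longer than `κ + (δ + δ)`, which decides the
  -- alternative in `away`; `K₁` bounds its length plus a defect. `KE` is the distance from ⟨h⟩
  -- within which its commensurator stays.
  s₀ K₁ K₃ KE : ℕ
  s₀ = κ + (δ + δ) + 1
  K₁ = s₀ * λₕ + (δ + δ)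
  K₃ = K₁ + K₁ + (δ + δ)
  KE = κ + (δ + δ + (δ + δ)) + (K₁ + K₁)

  -- From the nearest point on, distance to the line and length along it add up. `D` is cut after
  -- `s₀` steps: since `p` is minimal, the first alternative of `quad` would make the first piece
  -- shorter than `linear` allows.
  away : ∀ {u i p} → Near u i p → ∀ D {r s} → Len (u ∙ zp (i ℤ.+ D)) r → Len (zp D) s → p + s ≤ r + K₁
  away {u} {i} {p} nr D {r} {s} lr ls with ∣ D ∣ ≤? s₀
  ... | yes D≤ = away-near p r s (s₀ * λₕ) δ (minimal nr (i ℤ.+ D) r (proj₁ lr)) (≤-trans (zp-upper D ls) (ℕₚ.*-monoˡ-≤ λₕ D≤))
  ... | no D≰ = far (∣-∣-split D s₀ (ℕₚ.<⇒≤ (≰⇒> D≰)))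
    where
    far : (∃₂ λ D₁ D₂ → D ≡ D₁ ℤ.+ D₂ × ∣ D₁ ∣ ≡ s₀ × ∣ D ∣ ≡ ∣ D₁ ∣ + ∣ D₂ ∣) → p + s ≤ r + K₁
    far (D₁ , D₂ , refl , e₁ , e₂) = ≤-stable λ ¬le →
      len (zp D₁) λ (b , lb) → len (zp D₂) λ (d , ld) → len (u ∙ zp i ∙ zp D₁) λ (q , lq) → ¬le (step lb ld lq)
      where
      step : ∀ {b d q} → Len (zp D₁) b → Len (zp D₂) d → Len (u ∙ zp i ∙ zp D₁) q → p + s ≤ r + K₁
      step {b} {d} {q} lb ld lq with quad (u ∙ zp i) (zp D₁) (zp D₂) (near-len nr) lb ld lq (len-resp (zp-+ D₁ D₂) ls)
             (len-resp (≈-trans (∙-congˡ (≈-trans (zp-+ i _) (∙-congˡ (zp-+ D₁ D₂))))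
                (group! (u ∷ᵥ zp i ∷ᵥ zp D₁ ∷ᵥ zp D₂ ∷ᵥ []ᵥ) (x₀ · (x₁ · (x₂ · x₃))) (x₀ · x₁ · x₂ · x₃) refl)) lr)
         | minimal nr (i ℤ.+ D₁) q (wl-resp (≈-trans (assoc _ _ _) (∙-congˡ (≈-sym (zp-+ i D₁)))) (proj₁ lq))
      ... | inj₁ le | p≤q = ⊥-elim (away-⊥ p q s b d κ δ le p≤q (zp-additive D₁ D₂ e₂ lb ld ls)
              (≤-trans (≤-reflexive (≡.sym e₁)) (zp-linear D₁ lb)))
      ... | inj₂ le | p≤q = away-far p q r s b (s₀ * λₕ) δ le p≤q
              (≤-trans (zp-upper D₁ lb) (≤-reflexive (≡.cong (_* λₕ) e₁)))

  -- Between points with distant projections the shortest way is, up to `K₃`, to go to the line,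
  -- along it and away again. Both estimates come from `away`, applied at either end.
  bottleneck : ∀ {u x i i′ A B P d} → Near u i A → Near (x ∙ u) i′ B → Len x P →
    Len (zp (i′ ℤ.- i)) d → K₁ + δ < ∣ i′ ℤ.- i ∣ → A + B + d ≤ P + K₃
  bottleneck {u} {x} {i} {i′} {A} {B} {P} {d} nu nxu lx ld K<D = ≤-stable λ ¬le →
    len (u ∙ zp i′) λ (r , lr) → len (x ∙ u ∙ zp i) λ (q , lq) → ¬le (step lr lq)
    where
    D = i′ ℤ.- i
    i+D : zp i ∙ zp D ≈ zp i′
    i+D = ≈-trans (≈-sym (zp-+ i D)) (≈-reflexive (≡.cong zp (i+[j-i] i i′)))
    step : ∀ {r q} → Len (u ∙ zp i′) r → Len (x ∙ u ∙ zp i) q → A + B + d ≤ P + K₃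
    step {r} {q} lr lq = conclude
      (quad (u ∙ zp i) (zp D) ((x ∙ u ∙ zp i′) ⁻¹) (near-len nu) ld (len-⁻¹ (near-len nxu))
        (len-resp (≈-sym (≈-trans (assoc _ _ _) (∙-congˡ i+D))) lr)
        (len-resp (≈-trans (group! (u ∷ᵥ x ∷ᵥ zp i ∷ᵥ zp D ∷ᵥ []ᵥ) ((x₁ · x₀ · x₂) ⁻) (x₃ · (x₁ · x₀ · (x₂ · x₃)) ⁻) refl)
          (∙-congˡ (⁻¹-cong (∙-congˡ i+D)))) (len-⁻¹ lq))
        (len-resp (≈-trans (group! (u ∷ᵥ x ∷ᵥ zp i ∷ᵥ zp D ∷ᵥ []ᵥ) (x₁ ⁻) (x₀ · x₂ · x₃ · (x₁ · x₀ · (x₂ · x₃)) ⁻) refl)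
          (∙-congˡ (⁻¹-cong (∙-congˡ i+D)))) (len-⁻¹ lx)))
      where
      A+d : A + d ≤ r + K₁
      A+d = away nu D (≡.subst (λ j → Len (u ∙ zp j) r) (≡.sym (i+[j-i] i i′)) lr) ld
      B+d : B + d ≤ q + K₁
      B+d = away nxu (ℤ.- D) (≡.subst (λ j → Len (x ∙ u ∙ zp j) q) (≡.sym (j+-[j-i] i i′)) lq) (zp-neg D ld)
      conclude : (r + q ≤ A + B + (δ + δ)) ⊎ (r + q ≤ P + d + (δ + δ)) → A + B + d ≤ P + K₃
      conclude (inj₁ le) = ⊥-elim (bottleneck-⊥ A B d r q K₁ δ ∣ D ∣ A+d B+d le (zp-linear D ld) K<D)
      conclude (inj₂ le) = bottleneck-≤ A B d r q K₁ δ P A+d B+d le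

  lipschitz : ∀ {u x i i′ A B P} → Near u i A → Near (x ∙ u) i′ B → WL x P → ∣ i′ ℤ.- i ∣ ≤ P + K₃
  lipschitz {u} {x} {i} {i′} {A} {B} {P} nu nxu wx with ∣ i′ ℤ.- i ∣ ≤? K₁ + δ
  ... | yes le = lip-near _ P K₁ δ le
  ... | no ≰ = ≤-stable λ ¬le → len x λ (P′ , lx) → len (zp (i′ ℤ.- i)) λ (d , ld) →
    ¬le (lip-far A B d _ P P′ K₃ (bottleneck nu nxu lx ld (≰⇒> ≰)) (zp-linear (i′ ℤ.- i) ld) (proj₂ lx P wx))

  projection-nearer : ∀ {u x i i′ A B P} → Near u i A → Near (x ∙ u) i′ B → WL x P → K₃ < ∣ i′ ℤ.- i ∣ → A < P
  projection-nearer {u} {x} {i} {i′} {A} {B} {P} nu nxu wx far = ≤-stable λ ¬le →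
    len x λ (P′ , lx) → len (zp (i′ ℤ.- i)) λ (d , ld) →
    ¬le (≤-trans (nearer A B d _ P′ K₃ (bottleneck nu nxu lx ld (3K⇒K K₁ δ _ far)) (zp-linear (i′ ℤ.- i) ld) far) (proj₂ lx P wx))

  between-near : ∀ {u j e} k₁ k₂ {r₁ r₂ s} → Near u j e → Len (u ∙ zp k₁) r₁ → Len (u ∙ zp k₂) r₂ → Len (zp (k₂ ℤ.- k₁)) s →
    e + e + s ≤ r₁ + r₂ + (K₁ + K₁)
  between-near {u} {j} {e} k₁ k₂ {r₁} {r₂} {s} nu l₁ l₂ ls = ≤-stable λ ¬le →
    len (zp (k₁ ℤ.- j)) λ (s₁ , ls₁) → len (zp (k₂ ℤ.- j)) λ (s₂ , ls₂) →
    ¬le (between e s s₁ s₂ r₁ r₂ K₁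
      (away nu (k₁ ℤ.- j) (≡.subst (λ i → Len (u ∙ zp i) r₁) (≡.sym (i+[j-i] j k₁)) l₁) ls₁)
      (away nu (k₂ ℤ.- j) (≡.subst (λ i → Len (u ∙ zp i) r₂) (≡.sym (i+[j-i] j k₂)) l₂) ls₂)
      (len-∙ (len-resp (≈-trans (≈-reflexive (≡.cong zp (≡.sym (-[k-j]+[l-j] j k₁ k₂)))) (zp-+ (ℤ.- (k₁ ℤ.- j)) _)) ls) (zp-neg (k₁ ℤ.- j) ls₁) ls₂))

  -- The bound must not depend on `x`. Far out, the translate of the line by `x` has both ends
  -- within the length of `x` of the line; on a long segment this displacement is no longer felt in
  -- the middle, where `x` lies.
  intertwiner-near : ∀ {x j e} a b → a ≢ + 0 → x ∙ zp a ≈ zp b ∙ x → Near (x ⁻¹) j e → e ≤ KE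
  intertwiner-near {x} {j} {e} a b a≢0 comm nx = ≤-stable λ ¬le → len x λ (P , lx) → main P lx ¬le
    where
    main : ∀ P → Len x P → ¬ ¬ (e ≤ KE)
    main P lx ¬le =
      len (zp A) λ (α , lα) → len (zp (ℤ.- A ℤ.+ ℤ.- A)) λ (α₂ , lα₂) →
      len (x ⁻¹ ∙ zp B) λ (r₁ , lr₁) → len (x ⁻¹ ∙ zp (ℤ.- B)) λ (r₂ , lr₂) →
      len (x ∙ zp (ℤ.- A ℤ.+ ℤ.- A)) λ (ρ , lρ) → len (zp (ℤ.- B ℤ.+ ℤ.- B)) λ (s , ls) →
      ¬le (step lα lα₂ lr₁ lr₂ lρ ls)
      where
      -- With `a ≢ + 0` and linear growth, the half segment is at least this long, which absorbs `P`
      -- and excludes the wrong alternatives of `quad₁` and `quad₂`.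
      n = P + κ + (δ + δ + (δ + δ)) + 1
      A = a ℤ.* + n
      B = b ℤ.* + n
      comm₊ : x ∙ zp A ≈ zp B ∙ x
      comm₊ = begin
        x ∙ zp A            ≈⟨ ∙-congˡ (zpow-*-pow h a n) ⟨
        x ∙ pow G (zp a) n  ≈⟨ intertwine-pow n comm ⟩
        pow G (zp b) n ∙ x  ≈⟨ ∙-congʳ (zpow-*-pow h b n) ⟩
        zp B ∙ x            ∎
      comm₋ : x ∙ zp (ℤ.- A) ≈ zp (ℤ.- B) ∙ x
      comm₋ = begin
        x ∙ zp (ℤ.- A)      ≈⟨ ∙-congˡ (zpow-neg h A) ⟩
        x ∙ zp A ⁻¹         ≈⟨ intertwine-inv comm₊ ⟩
        zp B ⁻¹ ∙ x         ≈⟨ ∙-congʳ (zpow-neg h B) ⟨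
        zp (ℤ.- B) ∙ x      ∎
      comm₋₂ : x ∙ zp (ℤ.- A ℤ.+ ℤ.- A) ≈ zp (ℤ.- B ℤ.+ ℤ.- B) ∙ x
      comm₋₂ = begin
        x ∙ zp (ℤ.- A ℤ.+ ℤ.- A)        ≈⟨ ∙-congˡ (zp-+ (ℤ.- A) (ℤ.- A)) ⟩
        x ∙ (zp (ℤ.- A) ∙ zp (ℤ.- A))   ≈⟨ intertwine-∙ comm₋ comm₋ ⟩
        zp (ℤ.- B) ∙ zp (ℤ.- B) ∙ x     ≈⟨ ∙-congʳ (zp-+ (ℤ.- B) (ℤ.- B)) ⟨
        zp (ℤ.- B ℤ.+ ℤ.- B) ∙ x        ∎
      zpA∙x⁻¹ : x ⁻¹ ∙ zp B ≈ zp A ∙ x ⁻¹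
      zpA∙x⁻¹ = begin
        x ⁻¹ ∙ zp B                   ≈⟨ group! (x ∷ᵥ zp B ∷ᵥ []ᵥ) (x₀ ⁻ · x₁) (x₀ ⁻ · (x₁ · x₀) · x₀ ⁻) refl ⟩
        x ⁻¹ ∙ (zp B ∙ x) ∙ x ⁻¹      ≈⟨ ∙-congʳ (∙-congˡ comm₊) ⟨
        x ⁻¹ ∙ (x ∙ zp A) ∙ x ⁻¹      ≈⟨ group! (x ∷ᵥ zp A ∷ᵥ []ᵥ) (x₀ ⁻ · (x₀ · x₁) · x₀ ⁻) (x₁ · x₀ ⁻) refl ⟩
        zp A ∙ x ⁻¹                   ∎
      A-2A : zp A ∙ zp (ℤ.- A ℤ.+ ℤ.- A) ≈ zp (ℤ.- A)
      A-2A = ≈-trans (≈-sym (zp-+ A _)) (≈-reflexive (≡.cong zp (i+[-i+-i] A)))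
      B-2B : zp B ∙ zp (ℤ.- B ℤ.+ ℤ.- B) ≈ zp (ℤ.- B)
      B-2B = ≈-trans (≈-sym (zp-+ B _)) (≈-reflexive (≡.cong zp (i+[-i+-i] B)))
      module _ {α α₂ r₁ r₂ ρ s : ℕ} (lα : Len (zp A) α) (lα₂ : Len (zp (ℤ.- A ℤ.+ ℤ.- A)) α₂)
          (lr₁ : Len (x ⁻¹ ∙ zp B) r₁) (lr₂ : Len (x ⁻¹ ∙ zp (ℤ.- B)) r₂)
          (lρ : Len (x ∙ zp (ℤ.- A ℤ.+ ℤ.- A)) ρ) (ls : Len (zp (ℤ.- B ℤ.+ ℤ.- B)) s) where
        quad₁ : (r₁ + α₂ ≤ α + ρ + (δ + δ)) ⊎ (r₁ + α₂ ≤ α + P + (δ + δ))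
        quad₁ = quad (zp A) (x ⁻¹) (x ∙ zp (ℤ.- A ℤ.+ ℤ.- A)) lα (len-⁻¹ lx) lρ
          (len-resp zpA∙x⁻¹ lr₁)
          (len-resp (group! (x ∷ᵥ zp (ℤ.- A ℤ.+ ℤ.- A) ∷ᵥ []ᵥ) x₁ (x₀ ⁻ · (x₀ · x₁)) refl) lα₂)
          (len-resp (≈-trans (≈-sym A-2A) (group! (x ∷ᵥ zp (ℤ.- A ℤ.+ ℤ.- A) ∷ᵥ zp A ∷ᵥ []ᵥ) (x₂ · x₁) (x₂ · x₀ ⁻ · (x₀ · x₁)) refl)) (zp-neg A lα))
        quad₂ : (r₂ + ρ ≤ r₁ + P + (δ + δ)) ⊎ (r₂ + ρ ≤ α + s + (δ + δ))
        quad₂ = quad (x ⁻¹ ∙ zp B) (zp (ℤ.- B ℤ.+ ℤ.- B)) x lr₁ ls lx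
          (len-resp (≈-trans (∙-congˡ (≈-sym B-2B)) (≈-sym (assoc _ _ _))) lr₂)
          (len-resp comm₋₂ lρ)
          (len-resp (begin
            zp (ℤ.- A)                                   ≈⟨ group! (x ∷ᵥ zp (ℤ.- A) ∷ᵥ []ᵥ) x₁ (x₀ ⁻ · (x₀ · x₁)) refl ⟩
            x ⁻¹ ∙ (x ∙ zp (ℤ.- A))                      ≈⟨ ∙-congˡ comm₋ ⟩
            x ⁻¹ ∙ (zp (ℤ.- B) ∙ x)                      ≈⟨ ∙-congˡ (∙-congʳ B-2B) ⟨
            x ⁻¹ ∙ (zp B ∙ zp (ℤ.- B ℤ.+ ℤ.- B) ∙ x)     ≈⟨ group! (x ∷ᵥ zp B ∷ᵥ zp (ℤ.- B ℤ.+ ℤ.- B) ∷ᵥ []ᵥ) (x₀ ⁻ · (x₁ · x₂ · x₀)) (x₀ ⁻ · x₁ · x₂ · x₀) refl ⟩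
            x ⁻¹ ∙ zp B ∙ zp (ℤ.- B ℤ.+ ℤ.- B) ∙ x       ∎) (zp-neg A lα))
        big : n ≤ α
        big = ≤-trans (n≤∣a*n∣ a n a≢0) (zp-linear A lα)
        2α : α + α ≤ α₂ + κ
        2α = zp-additive (ℤ.- A) (ℤ.- A) (∣i+i∣ (ℤ.- A)) (zp-neg A lα) (zp-neg A lα) lα₂
        α≤ : α ≤ r₁ + P
        α≤ = len-∙ (len-resp (group! (x ∷ᵥ zp A ∷ᵥ []ᵥ) x₁ (x₁ · x₀ ⁻ · x₀) refl) lα) (len-resp zpA∙x⁻¹ lr₁) lx
        2e : e + e + s ≤ r₁ + r₂ + (K₁ + K₁)
        2e = between-near B (ℤ.- B) nx lr₁ lr₂ (≡.subst (λ i → Len (zp i) s) (≡.sym (-i-i B)) ls)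
        step : e ≤ KE
        step with quad₁ | quad₂
        ... | inj₂ le | _        = ⊥-elim (follow-⊥₁ α α₂ r₁ P κ δ le α≤ 2α big)
        ... | inj₁ le | inj₁ le′ = ⊥-elim (follow-⊥₂ α α₂ r₁ r₂ ρ P κ δ le le′ 2α big)
        ... | inj₁ le | inj₂ le′ = follow α α₂ r₁ r₂ ρ s e K₁ κ δ le le′ 2α 2e

-- The commensurator of ⟨h⟩, and a power of `h` central in it

¬¬-All : ∀ {a p} {A : Set a} {P : A → Set p} → (∀ x → ¬ ¬ P x) → ∀ xs → ¬ ¬ All P xs
¬¬-All h []       κ = κ All.[]
¬¬-All h (x ∷ xs) κ = h x λ px → ¬¬-All h xs λ pxs → κ (px All.∷ pxs)

common-multiple : ∀ {a p} {A : Set a} (Q : A → ℕ → Set p) →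
  (∀ {x} m n → Q x m → Q x (n * m)) →
  ∀ {xs} → All (λ x → ∃ λ l → Q x (suc l)) xs → ∃ λ l → All (λ x → Q x (suc l)) xs
common-multiple Q mult All.[] = 0 , All.[]
common-multiple Q mult ((l , q) All.∷ rest) with common-multiple Q mult rest
... | m , qs = m + l * suc m ,
  ≡.subst (Q _) (ℕₚ.*-comm (suc m) (suc l)) (mult (suc l) (suc m) q) All.∷ All.map (mult (suc m) (suc l)) qs

module IndexArithmetic where
  abstract
    dist-sym : ∀ i j → ∣ i ℤ.- j ∣ ≡ ∣ j ℤ.- i ∣
    dist-sym = ℤₚ.∣i-j∣≡∣j-i∣

    dist-tri : ∀ i j l → ∣ i ℤ.- l ∣ ≤ ∣ i ℤ.- j ∣ + ∣ j ℤ.- l ∣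
    dist-tri i j l = ≤-trans (≤-reflexive (≡.cong ∣_∣ (eq i j l))) (ℤₚ.∣i+j∣≤∣i∣+∣j∣ (i ℤ.- j) (j ℤ.- l))
      where
      eq : ∀ i j l → i ℤ.- l ≡ (i ℤ.- j) ℤ.+ (j ℤ.- l)
      eq i j l = ℤ-Solver.solve (i ∷ j ∷ l ∷ [])

    [i+D₁+D₂]-D₂ : ∀ i i′ D₁ D₂ → i′ ℤ.- i ≡ D₁ ℤ.+ D₂ → i′ ℤ.+ ℤ.- D₂ ≡ i ℤ.+ D₁
    [i+D₁+D₂]-D₂ i i′ D₁ D₂ e = ≡.trans (eq₁ i i′ D₂) (≡.trans (≡.cong (λ d → i ℤ.+ d ℤ.+ ℤ.- D₂) e) (eq₂ i D₁ D₂))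
      where
      eq₁ : ∀ i i′ D₂ → i′ ℤ.+ ℤ.- D₂ ≡ i ℤ.+ (i′ ℤ.- i) ℤ.+ ℤ.- D₂
      eq₁ i i′ D₂ = ℤ-Solver.solve (i ∷ i′ ∷ D₂ ∷ [])
      eq₂ : ∀ i D₁ D₂ → i ℤ.+ (D₁ ℤ.+ D₂) ℤ.+ ℤ.- D₂ ≡ i ℤ.+ D₁
      eq₂ i D₁ D₂ = ℤ-Solver.solve (i ∷ D₁ ∷ D₂ ∷ [])

    follows-line : ∀ e P r₁ r₂ A B d₁ d₂ d κ K K₃ → e + e + P ≤ r₁ + r₂ + (K + K) → r₁ ≤ A + d₁ → r₂ ≤ B + d₂ →
      d₁ + d₂ ≤ d + κ → A + B + d ≤ P + K₃ → e ≤ K₃ + κ + (K + K)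
    follows-line e P r₁ r₂ A B d₁ d₂ d κ K K₃ a b u v w =
      lin e (+-mono-≤ (+-mono-≤ a b) (+-mono-≤ u (+-mono-≤ v w)))
        (solve (e ∷ P ∷ r₁ ∷ r₂ ∷ A ∷ B ∷ d₁ ∷ d₂ ∷ d ∷ κ ∷ K ∷ K₃ ∷ []))

    difference-of-shifts : ∀ i a b → (i ℤ.+ a) ℤ.+ ℤ.- (i ℤ.+ b) ≡ a ℤ.- b
    difference-of-shifts i a b = ℤ-Solver.solve (i ∷ a ∷ b ∷ [])

    dist-tri′ : ∀ i j l → ∣ i ℤ.- l ∣ ≤ ∣ j ℤ.- i ∣ + ∣ j ℤ.- l ∣
    dist-tri′ i j l = ≤-trans (dist-tri i j l) (≤-reflexive (≡.cong (_+ ∣ j ℤ.- l ∣) (dist-sym i j)))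

    far-from-third : ∀ i a s θ K → K + θ < ∣ i ℤ.- s ∣ → ∣ a ℤ.- s ∣ ≤ θ → K < ∣ a ℤ.- i ∣
    far-from-third i a s θ K far near = aux K θ _ _ _ far near (dist-tri′ i a s)
      where
      aux : ∀ K θ is as ai → K + θ < is → as ≤ θ → is ≤ ai + as → K < ai
      aux K θ is as ai p q r = lin 0 (+-mono-≤ p (+-mono-≤ q r)) (solve (K ∷ θ ∷ is ∷ as ∷ ai ∷ []))

    far-far : ∀ i a s s′ θ K → K + (θ + θ) < ∣ i ℤ.- s ∣ → ∣ a ℤ.- i ∣ ≤ θ → ∣ s′ ℤ.- s ∣ ≤ θ → K < ∣ s′ ℤ.- a ∣
    far-far i a s s′ θ K far near near′ = far-from-third a s′ s θ K (aux K θ _ _ _ far near (dist-tri′ i a s)) near′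
      where
      aux : ∀ K θ is as ai → K + (θ + θ) < is → ai ≤ θ → is ≤ ai + as → K + θ < as
      aux K θ is as ai p q r = lin 0 (+-mono-≤ p (+-mono-≤ q r)) (solve (K ∷ θ ∷ is ∷ as ∷ ai ∷ []))

    far-other-end : ∀ i₀ i₁ s θ K → K + K + (θ + θ + θ) < ∣ i₁ ℤ.- i₀ ∣ → ∣ i₁ ℤ.- s ∣ ≤ K + θ → K + (θ + θ) < ∣ i₀ ℤ.- s ∣
    far-other-end i₀ i₁ s θ K far near = aux K θ _ _ _ far near
      (≤-trans (dist-tri i₁ s i₀) (≤-reflexive (≡.cong (_+_ ∣ i₁ ℤ.- s ∣) (dist-sym s i₀))))
      where
      aux : ∀ K θ i₁i₀ i₁s i₀s → K + K + (θ + θ + θ) < i₁i₀ → i₁s ≤ K + θ → i₁i₀ ≤ i₁s + i₀s → K + (θ + θ) < i₀s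
      aux K θ i₁i₀ i₁s i₀s p q r = lin 0 (+-mono-≤ p (+-mono-≤ q r)) (solve (K ∷ θ ∷ i₁i₀ ∷ i₁s ∷ i₀s ∷ []))

    via : ∀ i a i′ θ K → ∣ a ℤ.- i ∣ ≤ θ → ∣ i′ ℤ.- a ∣ ≤ K → ∣ i′ ℤ.- i ∣ ≤ θ + K
    via i a i′ θ K p q = ≤-trans (dist-tri i′ a i) (≤-trans (+-mono-≤ q p) (≤-reflexive (ℕₚ.+-comm K θ)))

module Commensurator {c ℓ : Level} (G : Group c ℓ) {k : ℕ} (S : Fin k → Group.Carrier G)
    (gen : Generates G S) (δ : ℕ) (fourPoint : FourPoint G S δ) (tf : TorsionFree G)
    (h : Group.Carrier G) (ax : Hyperbolicity.Axis G S gen δ fourPoint h) where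
  open Line G S gen δ fourPoint h ax
  open import Relation.Binary.Reasoning.Setoid setoid

  -- The elementary closure of `h`, described as the commensurator of ⟨h⟩.
  InE : Γ → Set ℓ
  InE x = ∃₂ λ a b → a ≢ + 0 × x ∙ zp a ≈ zp b ∙ x

  InE-ε : InE ε
  InE-ε = + 1 , + 1 , (λ ()) , ≈-trans (identityˡ _) (≈-sym (identityʳ _))

  InE-resp : ∀ {x y} → x ≈ y → InE x → InE y
  InE-resp e (a , b , a≢0 , comm) = a , b , a≢0 , ≈-trans (∙-congʳ (≈-sym e)) (≈-trans comm (∙-congˡ e))

  intertwine-* : ∀ {x} a b i → x ∙ zp a ≈ zp b ∙ x → x ∙ zp (a ℤ.* i) ≈ zp (b ℤ.* i) ∙ x
  intertwine-* {x} a b i comm = begin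
    x ∙ zp (a ℤ.* i)            ≈⟨ ∙-congˡ (zpow-* h a i) ⟨
    x ∙ zpow G (zp a) i         ≈⟨ intertwine-zpow i comm ⟩
    zpow G (zp b) i ∙ x         ≈⟨ ∙-congʳ (zpow-* h b i) ⟩
    zp (b ℤ.* i) ∙ x            ∎

  InE-∙ : ∀ {x y} → InE x → InE y → InE (x ∙ y)
  InE-∙ {x} {y} (a , b , a≢0 , cx) (a′ , b′ , a′≢0 , cy) =
    a′ ℤ.* a , b ℤ.* b′ , (λ e → nonzero (ℤₚ.i*j≡0⇒i≡0∨j≡0 a′ e)) , (begin
      x ∙ y ∙ zp (a′ ℤ.* a)     ≈⟨ assoc _ _ _ ⟩
      x ∙ (y ∙ zp (a′ ℤ.* a))   ≈⟨ ∙-congˡ (intertwine-* a′ b′ a cy) ⟩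
      x ∙ (zp (b′ ℤ.* a) ∙ y)   ≈⟨ assoc _ _ _ ⟨
      x ∙ zp (b′ ℤ.* a) ∙ y     ≡⟨ ≡.cong (λ i → x ∙ zp i ∙ y) (ℤₚ.*-comm b′ a) ⟩
      x ∙ zp (a ℤ.* b′) ∙ y     ≈⟨ ∙-congʳ (intertwine-* a b b′ cx) ⟩
      zp (b ℤ.* b′) ∙ x ∙ y     ≈⟨ assoc _ _ _ ⟩
      zp (b ℤ.* b′) ∙ (x ∙ y)   ∎)
    where
    nonzero : (a′ ≡ + 0) ⊎ (a ≡ + 0) → ⊥
    nonzero (inj₁ e) = a′≢0 e
    nonzero (inj₂ e) = a≢0 e

  InE-pow : ∀ {x} → InE x → ∀ n → InE (pow G x n)
  InE-pow x∈E zero    = InE-ε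
  InE-pow x∈E (suc n) = InE-∙ x∈E (InE-pow x∈E n)

  InE-near : ∀ {x} → InE x → ¬ ¬ (∃ λ j → WL (x ⁻¹ ∙ zp j) KE)
  InE-near {x} (a , b , a≢0 , comm) κ′ = near (x ⁻¹) λ (j , e , nx) →
    κ′ (j , wl-mono (intertwiner-near a b a≢0 comm nx) (point nx))

  -- All powers of x stay within KE of ⟨h⟩, so two of them differ by an element of ⟨h⟩.
  InE-power : ∀ {x} → InE x → ¬ ¬ (∃₂ λ m l → pow G x (suc m) ≈ zp l)
  InE-power {x} x∈E κ′ = ¬¬-∀Fin (λ t → InE-near (InE-pow x∈E (toℕ t))) λ nears →
    found nears (wl-pigeonhole KE (λ t → pow G x (toℕ t) ⁻¹ ∙ zp (proj₁ (nears t))) (λ t → proj₂ (nears t)))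
    where
    found : (nears : ∀ (t : Fin (suc (#words KE))) → ∃ λ j → WL (pow G x (toℕ t) ⁻¹ ∙ zp j) KE) →
      (∃₂ λ s t → s Fin.< t × pow G x (toℕ s) ⁻¹ ∙ zp (proj₁ (nears s)) ≈ pow G x (toℕ t) ⁻¹ ∙ zp (proj₁ (nears t))) → ⊥
    found nears (s , t , s<t , e) = κ′ (m , j′ ℤ.- j , (begin
        pow G x (suc m)                                   ≈⟨ group! (pow G x (suc m) ∷ᵥ X ∷ᵥ zp j ∷ᵥ []ᵥ) x₀ (x₀ · x₁ · (x₁ ⁻ · x₂) · x₂ ⁻) refl ⟩
        pow G x (suc m) ∙ X ∙ (X ⁻¹ ∙ zp j) ∙ zp j ⁻¹     ≈⟨ ∙-congʳ (∙-cong (pow-+ x (suc m) (toℕ s)) (≈-sym e)) ⟨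
        pow G x (suc m + toℕ s) ∙ (X′ ⁻¹ ∙ zp j′) ∙ zp j ⁻¹ ≡⟨ ≡.cong (λ n → pow G x n ∙ (X′ ⁻¹ ∙ zp j′) ∙ zp j ⁻¹) eq ⟩
        X′ ∙ (X′ ⁻¹ ∙ zp j′) ∙ zp j ⁻¹                    ≈⟨ group! (X′ ∷ᵥ zp j′ ∷ᵥ zp j ∷ᵥ []ᵥ) (x₀ · (x₀ ⁻ · x₁) · x₂ ⁻) (x₁ · x₂ ⁻) refl ⟩
        zp j′ ∙ zp j ⁻¹                                   ≈⟨ ∙-congˡ (zpow-neg h j) ⟨
        zp j′ ∙ zp (ℤ.- j)                                ≈⟨ zp-+ j′ (ℤ.- j) ⟨
        zp (j′ ℤ.- j)                                     ∎))
      where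
      j = proj₁ (nears s)
      j′ = proj₁ (nears t)
      m = toℕ t ∸ suc (toℕ s)
      X = pow G x (toℕ s)
      X′ = pow G x (toℕ t)
      eq : suc m + toℕ s ≡ toℕ t
      eq = ≡.trans (≡.sym (ℕₚ.+-suc m (toℕ s))) (ℕₚ.m∸n+n≡m s<t)

  -- Membership is a hypothesis so that one exponent can serve all words of a ball, although it is
  -- not decidable which of them lie in the commensurator.
  Comm : Word k → ℕ → Set ℓ
  Comm v l = InE (ev v) → ev v ∙ pow G h l ≈ pow G h l ∙ ev v

  Comm-* : ∀ {v} m n → Comm v m → Comm v (n * m)
  Comm-* {v} m n cm x∈E = begin
    ev v ∙ pow G h (n * m)        ≈⟨ ∙-congˡ (pow-* h m n) ⟨
    ev v ∙ pow G (pow G h m) n    ≈⟨ intertwine-pow n (cm x∈E) ⟩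
    pow G (pow G h m) n ∙ ev v    ≈⟨ ∙-congʳ (pow-* h m n) ⟩
    pow G h (n * m) ∙ ev v        ∎

  -- Some positive power of `v` is a power of `h`. If that is trivial, `v` is trivial by
  -- torsion-freeness; otherwise a positive power of `h` is a power of `v` or of its inverse, and so
  -- commutes with `v`.
  Comm-exists : ∀ v → ¬ ¬ (∃ λ l → Comm v (suc l))
  Comm-exists v κ′ = em {X = InE (ev v)} λ
    { (inj₂ ¬e) → κ′ (0 , λ x∈E → ⊥-elim (¬e x∈E))
    ; (inj₁ x∈E) → InE-power x∈E λ (m , l , e) → root m l e }
    where
    y = ev v
    root : ∀ m l → pow G y (suc m) ≈ zp l → ⊥
    root m (+ zero) e = κ′ (0 , λ _ → ≈-trans (∙-congʳ y≈ε) (≈-trans (identityˡ _) (≈-trans (≈-sym (identityʳ _)) (∙-congˡ (≈-sym y≈ε)))))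
      where
      y≈ε : y ≈ ε
      y≈ε = tf y m e
    root m (+ suc l) e = κ′ (l , λ _ → ≈-trans (∙-congˡ (≈-sym e)) (≈-trans (commʸ m) (∙-congʳ e)))
      where
      commʸ : ∀ m → y ∙ pow G y (suc m) ≈ pow G y (suc m) ∙ y
      commʸ m = intertwine-pow (suc m) ≈-refl
    root m -[1+ l ] e = κ′ (l , λ _ → ≈-trans (∙-congˡ hl) (≈-trans (intertwine-inv (intertwine-pow (suc m) ≈-refl)) (∙-congʳ (≈-sym hl))))
      where
      hl : pow G h (suc l) ≈ pow G y (suc m) ⁻¹
      hl = ≈-trans (≈-sym (⁻¹-involutive _)) (⁻¹-cong (≈-sym e))

  pow-axis : ∀ l → Axis (pow G h (suc l))
  pow-axis l = record
    { κ = κ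
    ; λₕ = suc l * λₕ
    ; wl-h = wl-pow (suc l) wl-h
    ; linear = λ n ln → ≤-trans (ℕₚ.m≤m*n n (suc l)) (linear (n * suc l) (len-resp (pow-* h (suc l) n) ln))
    ; additive = λ m n {a} {b} {s} la lb ls → additive (m * suc l) (n * suc l) (len-resp (pow-* h (suc l) m) la) (len-resp (pow-* h (suc l) n) lb)
        (≡.subst (λ i → Len (pow G h i) s) (ℕₚ.*-distribʳ-+ (suc l) m n) (len-resp (pow-* h (suc l) (m + n)) ls)) }

  -- E/⟨h⟩ is finite, so a single power of h is central in E.
  central-power : ¬ ¬ (∃ λ l → CentralCommensurator (pow G h (suc l)))
  central-power κ′ = ¬¬-All Comm-exists (wordsUpTo KE) λ each →
    let (l , commutes) = common-multiple Comm (λ {v} → Comm-* {v}) each in κ′ (l , central l commutes)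
    where
    central : ∀ l → All (λ v → Comm v (suc l)) (wordsUpTo KE) → CentralCommensurator (pow G h (suc l))
    central l commutes x a b a≢0 comm κ″ = InE-near x∈E λ (j , w) → conclude j (wl-⁻¹ w)
      where
      L = + suc l
      x∈E : InE x
      x∈E = L ℤ.* a , L ℤ.* b , (λ e → nz (ℤₚ.i*j≡0⇒i≡0∨j≡0 L e)) ,
        ≈-trans (∙-congˡ (≈-sym (zpow-* h L a))) (≈-trans comm (∙-congʳ (zpow-* h L b)))
        where
        nz : (L ≡ + 0) ⊎ (a ≡ + 0) → ⊥
        nz (inj₁ ())
        nz (inj₂ e) = a≢0 e
      conclude : ∀ j → WL ((x ⁻¹ ∙ zp j) ⁻¹) KE → ⊥
      conclude j (v , lv , e) = κ″ (begin
          x ∙ H                   ≈⟨ ∙-congʳ x≈ ⟩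
          zp j ∙ ev v ∙ H         ≈⟨ assoc _ _ _ ⟩
          zp j ∙ (ev v ∙ H)       ≈⟨ ∙-congˡ (All.lookup commutes (∈-wordsUpTo v lv) ev∈) ⟩
          zp j ∙ (H ∙ ev v)       ≈⟨ assoc _ _ _ ⟨
          zp j ∙ H ∙ ev v         ≈⟨ ∙-congʳ jH ⟩
          H ∙ zp j ∙ ev v         ≈⟨ assoc _ _ _ ⟩
          H ∙ (zp j ∙ ev v)       ≈⟨ ∙-congˡ x≈ ⟨
          H ∙ x                   ∎)
        where
        H = pow G h (suc l)
        x≈ : x ≈ zp j ∙ ev v
        x≈ = ≈-trans (group! (x ∷ᵥ zp j ∷ᵥ []ᵥ) x₀ (x₁ · (x₀ ⁻ · x₁) ⁻) refl) (∙-congˡ (≈-sym e))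
        jH : zp j ∙ H ≈ H ∙ zp j
        jH = ≈-trans (≈-sym (zp-+ j L)) (≈-trans (≈-reflexive (≡.cong zp (ℤₚ.+-comm j L))) (zp-+ L j))
        ev∈ : InE (ev v)
        ev∈ = InE-resp (≈-trans (group! (x ∷ᵥ zp j ∷ᵥ []ᵥ) (x₁ ⁻ · x₀) ((x₀ ⁻ · x₁) ⁻) refl) (≈-sym e))
          (InE-∙ (+ 1 , + 1 , (λ ()) , intertwine-inv₁) x∈E)
          where
          intertwine-inv₁ : zp j ⁻¹ ∙ zp (+ 1) ≈ zp (+ 1) ∙ zp j ⁻¹
          intertwine-inv₁ = begin
            zp j ⁻¹ ∙ zp (+ 1)        ≈⟨ ∙-congʳ (zpow-neg h j) ⟨
            zp (ℤ.- j) ∙ zp (+ 1)     ≈⟨ zp-+ (ℤ.- j) (+ 1) ⟨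
            zp (ℤ.- j ℤ.+ + 1)        ≡⟨ ≡.cong zp (ℤₚ.+-comm (ℤ.- j) (+ 1)) ⟩
            zp (+ 1 ℤ.+ ℤ.- j)        ≈⟨ zp-+ (+ 1) (ℤ.- j) ⟩
            zp (+ 1) ∙ zp (ℤ.- j)     ≈⟨ ∙-congˡ (zpow-neg h j) ⟩
            zp (+ 1) ∙ zp j ⁻¹        ∎

-- The malnormal centralizer of `c`, and projections of its cosets to each other

module Centralizer {a ℓ : Level} (G : Group a ℓ) {k : ℕ} (S : Fin k → Group.Carrier G)
    (gen : Generates G S) (δ : ℕ) (fourPoint : FourPoint G S δ) (tf : TorsionFree G)
    (c : Group.Carrier G) (ax : Hyperbolicity.Axis G S gen δ fourPoint c)
    (commensurating⇒central : GroupLemmas.CentralCommensurator G c) where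
  open Line G S gen δ fourPoint c ax public
  open Commensurator G S gen δ fourPoint tf c ax using (InE; InE-power; InE-near)
  open LineArithmetic
  open IndexArithmetic
  open import Relation.Binary.Reasoning.Setoid setoid

  C : Γ → Set ℓ
  C x = x ∙ c ≈ c ∙ x

  C-resp : ∀ {x y} → x ≈ y → C x → C y
  C-resp e cx = ≈-trans (∙-congʳ (≈-sym e)) (≈-trans cx (∙-congˡ e))

  C-∙ : ∀ {x y} → C x → C y → C (x ∙ y)
  C-∙ {x} {y} cx cy = begin
    x ∙ y ∙ c     ≈⟨ assoc _ _ _ ⟩
    x ∙ (y ∙ c)   ≈⟨ ∙-congˡ cy ⟩
    x ∙ (c ∙ y)   ≈⟨ assoc _ _ _ ⟨
    x ∙ c ∙ y     ≈⟨ ∙-congʳ cx ⟩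
    c ∙ x ∙ y     ≈⟨ assoc _ _ _ ⟩
    c ∙ (x ∙ y)   ∎

  C-⁻¹ : ∀ {x} → C x → C (x ⁻¹)
  C-⁻¹ {x} cx = ≈-sym (intertwine-inv (≈-sym cx))

  C-zp : ∀ i → C (zp i)
  C-zp i = ≈-sym (intertwine-zpow i ≈-refl)

  C-cancelˡ : ∀ {x y} → C x → C (x ∙ y) → C y
  C-cancelˡ {x} {y} cx cxy = C-resp (group! (x ∷ᵥ y ∷ᵥ []ᵥ) (x₀ ⁻ · (x₀ · x₁)) x₁ refl) (C-∙ (C-⁻¹ cx) cxy)

  C⇒InE : ∀ {x} → C x → InE x
  C⇒InE cx = + 1 , + 1 , (λ ()) , intertwine-zpow (+ 1) cx

  C-root : ∀ {z} → C z → ¬ z ≈ ε → ¬ ¬ (∃₂ λ m l → l ≢ + 0 × pow G z (suc m) ≈ zp l)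
  C-root {z} cz z≉ε κ′ = InE-power (C⇒InE cz) λ (m , l , e) → κ′ (m , l , (λ { refl → z≉ε (tf z m e) }) , e)

  -- Both `z` and its conjugate have a nontrivial power in ⟨c⟩, so `y` conjugates one power of `c`
  -- to another and thus commutes with `c`.
  malnormal : ∀ {y z} → ¬ C y → C z → ¬ z ≈ ε → ¬ C (y ⁻¹ ∙ z ∙ y)
  malnormal {y} {z} y∉C z∈C z≉ε x∈C =
    C-root z∈C z≉ε λ (m , l , l≢0 , e) → C-root x∈C x≉ε λ (m′ , l′ , l′≢0 , e′) →
      commensurating⇒central y (l′ ℤ.* + suc m) (l ℤ.* + suc m′)
        (λ eq → nz l′≢0 (ℤₚ.i*j≡0⇒i≡0∨j≡0 l′ eq)) (begin
          y ∙ zp (l′ ℤ.* + suc m)                ≈⟨ ∙-congˡ (zpow-*-pow c l′ (suc m)) ⟨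
          y ∙ pow G (zp l′) (suc m)              ≈⟨ ∙-congˡ (pow-cong (suc m) e′) ⟨
          y ∙ pow G (pow G x (suc m′)) (suc m)   ≈⟨ ∙-congˡ (pow-* x (suc m′) (suc m)) ⟩
          y ∙ pow G x (suc m * suc m′)           ≈⟨ intertwine-pow (suc m * suc m′) yx ⟩
          pow G z (suc m * suc m′) ∙ y           ≡⟨ ≡.cong (λ n → pow G z n ∙ y) (ℕₚ.*-comm (suc m) (suc m′)) ⟩
          pow G z (suc m′ * suc m) ∙ y           ≈⟨ ∙-congʳ (pow-* z (suc m) (suc m′)) ⟨
          pow G (pow G z (suc m)) (suc m′) ∙ y   ≈⟨ ∙-congʳ (pow-cong (suc m′) e) ⟩
          pow G (zp l) (suc m′) ∙ y              ≈⟨ ∙-congʳ (zpow-*-pow c l (suc m′)) ⟩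
          zp (l ℤ.* + suc m′) ∙ y                ∎)
        y∉C
    where
    x = y ⁻¹ ∙ z ∙ y
    yx : y ∙ x ≈ z ∙ y
    yx = group! (y ∷ᵥ z ∷ᵥ []ᵥ) (x₀ · (x₀ ⁻ · x₁ · x₀)) (x₁ · x₀) refl
    x≉ε : ¬ x ≈ ε
    x≉ε e = z≉ε (begin
      z               ≈⟨ group! (y ∷ᵥ z ∷ᵥ []ᵥ) x₁ (x₀ · (x₀ ⁻ · x₁ · x₀) · x₀ ⁻) refl ⟩
      y ∙ x ∙ y ⁻¹    ≈⟨ ∙-congʳ (∙-congˡ e) ⟩
      y ∙ ε ∙ y ⁻¹    ≈⟨ group! (y ∷ᵥ []ᵥ) (x₀ · one · x₀ ⁻) one refl ⟩
      ε               ∎)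
    nz : ∀ {l′ n} → l′ ≢ + 0 → (l′ ≡ + 0) ⊎ (+ suc n ≡ + 0) → ⊥
    nz l′≢0 (inj₁ e) = l′≢0 e
    nz l′≢0 (inj₂ ())

  -- Elements of `C` lie within `KE` of ⟨c⟩. If every letter times a short word were in `C`, the
  -- ball of radius `KE` would cover the group modulo ⟨c⟩.
  noncentral-exists : NonElementary G → ¬ ¬ (∃ λ f → ¬ C f)
  noncentral-exists ne κ′ = virtuallyCyclic gen c KE step ne
    where
    step : ∀ x r → length r ≤ KE → ¬ ¬ (∃₂ λ r′ z → length r′ ≤ KE × ev (x ∷ r) ≈ ev r′ ∙ zp z)
    step x r l κ″ = em {X = C g} λ
      { (inj₂ g∉C) → κ′ (g , g∉C)
      ; (inj₁ g∈C) → InE-near (C⇒InE (C-⁻¹ g∈C)) λ (j , v , lv , e) → κ″ (v , ℤ.- j , lv , (begin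
          g                             ≈⟨ group! (g ∷ᵥ zp j ∷ᵥ []ᵥ) x₀ (x₀ ⁻ ⁻ · x₁ · x₁ ⁻) refl ⟩
          (g ⁻¹) ⁻¹ ∙ zp j ∙ zp j ⁻¹    ≈⟨ ∙-cong e (zpow-neg c j) ⟨
          ev v ∙ zp (ℤ.- j)             ∎)) }
      where g = ev (x ∷ r)

  -- `K₄` measures how closely a line follows ⟨c⟩ along a long projection, `#words K₄` is the number
  -- of points that the pigeonhole principle must exceed, and `θ` adds the passage from ⟨c⟩ to all
  -- of `C`.
  K₄ θ₁ θ : ℕ
  K₄ = K₃ + κ + (K₁ + K₁)
  θ₁ = #words K₄ + (K₁ + δ)
  θ = θ₁ + (KE + K₃)

  -- A line on which ⟨c⟩ has a long projection runs parallel to ⟨c⟩; by the pigeonhole principle u then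
  -- commensurates ⟨c⟩.
  projection-of-axis : ∀ {u i i′ A B} q → ¬ C u → Near u i A → Near (zp q ∙ u) i′ B → ∣ i′ ℤ.- i ∣ ≤ θ₁
  projection-of-axis {u} {i} {i′} {A} {B} q u∉C nu nqu with ∣ i′ ℤ.- i ∣ ≤? θ₁
  ... | yes le = le
  ... | no ≰ = ⊥-elim (len (zp q) λ (P , lP) → len (zp D) λ (d , ld) →
      ¬¬-∀Fin (follow-t lP ld) λ nears →
        found nears (wl-pigeonhole K₄ (λ t → v t ⁻¹ ∙ zp (proj₁ (nears t))) (λ t → proj₂ (nears t))))
    where
    D = i′ ℤ.- i
    θ₁<D : θ₁ < ∣ D ∣
    θ₁<D = ≰⇒> ≰
    split : ∀ (t : Fin (suc (#words K₄))) → ∃₂ λ D₁ D₂ → D ≡ D₁ ℤ.+ D₂ × ∣ D₁ ∣ ≡ toℕ t × ∣ D ∣ ≡ ∣ D₁ ∣ + ∣ D₂ ∣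
    split t = ∣-∣-split D (toℕ t) (≤-trans (≤-trans (Finₚ.toℕ≤pred[n] t) (m≤m+n _ _)) (ℕₚ.<⇒≤ θ₁<D))
    D₁ D₂ : Fin (suc (#words K₄)) → ℤ
    D₁ t = proj₁ (split t)
    D₂ t = proj₁ (proj₂ (split t))
    v : Fin (suc (#words K₄)) → Γ
    v t = u ∙ zp (i ℤ.+ D₁ t)
    -- A point of the line between the two projections is nearly on a geodesic between two points of
    -- ⟨c⟩, by `bottleneck`, and therefore near ⟨c⟩ itself.
    follow-t : ∀ {P d} → Len (zp q) P → Len (zp D) d → ∀ t → ¬ ¬ (∃ λ j → WL (v t ⁻¹ ∙ zp j) K₄)
    follow-t {P} {d} lP ld t κ′ with split t
    ... | D₁ , D₂ , e , _ , e₂ =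
      near (y ⁻¹) λ (j , e , ny) → len (y ⁻¹ ∙ zp (+ 0)) λ (r₁ , lr₁) → len (y ⁻¹ ∙ zp (ℤ.- q)) λ (r₂ , lr₂) →
      len (zp D₁) λ (d₁ , ld₁) → len (zp D₂) λ (d₂ , ld₂) →
        κ′ (j , wl-mono (bound ny lr₁ lr₂ ld₁ ld₂) (point ny))
      where
      y = u ∙ zp (i ℤ.+ D₁)
      bound : ∀ {j e r₁ r₂ d₁ d₂} → Near (y ⁻¹) j e → Len (y ⁻¹ ∙ zp (+ 0)) r₁ → Len (y ⁻¹ ∙ zp (ℤ.- q)) r₂ →
        Len (zp D₁) d₁ → Len (zp D₂) d₂ → e ≤ K₄
      bound {j} {e′} {r₁} {r₂} {d₁} {d₂} ny lr₁ lr₂ ld₁ ld₂ = follows-line e′ P r₁ r₂ A B d₁ d₂ d κ K₁ K₃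
        (between-near (+ 0) (ℤ.- q) ny lr₁ lr₂ (≡.subst (λ n → Len (zp n) P) (≡.sym (ℤₚ.+-identityʳ (ℤ.- q))) (zp-neg q lP)))
        (len-∙ (len-resp (≈-trans (group! (y ∷ᵥ []ᵥ) ((x₀ ⁻ · one) ⁻) x₀ refl)
            (≈-trans (∙-congˡ (zp-+ i D₁)) (≈-sym (assoc _ _ _)))) (len-⁻¹ lr₁)) (near-len nu) ld₁)
        (len-∙ (len-resp (begin
            (y ⁻¹ ∙ zp (ℤ.- q)) ⁻¹                 ≈⟨ ⁻¹-cong (∙-congˡ (zpow-neg c q)) ⟩
            (y ⁻¹ ∙ zp q ⁻¹) ⁻¹                    ≈⟨ group! (u ∷ᵥ zp (i ℤ.+ D₁) ∷ᵥ zp q ∷ᵥ []ᵥ) (((x₀ · x₁) ⁻ · x₂ ⁻) ⁻) (x₂ · x₀ · x₁) refl ⟩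
            zp q ∙ u ∙ zp (i ℤ.+ D₁)               ≡⟨ ≡.cong (λ n → zp q ∙ u ∙ zp n) ([i+D₁+D₂]-D₂ i i′ D₁ D₂ e) ⟨
            zp q ∙ u ∙ zp (i′ ℤ.+ ℤ.- D₂)          ≈⟨ ∙-congˡ (zp-+ i′ (ℤ.- D₂)) ⟩
            zp q ∙ u ∙ (zp i′ ∙ zp (ℤ.- D₂))       ≈⟨ assoc _ _ _ ⟨
            zp q ∙ u ∙ zp i′ ∙ zp (ℤ.- D₂)         ∎) (len-⁻¹ lr₂)) (near-len nqu) (zp-neg D₂ ld₂))
        (zp-additive D₁ D₂ (≡.trans (≡.cong ∣_∣ (≡.sym e)) e₂) ld₁ ld₂ (≡.subst (λ n → Len (zp n) d) e ld))
        (bottleneck nu nqu lP ld (≤-trans (s≤s (m≤n+m (K₁ + δ) (#words K₄))) θ₁<D))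
    found : (nears : ∀ t → ∃ λ j → WL (v t ⁻¹ ∙ zp j) K₄) →
      (∃₂ λ s t → s Fin.< t × v s ⁻¹ ∙ zp (proj₁ (nears s)) ≈ v t ⁻¹ ∙ zp (proj₁ (nears t))) → ⊥
    found nears (s , t , s<t , e) = commensurating⇒central u (D₁ t ℤ.- D₁ s) (j′ ℤ.- j) nonzero (begin
        u ∙ zp (D₁ t ℤ.- D₁ s)                                ≡⟨ ≡.cong (λ n → u ∙ zp n) (difference-of-shifts i (D₁ t) (D₁ s)) ⟨
        u ∙ zp ((i ℤ.+ D₁ t) ℤ.+ ℤ.- (i ℤ.+ D₁ s))            ≈⟨ ∙-congˡ (≈-trans (zp-+ (i ℤ.+ D₁ t) _) (∙-congˡ (zpow-neg c (i ℤ.+ D₁ s)))) ⟩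
        u ∙ (X′ ∙ X ⁻¹)                                       ≈⟨ group! (u ∷ᵥ X ∷ᵥ X′ ∷ᵥ zp j ∷ᵥ []ᵥ) (x₀ · (x₂ · x₁ ⁻)) (x₀ · x₂ · ((x₀ · x₁) ⁻ · x₃) · x₃ ⁻ · x₀) refl ⟩
        u ∙ X′ ∙ ((u ∙ X) ⁻¹ ∙ zp j) ∙ zp j ⁻¹ ∙ u            ≈⟨ ∙-congʳ (∙-congʳ (∙-congˡ e)) ⟩
        u ∙ X′ ∙ ((u ∙ X′) ⁻¹ ∙ zp j′) ∙ zp j ⁻¹ ∙ u          ≈⟨ group! (u ∷ᵥ X′ ∷ᵥ zp j ∷ᵥ zp j′ ∷ᵥ []ᵥ) (x₀ · x₁ · ((x₀ · x₁) ⁻ · x₃) · x₂ ⁻ · x₀) (x₃ · x₂ ⁻ · x₀) refl ⟩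
        zp j′ ∙ zp j ⁻¹ ∙ u                                   ≈⟨ ∙-congʳ (∙-congˡ (zpow-neg c j)) ⟨
        zp j′ ∙ zp (ℤ.- j) ∙ u                                ≈⟨ ∙-congʳ (zp-+ j′ (ℤ.- j)) ⟨
        zp (j′ ℤ.- j) ∙ u                                     ∎) u∉C
      where
      j = proj₁ (nears s)
      j′ = proj₁ (nears t)
      X = zp (i ℤ.+ D₁ s)
      X′ = zp (i ℤ.+ D₁ t)
      ∣D₁∣ : ∀ t → ∣ D₁ t ∣ ≡ toℕ t
      ∣D₁∣ t = proj₁ (proj₂ (proj₂ (proj₂ (split t))))
      nonzero : D₁ t ℤ.- D₁ s ≢ + 0
      nonzero eq = ℕₚ.<⇒≢ s<t (≡.trans (≡.sym (∣D₁∣ s)) (≡.trans (≡.cong ∣_∣ (≡.sym (ℤₚ.i-j≡0⇒i≡j (D₁ t) (D₁ s) eq))) (∣D₁∣ t)))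

  -- An element of `C` is within `KE` of a power of `c`, and `lipschitz` pays for the difference.
  projection-of-coset : ∀ {u e i i′ A B} → ¬ C u → C e → Near u i A → Near (e ∙ u) i′ B → ∣ i′ ℤ.- i ∣ ≤ θ
  projection-of-coset {u} {e} {i} {i′} u∉C e∈C nu neu = ≤-stable λ ¬le →
    InE-near (C⇒InE (C-⁻¹ e∈C)) λ (j , w) → near (zp (ℤ.- j) ∙ u) λ (i″ , _ , nv) →
      ¬le (via i i″ i′ θ₁ (KE + K₃) (projection-of-axis (ℤ.- j) u∉C nu nv)
        (lipschitz nv (near-resp (begin
            e ∙ u                                      ≈⟨ group! (e ∷ᵥ u ∷ᵥ zp j ∷ᵥ []ᵥ) (x₀ · x₁) (x₀ ⁻ ⁻ · x₂ · (x₂ ⁻ · x₁)) refl ⟩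
            (e ⁻¹) ⁻¹ ∙ zp j ∙ (zp j ⁻¹ ∙ u)           ≈⟨ ∙-congˡ (∙-congʳ (zpow-neg c j)) ⟨
            (e ⁻¹) ⁻¹ ∙ zp j ∙ (zp (ℤ.- j) ∙ u)        ∎) neu) w))

  -- On the way from `w` to the second line the projection to the first must travel from `i₁` to the
  -- neighbourhood of `s`, so the way passes the first line earlier.
  nearer-line : ∀ {w y₁ y₂ i₁ j₁ s A₁ B₁ n} → ¬ C (y₂ ⁻¹ ∙ y₁) →
    Near (w ⁻¹ ∙ y₁) i₁ A₁ → Near (w ⁻¹ ∙ y₂) j₁ B₁ → Near (y₂ ⁻¹ ∙ y₁) s n → K₃ + θ < ∣ i₁ ℤ.- s ∣ → A₁ < B₁
  nearer-line {w} {y₁} {y₂} {i₁} {j₁} {s} {A₁} {B₁} u∉C n₁ n₂ ns far = ≤-stable λ ¬le →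
    near (zp (ℤ.- j₁) ∙ (y₂ ⁻¹ ∙ y₁)) λ (i , _ , ni) →
    ¬le (projection-nearer n₁ (near-resp (≈-trans (∙-congʳ (zpow-neg c j₁))
            (group! (w ∷ᵥ y₁ ∷ᵥ y₂ ∷ᵥ zp j₁ ∷ᵥ []ᵥ) (x₃ ⁻ · (x₂ ⁻ · x₁)) ((x₀ ⁻ · x₂ · x₃) ⁻ · (x₀ ⁻ · x₁)) refl)) ni)
          (wl-⁻¹ (point n₂))
          (far-from-third i₁ i s θ K₃ far (projection-of-coset u∉C (C-zp (ℤ.- j₁)) ns ni)))

  -- The comparison of `nearer-line`, seen from `C` instead of `w`. The second `θ` in the threshold
  -- is there because the way may start anywhere in `C`.
  shortcut : ∀ {y₁ y₂ i₀ s A n} → ¬ C y₁ → ¬ C (y₂ ⁻¹ ∙ y₁) → Near y₁ i₀ A → Near (y₂ ⁻¹ ∙ y₁) s n →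
    K₃ + (θ + θ) < ∣ i₀ ℤ.- s ∣ → ∀ {e} j {r} → C e → WL (e ∙ y₂ ∙ zp j) r →
    ¬ ¬ (∃₂ λ i r′ → r′ < r × WL (e ∙ y₁ ∙ zp i) r′)
  shortcut {y₁} {y₂} {i₀} {s} y₁∉C u∉C n₁ ns far {e} j {r} e∈C wr κ′ =
    near (e ∙ y₁) λ (i , A , ni) → near (zp (ℤ.- j) ∙ (y₂ ⁻¹ ∙ y₁)) λ (s′ , _ , ns′) →
    κ′ (i , A , projection-nearer ni (near-resp (≈-trans (∙-congʳ (zpow-neg c j))
            (group! (e ∷ᵥ y₁ ∷ᵥ y₂ ∷ᵥ zp j ∷ᵥ []ᵥ) (x₃ ⁻ · (x₂ ⁻ · x₁)) ((x₀ · x₂ · x₃) ⁻ · (x₀ · x₁)) refl)) ns′)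
          (wl-⁻¹ wr)
          (far-far i₀ i s s′ θ K₃ far (projection-of-coset y₁∉C e∈C n₁ ni) (projection-of-coset u∉C (C-zp (ℤ.- j)) ns ns′)) ,
        point ni)

  -- If one end of so long a projection is within `K₃ + θ` of a given point, the other is more than
  -- `K₃ + (θ + θ)` away from it: the thresholds of `nearer-line` and `shortcut`.
  m⋆ : ℕ
  m⋆ = K₃ + K₃ + (θ + θ + θ)

  -- Of two lines y, zy met by the geodesic from 1 to w, the first one met would be closer to C than the second,
  -- but z preserves the distance to C.
  one-rotation : ∀ {w y z i₀ i₁ j₀ j₁ A₀ A₁ B₀ B₁} → ¬ C y → C z → ¬ z ≈ ε →
    Near y i₀ A₀ → Near (w ⁻¹ ∙ y) i₁ A₁ → Near (z ∙ y) j₀ B₀ → Near (w ⁻¹ ∙ (z ∙ y)) j₁ B₁ →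
    m⋆ < ∣ i₁ ℤ.- i₀ ∣ → m⋆ < ∣ j₁ ℤ.- j₀ ∣ → ⊥
  one-rotation {w} {y} {z} {i₀} {i₁} {j₀} {j₁} y∉C z∈C z≉ε ni₀ ni₁ nj₀ nj₁ far-i far-j =
    near ((z ∙ y) ⁻¹ ∙ y) λ (s , _ , ns) → near (y ⁻¹ ∙ (z ∙ y)) λ (t , _ , nt) →
      cases s t ns nt (∣ i₁ ℤ.- s ∣ ≤? K₃ + θ) (∣ j₁ ℤ.- t ∣ ≤? K₃ + θ)
    where
    z⁻¹≉ε : ¬ z ⁻¹ ≈ ε
    z⁻¹≉ε e = z≉ε (≈-trans (≈-sym (⁻¹-involutive z)) (≈-trans (⁻¹-cong e) ε⁻¹≈ε))
    u∉C : ¬ C ((z ∙ y) ⁻¹ ∙ y)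
    u∉C u∈C = malnormal y∉C (C-⁻¹ z∈C) z⁻¹≉ε (C-resp (group! (y ∷ᵥ z ∷ᵥ []ᵥ) ((x₁ · x₀) ⁻ · x₀) (x₀ ⁻ · x₁ ⁻ · x₀) refl) u∈C)
    u′∉C : ¬ C (y ⁻¹ ∙ (z ∙ y))
    u′∉C u∈C = malnormal y∉C z∈C z≉ε (C-resp (≈-sym (assoc _ _ _)) u∈C)
    zy∉C : ¬ C (z ∙ y)
    zy∉C = y∉C ∘ C-cancelˡ z∈C
    Attained : ℕ → Set (a ⊔ ℓ)
    Attained n = ∃₂ λ e j → C e × WL (e ∙ y ∙ zp j) n
    minimum : (∀ n → Attained n → ¬ ¬ (∃ λ n′ → n′ < n × Attained n′)) → ⊥
    minimum descend = least {P = Attained} (ε , + 0 , ≈-trans (identityˡ _) (≈-sym (identityʳ _)) , proj₂ (gen _))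
      λ (n , at , lb) → descend n at λ (n′ , n′<n , at′) → ℕₚ.<⇒≱ n′<n (lb n′ at′)
    cases : ∀ s t {m n} → Near ((z ∙ y) ⁻¹ ∙ y) s m → Near (y ⁻¹ ∙ (z ∙ y)) t n →
      Dec (∣ i₁ ℤ.- s ∣ ≤ K₃ + θ) → Dec (∣ j₁ ℤ.- t ∣ ≤ K₃ + θ) → ⊥
    -- Here `w` projects far from the other line on both lines, so each would be strictly nearer to
    -- `w` than the other.
    cases s t ns nt (no ≰) (no ≰′) = ℕₚ.<-asym (nearer-line u∉C ni₁ nj₁ ns (≰⇒> ≰)) (nearer-line u′∉C nj₁ ni₁ nt (≰⇒> ≰′))
    cases s t ns nt (yes le) _ = minimum λ n (e , j , e∈C , wn) κ′ →
      shortcut y∉C u∉C ni₀ ns (far-other-end i₀ i₁ s θ K₃ far-i le) j (C-∙ e∈C (C-⁻¹ z∈C))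
        (wl-resp (group! (e ∷ᵥ y ∷ᵥ z ∷ᵥ zp j ∷ᵥ []ᵥ) (x₀ · x₁ · x₃) (x₀ · x₂ ⁻ · (x₂ · x₁) · x₃) refl) wn)
        λ (i , n′ , n′<n , w′) → κ′ (n′ , n′<n , e ∙ z ⁻¹ , i , C-∙ e∈C (C-⁻¹ z∈C) , w′)
    cases s t ns nt (no _) (yes le) = minimum λ n (e , j , e∈C , wn) κ′ →
      shortcut zy∉C u′∉C nj₀ nt (far-other-end j₀ j₁ t θ K₃ far-j le) j e∈C wn
        λ (i , n′ , n′<n , w′) → κ′ (n′ , n′<n , e ∙ z , i , C-∙ e∈C z∈C ,
          wl-resp (∙-congʳ (≈-sym (assoc _ _ _))) w′)

-- Signed projections: powers of `f ∙ pow G c N` against elements of `T`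

infix 4 _≲[_]_
_≲[_]_ : ℤ → ℕ → ℤ → Set
i ≲[ R ] j = i ℤ.≤ j ℤ.+ + R

module RunArithmetic where
  abstract
    ≲-stable : ∀ {i R j} → ¬ ¬ (i ≲[ R ] j) → i ≲[ R ] j
    ≲-stable {i} {R} {j} = decidable-stable (i ℤ.≤? j ℤ.+ + R)

    ≲-trans : ∀ {i j l R R′} → i ≲[ R ] j → j ≲[ R′ ] l → i ≲[ R + R′ ] l
    ≲-trans {i} {j} {l} {R} {R′} p q = ℤₚ.≤-trans p (ℤₚ.≤-trans (ℤₚ.+-monoˡ-≤ (+ R) q)
      (ℤₚ.≤-reflexive (≡.trans (ℤₚ.+-assoc l (+ R′) (+ R)) (≡.cong (λ n → l ℤ.+ + n) (ℕₚ.+-comm R′ R)))))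

    ≲-weaken : ∀ {i j R R′} → R ≤ R′ → i ≲[ R ] j → i ≲[ R′ ] j
    ≲-weaken {j = j} le p = ℤₚ.≤-trans p (ℤₚ.+-monoʳ-≤ j (ℤ.+≤+ le))

    dist⇒≲ : ∀ {i j R} → ∣ i ℤ.- j ∣ ≤ R → i ≲[ R ] j
    dist⇒≲ {i} {j} {R} le = ℤₚ.≤-trans (ℤₚ.≤-reflexive (eq i j)) (ℤₚ.+-monoʳ-≤ j (ℤₚ.≤-trans (n≤∣n∣ (i ℤ.- j)) (ℤ.+≤+ le)))
      where
      eq : ∀ i j → i ≡ j ℤ.+ (i ℤ.- j)
      eq i j = ℤ-Solver.solve (i ∷ j ∷ [])
      n≤∣n∣ : ∀ n → n ℤ.≤ + ∣ n ∣
      n≤∣n∣ (+ n)    = ℤₚ.≤-refl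
      n≤∣n∣ -[1+ n ] = ℤ.-≤+

    dist⇒≳ : ∀ {i j R} → ∣ i ℤ.- j ∣ ≤ R → j ≲[ R ] i
    dist⇒≳ {i} {j} le = dist⇒≲ {j} {i} (≤-trans (≤-reflexive (ℤₚ.∣i-j∣≡∣j-i∣ j i)) le)

    gain : ∀ {i j N P Q} → i ℤ.+ + N ≲[ P ] j → j ≲[ Q ] i → N ≤ P + Q
    gain {i} {j} {N} {P} {Q} p q = ℤₚ.drop‿+≤+
      (ℤₚ.≤-trans (ℤₚ.≤-reflexive (≡.sym (cancel i (+ N)))) (ℤₚ.≤-trans (ℤₚ.+-monoʳ-≤ (ℤ.- i) (≲-trans {i ℤ.+ + N} {j} {i} p q))
        (ℤₚ.≤-reflexive (cancel i (+ (P + Q))))))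
      where
      cancel : ∀ i x → ℤ.- i ℤ.+ (i ℤ.+ x) ≡ x
      cancel i x = ℤ-Solver.solve (i ∷ x ∷ [])

    gain-start : ∀ {i j R N R′} → i ≲[ R ] j → ∣ j ∣ ≤ R′ → i ℤ.+ + N ≲[ R + R′ ] + N
    gain-start {i} {j} {R} {N} {R′} p q = ℤₚ.≤-trans (ℤₚ.+-monoˡ-≤ (+ N) (≲-trans {i} {j} {+ 0} p j≲0))
      (ℤₚ.≤-reflexive (≡.trans (≡.cong (ℤ._+ + N) (ℤₚ.+-identityˡ (+ (R + R′)))) (ℤₚ.+-comm (+ (R + R′)) (+ N))))
      where
      j≲0 : j ≲[ R′ ] + 0
      j≲0 = dist⇒≲ {j} {+ 0} (≤-trans (≤-reflexive (≡.cong ∣_∣ (ℤₚ.+-identityʳ j))) q)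

    far-or-close : ∀ m i j → (m < ∣ i ℤ.- j ∣) ⊎ (∣ i ℤ.- j ∣ ≤ m)
    far-or-close m i j with ∣ i ℤ.- j ∣ ≤? m
    ... | yes le = inj₂ le
    ... | no ≰   = inj₁ (≰⇒> ≰)

module Avoidance {a ℓ : Level} (G : Group a ℓ) {k : ℕ} (S : Fin k → Group.Carrier G)
    (gen : Generates G S) (δ : ℕ) (fourPoint : FourPoint G S δ) (tf : TorsionFree G)
    (c : Group.Carrier G) (ax : Hyperbolicity.Axis G S gen δ fourPoint c)
    (commensurating⇒central : GroupLemmas.CentralCommensurator G c) where
  open Centralizer G S gen δ fourPoint tf c ax commensurating⇒central public
  open RunArithmetic
  open import Relation.Binary.Reasoning.Setoid setoid

  T : Γ → Set (a ⊔ ℓ)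
  T x = ∃₂ λ w z → C z × ¬ z ≈ ε × x ≈ w ∙ z ∙ w ⁻¹ ∙ c ∙ w

  near-ε : Near ε (+ 0) 0
  near-ε = nearest (wl-resp (≈-sym (identityˡ _)) wl-ε) λ _ _ _ → z≤n

  near-unique : ∀ {u i i′ A B} → Near u i A → Near u i′ B → ∣ i′ ℤ.- i ∣ ≤ K₃
  near-unique n n′ = lipschitz n (near-resp (≈-sym (identityˡ _)) n′) wl-ε

  C-ε : C ε
  C-ε = ≈-trans (identityˡ _) (≈-sym (identityʳ _))

  -- `τ` commutes with its own powers, so it would conjugate a nontrivial element of `C` into `C`.
  root-closed : ∀ {τ} → ¬ C τ → ∀ d → ¬ C (pow G τ (suc d))
  root-closed {τ} τ∉C d τᵈ∈C = malnormal τ∉C τᵈ∈C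
    (λ e → τ∉C (C-resp (≈-sym (tf τ d e)) C-ε))
    (C-resp (begin
      pow G τ (suc d)                      ≈⟨ group! (τ ∷ᵥ pow G τ (suc d) ∷ᵥ []ᵥ) x₁ (x₀ ⁻ · (x₀ · x₁)) refl ⟩
      τ ⁻¹ ∙ (τ ∙ pow G τ (suc d))         ≈⟨ ∙-congˡ (intertwine-pow (suc d) ≈-refl) ⟩
      τ ⁻¹ ∙ (pow G τ (suc d) ∙ τ)         ≈⟨ assoc _ _ _ ⟨
      τ ⁻¹ ∙ pow G τ (suc d) ∙ τ           ∎) τᵈ∈C)

  module _ {f : Γ} (f∉C : ¬ C f) {lf : ℕ} (wf : WL f lf) where

    R₀ : ℕ
    R₀ = (lf + K₃) + (θ + K₃)

    module _ (N : ℕ) where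
      blk : Γ
      blk = f ∙ pow G c N

      -- Reading `f` moves a projection by a bounded amount. Reading the power of `c` moves it by at
      -- most `θ`, except when `v` is in `C`: there it advances by `N`, which only helps a lower
      -- bound.
      block-progress : ∀ {u i i′ A B} → Near u i A → Near (blk ⁻¹ ∙ u) i′ B → i ≲[ R₀ ] i′
      block-progress {u} {i} {i′} nu nbu = ≲-stable {i} {R₀} {i′} λ ¬le → near v λ (i₁ , _ , nv) → em {X = C v} λ
        { (inj₁ v∈C) → ¬le (≲-trans {i} {i₁} {i′} (dist⇒≳ {i₁} {i} (lipschitz nu nv (wl-⁻¹ wf)))
            (≲-weaken {i₁} {i′} (m≤n+m K₃ θ) (advance v∈C nv)))
        ; (inj₂ v∉C) → ¬le (≲-trans {i} {i₁} {i′} (dist⇒≳ {i₁} {i} (lipschitz nu nv (wl-⁻¹ wf)))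
            (≲-weaken {i₁} {i′} (m≤m+n θ K₃) (dist⇒≳ {i′} {i₁} (projection-of-coset v∉C (C-⁻¹ (C-zp (+ N))) nv nv′)))) }
        where
        v = f ⁻¹ ∙ u
        nv′ : Near (zp (+ N) ⁻¹ ∙ v) i′ _
        nv′ = near-resp (group! (f ∷ᵥ zp (+ N) ∷ᵥ u ∷ᵥ []ᵥ) ((x₀ · x₁) ⁻ · x₂) (x₁ ⁻ · (x₀ ⁻ · x₂)) refl) nbu
        advance : ∀ {i₁ A} → C v → Near v i₁ A → i₁ ≲[ K₃ ] i′
        advance {i₁} v∈C nv = ℤₚ.≤-trans (grow i₁ N) (dist⇒≳ {i′} {i₁ ℤ.- ℤ.- + N} (near-unique shifted nv′))
          where
          grow : ∀ i N → i ℤ.≤ i ℤ.- ℤ.- + N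
          grow i N = ℤₚ.≤-trans (ℤₚ.i≤i+j i (+ N)) (ℤₚ.≤-reflexive (≡.cong (ℤ._+_ i) (≡.sym (ℤₚ.neg-involutive (+ N)))))
          shifted : Near (zp (+ N) ⁻¹ ∙ v) (i₁ ℤ.- ℤ.- + N) _
          shifted = near-resp (≈-trans (∙-congˡ (zpow-neg c (+ N))) (intertwine-inv (intertwine-zpow (+ N) v∈C))) (near-shift (ℤ.- + N) nv)

      progress : ∀ t {u i i′ A B} → Near u i A → Near (pow G blk t ⁻¹ ∙ u) i′ B → i ≲[ t * R₀ + K₃ ] i′
      progress zero {u} {i} {i′} nu nu′ = dist⇒≳ {i′} {i} (near-unique nu (near-resp (group! (u ∷ᵥ []ᵥ) (one ⁻ · x₀) x₀ refl) nu′))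
      progress (suc t) {u} {i} {i′} nu nu′ = ≲-stable {i} {_} {i′} λ ¬le → near (blk ⁻¹ ∙ u) λ (i₁ , _ , n₁) →
        ¬le (≡.subst (λ R → i ≲[ R ] i′) (≡.sym (ℕₚ.+-assoc R₀ (t * R₀) K₃)) (≲-trans {i} {i₁} {i′} (block-progress nu n₁)
          (progress t n₁ (near-resp (group! (blk ∷ᵥ pow G blk t ∷ᵥ u ∷ᵥ []ᵥ) ((x₀ · x₁) ⁻ · x₂) (x₁ ⁻ · (x₀ ⁻ · x₂)) refl) nu′))))

      module _ {g : Γ} {r : ℕ} (wg : WL g r) (M : ℕ) where
        E : Γ
        E = pow G blk M ∙ g

        Rₕ : ℕ
        Rₕ = (M * R₀ + K₃) + (r + K₃)

        -- What matters is that `Rₕ` does not involve `N`, so that `N` can be chosen larger than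
        -- anything built from it.
        never-backwards : ∀ {y i i′ A B} → Near y i A → Near (E ⁻¹ ∙ y) i′ B → i ≲[ Rₕ ] i′
        never-backwards {y} {i} {i′} ny nEy = ≲-stable {i} {Rₕ} {i′} λ ¬le → near (pow G blk M ⁻¹ ∙ y) λ (i₁ , _ , n₁) →
          ¬le (≲-trans {i} {i₁} {i′} (progress M ny n₁) (dist⇒≳ {i′} {i₁} (lipschitz n₁
            (near-resp (group! (pow G blk M ∷ᵥ g ∷ᵥ y ∷ᵥ []ᵥ) ((x₀ · x₁) ⁻ · x₂) (x₁ ⁻ · (x₀ ⁻ · x₂)) refl) nEy) (wl-⁻¹ wg))))

        Rₐ : ℕ
        Rₐ = (M * R₀ + K₃ + (lf + K₃)) + ((M * R₀ + K₃) + (r + K₃))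

        -- This line is the axis along which the power of `c` in block `t` runs. There the
        -- projection gains `N`, and by `progress` the rest of the word loses only a bounded amount.
        run : ∀ t s → t + suc s ≡ M → ∀ {i i′ A B} → Near (pow G blk t ∙ f) i A → Near (E ⁻¹ ∙ (pow G blk t ∙ f)) i′ B → i ℤ.+ + N ≲[ Rₐ ] i′
        run t s eq {i} {i′} ny nEy = ≲-stable {i ℤ.+ + N} {Rₐ} {i′} λ ¬le → near f λ (i₁ , _ , n₁) →
          near (pow G blk s ⁻¹ ∙ (ε ∙ zp (ℤ.- + N))) λ (i₂ , _ , n₂) →
          ¬le (≲-trans {i ℤ.+ + N} {+ N} {i′}
            (gain-start {i} {i₁} {M * R₀ + K₃} {N}
              (≲-weaken {i} {i₁} (+-monoˡ-≤ K₃ (ℕₚ.*-monoˡ-≤ R₀ t≤M))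
                (progress t ny (near-resp (group! (pow G blk t ∷ᵥ f ∷ᵥ []ᵥ) x₁ (x₀ ⁻ · (x₀ · x₁)) refl) n₁)))
              (≤-trans (≤-reflexive (≡.cong ∣_∣ (≡.sym (ℤₚ.+-identityʳ i₁)))) (lipschitz near-ε (near-resp (≈-sym (identityʳ f)) n₁) wf)))
            (≲-trans {+ N} {i₂} {i′}
              (≲-weaken {+ N} {i₂} (+-monoˡ-≤ K₃ (ℕₚ.*-monoˡ-≤ R₀ s≤M))
                (progress s (≡.subst (λ j → Near (ε ∙ zp (ℤ.- + N)) j 0) (≡.trans (ℤₚ.+-identityˡ _) (ℤₚ.neg-involutive (+ N))) (near-shift (ℤ.- + N) near-ε)) n₂))
              (dist⇒≳ {i′} {i₂} (lipschitz n₂ (near-resp last nEy) (wl-⁻¹ wg)))))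
          where
          t≤M : t ≤ M
          t≤M = ≤-trans (m≤m+n t (suc s)) (≤-reflexive eq)
          s≤M : s ≤ M
          s≤M = ≤-trans (ℕₚ.n≤1+n s) (≤-trans (m≤n+m (suc s) t) (≤-reflexive eq))
          last : E ⁻¹ ∙ (pow G blk t ∙ f) ≈ g ⁻¹ ∙ (pow G blk s ⁻¹ ∙ (ε ∙ zp (ℤ.- + N)))
          last = begin
            (pow G blk M ∙ g) ⁻¹ ∙ (pow G blk t ∙ f)
              ≈⟨ ∙-congʳ (⁻¹-cong (∙-congʳ (≈-trans (≈-reflexive (≡.cong (pow G blk) (≡.sym eq))) (pow-+ blk t (suc s))))) ⟩
            (pow G blk t ∙ (f ∙ pow G c N ∙ pow G blk s) ∙ g) ⁻¹ ∙ (pow G blk t ∙ f)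
              ≈⟨ group! (pow G blk t ∷ᵥ f ∷ᵥ pow G c N ∷ᵥ pow G blk s ∷ᵥ g ∷ᵥ []ᵥ)
                   ((x₀ · (x₁ · x₂ · x₃) · x₄) ⁻ · (x₀ · x₁)) (x₄ ⁻ · (x₃ ⁻ · (one · x₂ ⁻))) refl ⟩
            g ⁻¹ ∙ (pow G blk s ⁻¹ ∙ (ε ∙ pow G c N ⁻¹))
              ≈⟨ ∙-congˡ (∙-congˡ (∙-congˡ (zpow-neg c (+ N)))) ⟨
            g ⁻¹ ∙ (pow G blk s ⁻¹ ∙ (ε ∙ zp (ℤ.- + N)))   ∎

        module _ {w z : Γ} (z∈C : C z) (z≉ε : ¬ z ≈ ε) (E≈ : E ≈ w ∙ z ∙ w ⁻¹ ∙ c ∙ w) where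
          γ κ′ : Γ
          γ = w ∙ z ∙ w ⁻¹
          κ′ = γ ∙ c

          c⁻¹∈C : C (c ⁻¹)
          c⁻¹∈C = C-⁻¹ ≈-refl

          c⁻¹≉ε : ¬ c ⁻¹ ≈ ε
          c⁻¹≉ε e = ℕₚ.1+n≰n (linear 1 {0} (wl-resp ε≈c wl-ε , λ _ _ → z≤n))
            where
            ε≈c : ε ≈ c ∙ ε
            ε≈c = ≈-trans (≈-sym (≈-trans (⁻¹-cong e) ε⁻¹≈ε)) (≈-trans (⁻¹-involutive c) (≈-sym (identityʳ c)))

          z⁻¹≉ε : ¬ z ⁻¹ ≈ ε
          z⁻¹≉ε e = z≉ε (≈-trans (≈-sym (⁻¹-involutive z)) (≈-trans (⁻¹-cong e) ε⁻¹≈ε))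

          rotation-source : ∀ {y ζ i₀ i₁ j₀ j₁ A₀ A₁ B₀ B₁} → ¬ C y → C ζ → ¬ ζ ≈ ε →
            Near y i₀ A₀ → Near (w ⁻¹ ∙ y) i₁ A₁ → Near (ζ ∙ y) j₀ B₀ → Near (w ⁻¹ ∙ (ζ ∙ y)) j₁ B₁ →
            m⋆ < ∣ i₁ ℤ.- i₀ ∣ → ∣ j₁ ℤ.- j₀ ∣ ≤ m⋆
          rotation-source {j₀ = j₀} {j₁} y∉C ζ∈C ζ≉ε n₀ n₁ n₂ n₃ far with far-or-close m⋆ j₁ j₀
          ... | inj₁ far′  = ⊥-elim (one-rotation y∉C ζ∈C ζ≉ε n₀ n₁ n₂ n₃ far far′)
          ... | inj₂ close = close

          -- `one-rotation` for the inverse of `w`: it is from the far end of `w` that the two lines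
          -- differ by `ζ`.
          rotation-target : ∀ {y y′ ζ i₀ i₁ j₀ j₁ A₀ A₁ B₀ B₁} → ¬ C (w ⁻¹ ∙ y) → C ζ → ¬ ζ ≈ ε → y′ ≈ w ∙ ζ ∙ w ⁻¹ ∙ y →
            Near y i₀ A₀ → Near (w ⁻¹ ∙ y) i₁ A₁ → Near y′ j₀ B₀ → Near (w ⁻¹ ∙ y′) j₁ B₁ →
            m⋆ < ∣ i₁ ℤ.- i₀ ∣ → ∣ j₁ ℤ.- j₀ ∣ ≤ m⋆
          rotation-target {y} {y′} {ζ} {i₀} {i₁} {j₀} {j₁} wy∉C ζ∈C ζ≉ε e n₀ n₁ n₂ n₃ far with far-or-close m⋆ j₀ j₁
          ... | inj₂ close = ≤-trans (≤-reflexive (ℤₚ.∣i-j∣≡∣j-i∣ j₁ j₀)) close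
          ... | inj₁ far′  = ⊥-elim (one-rotation {w = w ⁻¹} wy∉C ζ∈C ζ≉ε n₁
                  (near-resp (group! (w ∷ᵥ y ∷ᵥ []ᵥ) x₁ (x₀ ⁻ ⁻ · (x₀ ⁻ · x₁)) refl) n₀)
                  (near-resp (≈-trans (∙-congˡ e) (group! (w ∷ᵥ ζ ∷ᵥ y ∷ᵥ []ᵥ) (x₀ ⁻ · (x₀ · x₁ · x₀ ⁻ · x₂)) (x₁ · (x₀ ⁻ · x₂)) refl)) n₃)
                  (near-resp (≈-trans e (group! (w ∷ᵥ ζ ∷ᵥ y ∷ᵥ []ᵥ) (x₀ · x₁ · x₀ ⁻ · x₂) (x₀ ⁻ ⁻ · (x₁ · (x₀ ⁻ · x₂))) refl)) n₂)
                  (≤-trans far (≤-reflexive (ℤₚ.∣i-j∣≡∣j-i∣ i₁ i₀))) far′)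

          E⁻¹ : ∀ y → E ⁻¹ ∙ y ≈ w ⁻¹ ∙ (κ′ ⁻¹ ∙ y)
          E⁻¹ y = ≈-trans (∙-congʳ (⁻¹-cong E≈)) (group! (w ∷ᵥ z ∷ᵥ c ∷ᵥ y ∷ᵥ []ᵥ)
            ((x₀ · x₁ · x₀ ⁻ · x₂ · x₀) ⁻ · x₃) (x₀ ⁻ · ((x₀ · x₁ · x₀ ⁻ · x₂) ⁻ · x₃)) refl)

          R₁ B : ℕ
          R₁ = θ + (m⋆ + (Rₕ + (m⋆ + θ)))
          B  = Rₕ + (R₁ + (θ + (m⋆ + θ)))

          -- A long positive run of w on the line y would show up, reversed, as a long negative run of E on γy.
          run≤ : ∀ {y p₀ p₁ A₀ A₁} → ¬ C y → ¬ C (w ⁻¹ ∙ y) → Near y p₀ A₀ → Near (w ⁻¹ ∙ y) p₁ A₁ → p₁ ≲[ R₁ ] p₀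
          run≤ {y} {p₀} {p₁} y∉C wy∉C n₀ n₁ with far-or-close m⋆ p₁ p₀
          ... | inj₂ close = ≲-weaken {p₁} {p₀} (≤-trans (m≤m+n m⋆ (Rₕ + (m⋆ + θ))) (m≤n+m _ θ)) (dist⇒≲ {p₁} {p₀} close)
          ... | inj₁ far = ≲-stable {p₁} {R₁} {p₀} λ ¬le →
            near (γ ∙ y) λ (i₀ , _ , ni₀) → near (w ⁻¹ ∙ (γ ∙ y)) λ (i₁ , _ , ni₁) →
            near (c ⁻¹ ∙ y) λ (k₀ , _ , nk₀) → near (w ⁻¹ ∙ (c ⁻¹ ∙ y)) λ (k₁ , _ , nk₁) →
            -- Follow `E` along `γ ∙ y`. The first `w` has a short run there, and so has the last,
            -- which sees `c ⁻¹ ∙ y`, both by `one-rotation`; only the inverse of `w` in between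
            -- counts.
            ¬le (≲-trans {p₁} {i₁} {p₀} (dist⇒≳ {i₁} {p₁} (projection-of-coset wy∉C z∈C n₁
                  (near-resp (group! (w ∷ᵥ z ∷ᵥ y ∷ᵥ []ᵥ) (x₀ ⁻ · (x₀ · x₁ · x₀ ⁻ · x₂)) (x₁ · (x₀ ⁻ · x₂)) refl) ni₁)))
                (≲-trans {i₁} {i₀} {p₀} (dist⇒≲ {i₁} {i₀} (rotation-target wy∉C z∈C z≉ε ≈-refl n₀ n₁ ni₀ ni₁ far))
                (≲-trans {i₀} {k₁} {p₀} (never-backwards ni₀ (near-resp (≈-sym (≈-trans (E⁻¹ (γ ∙ y))
                    (group! (w ∷ᵥ z ∷ᵥ c ∷ᵥ y ∷ᵥ []ᵥ) (x₀ ⁻ · ((x₀ · x₁ · x₀ ⁻ · x₂) ⁻ · (x₀ · x₁ · x₀ ⁻ · x₃))) (x₀ ⁻ · (x₂ ⁻ · x₃)) refl))) nk₁))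
                (≲-trans {k₁} {k₀} {p₀} (dist⇒≲ {k₁} {k₀} (rotation-source y∉C c⁻¹∈C c⁻¹≉ε n₀ n₁ nk₀ nk₁ far))
                  (dist⇒≲ {k₀} {p₀} (projection-of-coset y∉C c⁻¹∈C n₀ nk₀))))))

          -- `E` never goes backwards on `y`, so a long negative run of the first `w` would have to
          -- be made up. The inverse of `w` cannot do it, by `rotation-target`, nor the last `w`, by
          -- `run≤`.
          run≥ : ∀ {y i₀ i₁ A₀ A₁} → ¬ C y → ¬ C (w ⁻¹ ∙ y) → ¬ C (γ ⁻¹ ∙ y) → ¬ C ((κ′ ∙ w) ⁻¹ ∙ y) →
            Near y i₀ A₀ → Near (w ⁻¹ ∙ y) i₁ A₁ → i₀ ≲[ B ] i₁
          run≥ {y} {i₀} {i₁} y∉C wy∉C γy∉C κwy∉C n₀ n₁ with far-or-close m⋆ i₁ i₀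
          ... | inj₂ close = ≲-weaken {i₀} {i₁} (≤-trans (≤-trans (≤-trans (m≤m+n m⋆ θ) (m≤n+m _ θ)) (m≤n+m _ R₁)) (m≤n+m _ Rₕ)) (dist⇒≳ {i₁} {i₀} close)
          ... | inj₁ far = ≲-stable {i₀} {B} {i₁} λ ¬le →
            near (γ ⁻¹ ∙ y) λ (j₀ , _ , nj₀) → near (w ⁻¹ ∙ (γ ⁻¹ ∙ y)) λ (j₁ , _ , nj₁) →
            near (κ′ ⁻¹ ∙ y) λ (k₀ , _ , nk₀) → near (w ⁻¹ ∙ (κ′ ⁻¹ ∙ y)) λ (k₁ , _ , nk₁) →
            ¬le (≲-trans {i₀} {k₁} {i₁} (never-backwards n₀ (near-resp (≈-sym (E⁻¹ y)) nk₁))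
                (≲-trans {k₁} {k₀} {i₁} (run≤ (γy∉C ∘ C-cancelˡ c⁻¹∈C ∘ C-resp (κ⁻¹ y)) (κwy∉C ∘ C-resp κw⁻¹) nk₀ nk₁)
                (≲-trans {k₀} {j₀} {i₁} (dist⇒≲ {k₀} {j₀} (projection-of-coset γy∉C c⁻¹∈C nj₀ (near-resp (κ⁻¹ y) nk₀)))
                (≲-trans {j₀} {j₁} {i₁} (dist⇒≳ {j₁} {j₀} (rotation-target wy∉C (C-⁻¹ z∈C) z⁻¹≉ε
                    (group! (w ∷ᵥ z ∷ᵥ y ∷ᵥ []ᵥ) ((x₀ · x₁ · x₀ ⁻) ⁻ · x₂) (x₀ · x₁ ⁻ · x₀ ⁻ · x₂) refl) n₀ n₁ nj₀ nj₁ far))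
                  (dist⇒≲ {j₁} {i₁} (projection-of-coset wy∉C (C-⁻¹ z∈C) n₁
                    (near-resp (group! (w ∷ᵥ z ∷ᵥ y ∷ᵥ []ᵥ) (x₀ ⁻ · ((x₀ · x₁ · x₀ ⁻) ⁻ · x₂)) (x₁ ⁻ · (x₀ ⁻ · x₂)) refl) nj₁)))))))
            where
            κw⁻¹ : w ⁻¹ ∙ (κ′ ⁻¹ ∙ y) ≈ (κ′ ∙ w) ⁻¹ ∙ y
            κw⁻¹ = group! (w ∷ᵥ κ′ ∷ᵥ y ∷ᵥ []ᵥ) (x₀ ⁻ · (x₁ ⁻ · x₂)) ((x₁ · x₀) ⁻ · x₂) refl
            κ⁻¹ : ∀ y → κ′ ⁻¹ ∙ y ≈ c ⁻¹ ∙ (γ ⁻¹ ∙ y)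
            κ⁻¹ y = group! (γ ∷ᵥ c ∷ᵥ y ∷ᵥ []ᵥ) ((x₀ · x₁) ⁻ · x₂) (x₁ ⁻ · (x₀ ⁻ · x₂)) refl

          Q : ℕ
          Q = R₁ + (θ + (B + (θ + R₁)))

          -- The factors `w`, `w ⁻¹`, `w` of `E` see the lines of `y`, `γ ⁻¹ ∙ y` and `κ′ ⁻¹ ∙ y`.
          -- None can gain much: the outer two by `run≤`, the middle one by `run≥`, whose use at
          -- `γ ⁻¹ ∙ y` is the source of the last two hypotheses.
          bounded-run : ∀ t s → t + suc s ≡ M → let y = pow G blk t ∙ f in
            ¬ C y → ¬ C (w ⁻¹ ∙ y) → ¬ C (γ ⁻¹ ∙ y) → ¬ C ((κ′ ∙ w) ⁻¹ ∙ y) → ¬ C ((γ ∙ γ) ⁻¹ ∙ y) → ¬ C ((γ ∙ (κ′ ∙ w)) ⁻¹ ∙ y) →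
            N ≤ Rₐ + Q
          bounded-run t s eq y∉C wy∉C γy∉C κwy∉C γγy∉C γκwy∉C = ≤-stable λ ¬le →
            near y λ (i₀ , _ , ni₀) → near (w ⁻¹ ∙ y) λ (i₁ , _ , ni₁) →
            near (γ ⁻¹ ∙ y) λ (j₀ , _ , nj₀) → near (w ⁻¹ ∙ (γ ⁻¹ ∙ y)) λ (j₁ , _ , nj₁) →
            near (κ′ ⁻¹ ∙ y) λ (k₀ , _ , nk₀) → near (w ⁻¹ ∙ (κ′ ⁻¹ ∙ y)) λ (k₁ , _ , nk₁) →
            ¬le (gain {i₀} {k₁} {N} {Rₐ} {Q} (run t s eq ni₀ (near-resp (≈-sym (E⁻¹ y)) nk₁))
              (≲-trans {k₁} {k₀} {i₀} (run≤ (γy∉C ∘ C-cancelˡ c⁻¹∈C ∘ C-resp κ⁻¹) (κwy∉C ∘ C-resp κw⁻¹) nk₀ nk₁)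
              (≲-trans {k₀} {j₀} {i₀} (dist⇒≲ {k₀} {j₀} (projection-of-coset γy∉C c⁻¹∈C nj₀ (near-resp κ⁻¹ nk₀)))
              (≲-trans {j₀} {j₁} {i₀} (run≥ γy∉C (wy∉C ∘ C-cancelˡ (C-⁻¹ z∈C) ∘ C-resp wγ⁻¹)
                  (γγy∉C ∘ C-resp (group! (γ ∷ᵥ y ∷ᵥ []ᵥ) (x₀ ⁻ · (x₀ ⁻ · x₁)) ((x₀ · x₀) ⁻ · x₁) refl))
                  (γκwy∉C ∘ C-resp (group! (γ ∷ᵥ (κ′ ∙ w) ∷ᵥ y ∷ᵥ []ᵥ) (x₁ ⁻ · (x₀ ⁻ · x₂)) ((x₀ · x₁) ⁻ · x₂) refl)) nj₀ nj₁)
              (≲-trans {j₁} {i₁} {i₀} (dist⇒≲ {j₁} {i₁} (projection-of-coset wy∉C (C-⁻¹ z∈C) ni₁ (near-resp wγ⁻¹ nj₁)))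
                (run≤ y∉C wy∉C ni₀ ni₁))))))
            where
            y = pow G blk t ∙ f
            κw⁻¹ : w ⁻¹ ∙ (κ′ ⁻¹ ∙ y) ≈ (κ′ ∙ w) ⁻¹ ∙ y
            κw⁻¹ = group! (w ∷ᵥ κ′ ∷ᵥ y ∷ᵥ []ᵥ) (x₀ ⁻ · (x₁ ⁻ · x₂)) ((x₁ · x₀) ⁻ · x₂) refl
            κ⁻¹ : κ′ ⁻¹ ∙ y ≈ c ⁻¹ ∙ (γ ⁻¹ ∙ y)
            κ⁻¹ = group! (γ ∷ᵥ c ∷ᵥ y ∷ᵥ []ᵥ) ((x₀ · x₁) ⁻ · x₂) (x₁ ⁻ · (x₀ ⁻ · x₂)) refl
            wγ⁻¹ : w ⁻¹ ∙ (γ ⁻¹ ∙ y) ≈ z ⁻¹ ∙ (w ⁻¹ ∙ y)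
            wγ⁻¹ = group! (w ∷ᵥ z ∷ᵥ y ∷ᵥ []ᵥ) (x₀ ⁻ · ((x₀ · x₁ · x₀ ⁻) ⁻ · x₂)) (x₁ ⁻ · (x₀ ⁻ · x₂)) refl

          -- The cosets of `C` excluded in `bounded-run`. There are six, and this is why seven
          -- blocks are taken.
          rep : Fin 6 → Γ
          rep zero                                   = ε
          rep (suc zero)                             = w
          rep (suc (suc zero))                       = γ
          rep (suc (suc (suc zero)))                 = κ′ ∙ w
          rep (suc (suc (suc (suc zero))))           = γ ∙ γ
          rep (suc (suc (suc (suc (suc zero)))))     = γ ∙ (κ′ ∙ w)

          some-coset : Rₐ + Q < N → ∀ t s → t + suc s ≡ M → ¬ ¬ (∃ λ q → C (rep q ⁻¹ ∙ (pow G blk t ∙ f)))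
          some-coset large t s eq κ″ = ℕₚ.<⇒≱ large (bounded-run t s eq
            (λ x → κ″ (zero , C-resp (group! ((pow G blk t ∙ f) ∷ᵥ []ᵥ) x₀ (one ⁻ · x₀) refl) x))
            (λ x → κ″ (suc zero , x))
            (λ x → κ″ (suc (suc zero) , x))
            (λ x → κ″ (suc (suc (suc zero)) , x))
            (λ x → κ″ (suc (suc (suc (suc zero))) , x))
            (λ x → κ″ (suc (suc (suc (suc (suc zero)))) , x)))

      -- Two axes in one coset would put a positive power of `τ`, the block conjugated by `f`, into
      -- `C`, against `root-closed`.
      distinct-cosets : ∀ {q} t d → C (q ⁻¹ ∙ (pow G blk t ∙ f)) → C (q ⁻¹ ∙ (pow G blk (t + suc d) ∙ f)) → ⊥
      distinct-cosets {q} t d p p′ = root-closed τ∉C d (C-resp (begin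
          (q ⁻¹ ∙ (X ∙ f)) ⁻¹ ∙ (q ⁻¹ ∙ (pow G blk (t + suc d) ∙ f))
            ≈⟨ ∙-congˡ (∙-congˡ (∙-congʳ (pow-+ blk t (suc d)))) ⟩
          (q ⁻¹ ∙ (X ∙ f)) ⁻¹ ∙ (q ⁻¹ ∙ (X ∙ Y ∙ f))
            ≈⟨ group! (q ∷ᵥ X ∷ᵥ f ∷ᵥ Y ∷ᵥ []ᵥ) ((x₀ ⁻ · (x₁ · x₂)) ⁻ · (x₀ ⁻ · (x₁ · x₃ · x₂))) (x₂ ⁻ · (x₃ · x₂)) refl ⟩
          f ⁻¹ ∙ (Y ∙ f)
            ≈⟨ ∙-congˡ (intertwine-pow (suc d) (≈-sym (assoc _ _ _))) ⟨
          f ⁻¹ ∙ (f ∙ pow G τ (suc d))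
            ≈⟨ group! (f ∷ᵥ pow G τ (suc d) ∷ᵥ []ᵥ) (x₀ ⁻ · (x₀ · x₁)) x₁ refl ⟩
          pow G τ (suc d)   ∎) (C-∙ (C-⁻¹ p) p′))
        where
        X = pow G blk t
        Y = pow G blk (suc d)
        τ = pow G c N ∙ f
        τ∉C : ¬ C τ
        τ∉C = f∉C ∘ C-cancelˡ (C-zp (+ N))

    -- This is 1 + Rₐ + Q for M = 7.
    threshold : ℕ → ℕ
    threshold r = suc ((7 * R₀ + K₃ + (lf + K₃) + back) + (up + (θ + ((back + (up + (θ + (m⋆ + θ)))) + (θ + up)))))
      where
      back up : ℕ
      back = (7 * R₀ + K₃) + (r + K₃)
      up   = θ + (m⋆ + (back + (m⋆ + θ)))

    avoids : ∀ {g r N} → WL g r → threshold r ≤ N → ¬ T (pow G (f ∙ pow G c N) 7 ∙ g)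
    avoids {g} {r} {N} wg large (w , z , z∈C , z≉ε , e) =
      ¬¬-∀Fin (λ t → some-coset N wg 7 z∈C z≉ε e large (toℕ t) (6 ∸ toℕ t) (total t)) λ cosets →
        clash cosets (Finₚ.pigeonhole (ℕₚ.≤-refl {7}) (λ t → proj₁ (cosets t)))
      where
      total : ∀ (t : Fin 7) → toℕ t + suc (6 ∸ toℕ t) ≡ 7
      total t = ≡.trans (ℕₚ.+-suc (toℕ t) _) (≡.cong suc (ℕₚ.m+[n∸m]≡n (Finₚ.toℕ≤pred[n] t)))
      rep′ = rep N wg 7 z∈C z≉ε e
      clash : (cosets : ∀ (t : Fin 7) → ∃ λ q → C (rep′ q ⁻¹ ∙ (pow G (blk N) (toℕ t) ∙ f))) →
        (∃₂ λ s t → s Fin.< t × proj₁ (cosets s) ≡ proj₁ (cosets t)) → ⊥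
      clash cosets (s , t , s<t , eq) = distinct-cosets N (toℕ s) (toℕ t ∸ suc (toℕ s)) (proj₂ (cosets s))
        (≡.subst₂ (λ q n → C (rep′ q ⁻¹ ∙ (pow G (blk N) n ∙ f))) (≡.sym eq)
          (≡.trans (≡.sym (ℕₚ.m+[n∸m]≡n s<t)) (≡.sym (ℕₚ.+-suc (toℕ s) _))) (proj₂ (cosets t)))

-- Ramsey's theorem for pairs in a list

ramseyNumber : ℕ → ℕ → ℕ
ramseyNumber zero    n       = 0
ramseyNumber (suc m) zero    = 0
ramseyNumber (suc m) (suc n) = suc (ramseyNumber m (suc n) + ramseyNumber (suc m) n)

module _ {a} {A : Set a} where
  nth : A → List A → ℕ → A
  nth d []       n       = d
  nth d (x ∷ xs) zero    = x
  nth d (x ∷ xs) (suc n) = nth d xs n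

  All-nth : ∀ {p} {P : A → Set p} {d xs} → All P xs → ∀ n → n < length xs → P (nth d xs n)
  All-nth (px All.∷ pxs) zero    (s≤s l) = px
  All-nth (px All.∷ pxs) (suc n) (s≤s l) = All-nth pxs n l

  AllPairs-nth : ∀ {r} {R : A → A → Set r} {d xs} → AllPairs R xs → ∀ m n → m < n → n < length xs → R (nth d xs m) (nth d xs n)
  AllPairs-nth (rx AllPairs.∷ rxs) zero    (suc n) m<n       (s≤s l) = All-nth rx n l
  AllPairs-nth (rx AllPairs.∷ rxs) (suc m) (suc n) (s≤s m<n) (s≤s l) = AllPairs-nth rxs m n m<n l

  ¬¬-AllPairs : ∀ {r s} {R : A → A → Set r} {R′ : A → A → Set s} → (∀ {x y} → R x y → ¬ ¬ R′ x y) → ∀ {xs} → AllPairs R xs → ¬ ¬ AllPairs R′ xs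
  ¬¬-AllPairs h AllPairs.[] κ = κ AllPairs.[]
  ¬¬-AllPairs {R = R} {R′} h (rx AllPairs.∷ rxs) κ = ¬¬-AllPairs h rxs λ ps → row rx λ p → κ (p AllPairs.∷ ps)
    where
    row : ∀ {x ys} → All (R x) ys → ¬ ¬ All (R′ x) ys
    row All.[] κ′ = κ′ All.[]
    row (r All.∷ rs) κ′ = h r λ p → row rs λ ps → κ′ (p All.∷ ps)

  record Split {p q r w} (P : A → Set p) (Q : A → Set q) (R : A → A → Set r) (W : A → Set w) (xs : List A) : Set (a ⊔ p ⊔ q ⊔ r ⊔ w) where
    constructor split
    field
      {ys zs} : List A
      allP    : All P ys
      allQ    : All Q zs
      pairsʸ  : AllPairs R ys
      pairsᶻ  : AllPairs R zs
      allʸ    : All W ys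
      allᶻ    : All W zs
      total   : length xs ≤ length ys + length zs

  partition : ∀ {p q r w} {P : A → Set p} {Q : A → Set q} {R : A → A → Set r} {W : A → Set w} {xs} →
    All (λ x → P x ⊎ Q x) xs → AllPairs R xs → All W xs → Split P Q R W xs
  partition All.[] AllPairs.[] All.[] = split All.[] All.[] AllPairs.[] AllPairs.[] All.[] All.[] z≤n
  partition {W = W} (pq All.∷ pqs) (rx AllPairs.∷ rxs) (wx All.∷ wxs)
    with pq | partition pqs rxs (All.zip (rx , wxs))
  ... | inj₁ p | split ps qs ry rz wy wz l = split (p All.∷ ps) qs (All.map proj₁ wy AllPairs.∷ ry) rz
          (wx All.∷ All.map proj₂ wy) (All.map proj₂ wz) (s≤s l)
  ... | inj₂ q | split {ys} {zs} ps qs ry rz wy wz l = split ps (q All.∷ qs) ry (All.map proj₁ wz AllPairs.∷ rz)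
          (All.map proj₂ wy) (wx All.∷ All.map proj₂ wz) (≤-trans (s≤s l) (≤-reflexive (≡.sym (ℕₚ.+-suc (length ys) (length zs)))))

  -- `W` remembers the colours of the pairs formed with heads already removed, so that a head can be
  -- put back when the recursion returns.
  ramsey : ∀ m n {p q w} {P : A → A → Set p} {Q : A → A → Set q} {W : A → Set w} {xs} →
    ramseyNumber m n ≤ length xs → AllPairs (λ x y → P x y ⊎ Q x y) xs → All W xs →
    (∃ λ ys → m ≤ length ys × AllPairs P ys × All W ys) ⊎ (∃ λ ys → n ≤ length ys × AllPairs Q ys × All W ys)
  ramsey zero    n       l pq wx = inj₁ ([] , z≤n , AllPairs.[] , All.[])
  ramsey (suc m) zero    l pq wx = inj₂ ([] , z≤n , AllPairs.[] , All.[])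
  ramsey (suc m) (suc n) {P = P} {Q} {W} (s≤s l) (rx AllPairs.∷ rxs) (w₀ All.∷ wxs)
    with partition {P = P _} {Q = Q _} rx rxs wxs
  ... | split {ys} {zs} ps qs ry rz wy wz tot with ramseyNumber m (suc n) ≤? length ys
  ... | yes ly = left (ramsey m (suc n) ly ry (All.zip (ps , wy)))
    where
    left : (∃ λ vs → m ≤ length vs × AllPairs P vs × All (λ y → P _ y × W y) vs) ⊎
           (∃ λ vs → suc n ≤ length vs × AllPairs Q vs × All (λ y → P _ y × W y) vs) → _
    left (inj₁ (vs , lv , pv , wv)) = inj₁ (_ ∷ vs , s≤s lv , All.map proj₁ wv AllPairs.∷ pv , w₀ All.∷ All.map proj₂ wv)
    left (inj₂ (vs , lv , qv , wv)) = inj₂ (vs , lv , qv , All.map proj₂ wv)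
  ... | no ≰ = right (ramsey (suc m) n lz rz (All.zip (qs , wz)))
    where
    lz : ramseyNumber (suc m) n ≤ length zs
    lz = ℕₚ.+-cancelˡ-≤ (ramseyNumber m (suc n)) _ _ (≤-trans l (≤-trans tot (+-monoˡ-≤ (length zs) (ℕₚ.<⇒≤ (≰⇒> ≰)))))
    right : (∃ λ vs → suc m ≤ length vs × AllPairs P vs × All (λ y → Q _ y × W y) vs) ⊎
            (∃ λ vs → n ≤ length vs × AllPairs Q vs × All (λ y → Q _ y × W y) vs) → _
    right (inj₁ (vs , lv , pv , wv)) = inj₁ (vs , lv , pv , All.map proj₂ wv)
    right (inj₂ (vs , lv , qv , wv)) = inj₂ (_ ∷ vs , s≤s lv , All.map proj₁ wv AllPairs.∷ qv , w₀ All.∷ All.map proj₂ wv)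

-- Conjugate frames and Boolean combinations of equational sets

module Frames {c ℓ : Level} (G : Group c ℓ) (e₁ e₂ : Group.Carrier G) where
  open GroupLemmas G
  open Semantics G hiding (evalT)
  open BoolSem G
  open import Relation.Binary.Reasoning.Setoid setoid

  evalT-conj : ∀ {n} (t : Term n) {ρ ρ′ : Fin n → Γ} k → (∀ i → ρ′ i ≈ k ∙ ρ i ∙ k ⁻¹) → evalT ρ′ t ≈ k ∙ evalT ρ t ∙ k ⁻¹
  evalT-conj (var i) k h = h i
  evalT-conj one k h = group! (k ∷ᵥ []ᵥ) one (x₀ · one · x₀ ⁻) refl
  evalT-conj (mul s t) k h = ≈-trans (∙-cong (evalT-conj s k h) (evalT-conj t k h))
    (group! (k ∷ᵥ _ ∷ᵥ _ ∷ᵥ []ᵥ) (x₀ · x₁ · x₀ ⁻ · (x₀ · x₂ · x₀ ⁻)) (x₀ · (x₁ · x₂) · x₀ ⁻) refl)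
  evalT-conj (inv t) k h = ≈-trans (⁻¹-cong (evalT-conj t k h))
    (group! (k ∷ᵥ _ ∷ᵥ []ᵥ) ((x₀ · x₁ · x₀ ⁻) ⁻) (x₀ · x₁ ⁻ · x₀ ⁻) refl)

  conj-sym : ∀ {x y} k → y ≈ k ∙ x ∙ k ⁻¹ → x ≈ k ⁻¹ ∙ y ∙ (k ⁻¹) ⁻¹
  conj-sym {x} {y} k e = ≈-sym (≈-trans (∙-congʳ (∙-congˡ e)) (group! (k ∷ᵥ x ∷ᵥ []ᵥ) (x₀ ⁻ · (x₀ · x₁ · x₀ ⁻) · x₀ ⁻ ⁻) x₁ refl))

  Sat-conj : ∀ {n} (φ : Formula n) {ρ ρ′ : Fin n → Γ} k → (∀ i → ρ′ i ≈ k ∙ ρ i ∙ k ⁻¹) → Sat ρ φ → Sat ρ′ φ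
  Sat-conj (s ≐ t) {ρ} k h (lift e) = lift (≈-trans (evalT-conj s k h) (≈-trans (∙-congʳ (∙-congˡ e)) (≈-sym (evalT-conj t k h))))
  Sat-conj ff k h (lift ())
  Sat-conj (neg φ) k h ¬s s = ¬s (Sat-conj φ (k ⁻¹) (λ i → conj-sym k (h i)) s)
  Sat-conj (conj φ ψ) k h (s , t) = Sat-conj φ k h s , Sat-conj ψ k h t
  Sat-conj (disj φ ψ) k h (inj₁ s) = inj₁ (Sat-conj φ k h s)
  Sat-conj (disj φ ψ) k h (inj₂ t) = inj₂ (Sat-conj ψ k h t)
  Sat-conj (ex φ) k h (x , s) = k ∙ x ∙ k ⁻¹ , Sat-conj φ k (λ { zero → ≈-refl ; (suc i) → h i }) s
  Sat-conj (all φ) k h s x = Sat-conj φ k (λ { zero → group! (k ∷ᵥ x ∷ᵥ []ᵥ) x₁ (x₀ · (x₀ ⁻ · x₁ · x₀) · x₀ ⁻) refl ; (suc i) → h i }) (s (k ⁻¹ ∙ x ∙ k))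

  frame : Γ → Vector Γ 2
  frame g zero       = g ∙ e₁ ∙ g ⁻¹
  frame g (suc zero) = g ∙ e₂ ∙ g ⁻¹

  Hat : Formula 4 → Γ → Set (c ⊔ ℓ)
  Hat A x = _∈D[_,_] {2} {2} A (frame ε) (frame x)

  frames-conj : ∀ k g h i → (frame (k ∙ g) ++ᶠ frame (k ∙ h)) i ≈ k ∙ (frame g ++ᶠ frame h) i ∙ k ⁻¹
  frames-conj k g h zero = group! (k ∷ᵥ g ∷ᵥ e₁ ∷ᵥ []ᵥ) (x₀ · x₁ · x₂ · (x₀ · x₁) ⁻) (x₀ · (x₁ · x₂ · x₁ ⁻) · x₀ ⁻) refl
  frames-conj k g h (suc zero) = group! (k ∷ᵥ g ∷ᵥ e₂ ∷ᵥ []ᵥ) (x₀ · x₁ · x₂ · (x₀ · x₁) ⁻) (x₀ · (x₁ · x₂ · x₁ ⁻) · x₀ ⁻) refl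
  frames-conj k g h (suc (suc zero)) = group! (k ∷ᵥ h ∷ᵥ e₁ ∷ᵥ []ᵥ) (x₀ · x₁ · x₂ · (x₀ · x₁) ⁻) (x₀ · (x₁ · x₂ · x₁ ⁻) · x₀ ⁻) refl
  frames-conj k g h (suc (suc (suc zero))) = group! (k ∷ᵥ h ∷ᵥ e₂ ∷ᵥ []ᵥ) (x₀ · x₁ · x₂ · (x₀ · x₁) ⁻) (x₀ · (x₁ · x₂ · x₁ ⁻) · x₀ ⁻) refl

  frame-cong : ∀ {g g′ h h′} → g ≈ g′ → h ≈ h′ → ∀ i → (frame g ++ᶠ frame h) i ≈ ε ∙ (frame g′ ++ᶠ frame h′) i ∙ ε ⁻¹
  frame-cong {g} {g′} {h} {h′} p q i = ≈-trans (pointwise i) (group! (_ ∷ᵥ []ᵥ) x₀ (one · x₀ · one ⁻) refl)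
    where
    pointwise : ∀ i → (frame g ++ᶠ frame h) i ≈ (frame g′ ++ᶠ frame h′) i
    pointwise zero                   = ∙-cong (∙-congʳ p) (⁻¹-cong p)
    pointwise (suc zero)             = ∙-cong (∙-congʳ p) (⁻¹-cong p)
    pointwise (suc (suc zero))       = ∙-cong (∙-congʳ q) (⁻¹-cong q)
    pointwise (suc (suc (suc zero))) = ∙-cong (∙-congʳ q) (⁻¹-cong q)

  Hat⇒D : ∀ A g h {x} → g ⁻¹ ∙ h ≈ x → Hat A x → _∈D[_,_] {2} {2} A (frame g) (frame h)
  Hat⇒D A g h {x} e s = Sat-conj A ε (frame-cong (≈-sym (identityʳ g)) (≈-trans (group! (g ∷ᵥ h ∷ᵥ []ᵥ) x₁ (x₀ · (x₀ ⁻ · x₁)) refl) (∙-congˡ e)))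
    (Sat-conj A g (frames-conj g ε x) s)

  D⇒Hat : ∀ A g h {x} → g ⁻¹ ∙ h ≈ x → _∈D[_,_] {2} {2} A (frame g) (frame h) → Hat A x
  D⇒Hat A g h {x} e s = Sat-conj A ε (frame-cong (≈-sym (inverseˡ g)) (≈-sym e)) (Sat-conj A (g ⁻¹) (frames-conj (g ⁻¹) g h) s)

  Eq : Formula 4 → Set (c ⊔ ℓ)
  Eq = Equational {2} {2}

  -- frame xᵢ⁻¹ and frame (xₖ⁻¹ g) have quotient xᵢ xₖ⁻¹ g, which is g on the diagonal.
  chain-bound : ∀ A ((N , _) : Eq A) {g} → ¬ Hat A g → (x : ℕ → Γ) → ∀ {is} →
    AllPairs (λ k i → Hat A (x i ∙ x k ⁻¹ ∙ g)) is → length is ≤ N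
  chain-bound A (N , bound) {g} ¬Ag x {is} pairs = bound (length is) (λ j → frame (at j ⁻¹ ∙ g)) λ j j< →
      frame (at (suc j) ⁻¹) ,
      (λ i i≤j → Hat⇒D A _ _ (quotient (at (suc j)) (at i)) (AllPairs-nth pairs i (suc j) (s≤s i≤j) j<)) ,
      λ inPrefix → ¬Ag (D⇒Hat A _ _ (group! (at (suc j) ∷ᵥ g ∷ᵥ []ᵥ) (x₀ ⁻ ⁻ · (x₀ ⁻ · x₁)) x₁ refl) (inPrefix (suc j) ≤-refl))
    where
    at : ℕ → Γ
    at j = x (nth 0 is j)
    quotient : ∀ p q → (p ⁻¹) ⁻¹ ∙ (q ⁻¹ ∙ g) ≈ p ∙ q ⁻¹ ∙ g
    quotient p q = group! (p ∷ᵥ q ∷ᵥ g ∷ᵥ []ᵥ) (x₀ ⁻ ⁻ · (x₁ ⁻ · x₂)) (x₀ · x₁ ⁻ · x₂) refl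

  AllFalse : List (Formula 4) → Γ → Set (c ⊔ ℓ)
  AllFalse Z x = All (λ A → ¬ Hat A x) Z

  -- A pair must be left when all atoms are treated, hence `2`. Each atom costs one Ramsey step,
  -- with `suc N` because `chain-bound` forbids more than `N`.
  pairLength : ∀ {Z} → All Eq Z → ℕ
  pairLength All.[]              = 2
  pairLength ((N , _) All.∷ eqs) = ramseyNumber (suc N) (pairLength eqs)

  -- By `chain-bound` no long sublist has `A` true at all its pairs, so Ramsey's theorem leaves one
  -- with `A` false at all of them; `Q` accumulates what earlier atoms have yielded.
  all-false-pair : ∀ {Z} (eqs : All Eq Z) {g} → AllFalse Z g → ∀ (x : ℕ → Γ) {q} {Q : ℕ → ℕ → Set q} is →
    pairLength eqs ≤ length is → AllPairs Q is → ¬ ¬ (∃₂ λ k i → Q k i × AllFalse Z (x i ∙ x k ⁻¹ ∙ g))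
  all-false-pair All.[] _ x (k ∷ i ∷ is) l ((q All.∷ _) AllPairs.∷ _) κ = κ (k , i , q , All.[])
  all-false-pair All.[] _ x (k ∷ []) (s≤s ())
  all-false-pair {A ∷ Z} (eqA All.∷ eqs) {g} (¬Ag All.∷ fs) x {Q = Q} is l pairs κ =
    ¬¬-AllPairs {R′ = λ k i → H k i ⊎ (Q k i × ¬ H k i)} (λ q κ′ → em λ { (inj₁ y) → κ′ (inj₁ y) ; (inj₂ n) → κ′ (inj₂ (q , n)) }) pairs λ coloured →
      mono (ramsey (suc (proj₁ eqA)) (pairLength eqs) {W = λ _ → ⊤} l coloured (All.universal (λ _ → tt) is))
    where
    H : ℕ → ℕ → Set (c ⊔ ℓ)
    H k i = Hat A (x i ∙ x k ⁻¹ ∙ g)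
    mono : (∃ λ ys → suc (proj₁ eqA) ≤ length ys × AllPairs H ys × All (λ _ → ⊤) ys) ⊎
           (∃ λ ys → pairLength eqs ≤ length ys × AllPairs (λ k i → Q k i × ¬ H k i) ys × All (λ _ → ⊤) ys) → ⊥
    mono (inj₁ (ys , ly , ps , _)) = ℕₚ.<⇒≱ ly (chain-bound A eqA ¬Ag x ps)
    mono (inj₂ (ys , ly , ps , _)) = all-false-pair eqs fs x ys ly ps λ (k , i , (q , ¬h) , fs′) → κ (k , i , q , ¬h All.∷ fs′)

  Decided : List (Formula 4) → Formula 4 → Set (c ⊔ ℓ)
  Decided Z A = (∀ x → AllFalse Z x → ¬ Hat A x) ⊎ (∀ x → AllFalse Z x → ¬ ¬ Hat A x)

  Decided-mono : ∀ {Z Z′} → (∀ {x} → AllFalse Z′ x → AllFalse Z x) → ∀ {A} → Decided Z A → Decided Z′ A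
  Decided-mono sub (inj₁ d) = inj₁ λ x → d x ∘ sub
  Decided-mono sub (inj₂ d) = inj₂ λ x → d x ∘ sub

  AllAtoms-map : ∀ {P Q : Formula 4 → Set (c ⊔ ℓ)} → (∀ {A} → P A → Q A) → ∀ b → AllAtoms P b → AllAtoms Q b
  AllAtoms-map h (atom A)   p       = h p
  AllAtoms-map h (bneg b)   p       = AllAtoms-map h b p
  AllAtoms-map h (band b d) (p , q) = AllAtoms-map h b p , AllAtoms-map h d q
  AllAtoms-map h (bor b d)  (p , q) = AllAtoms-map h b p , AllAtoms-map h d q

  record Stage : Set (c ⊔ ℓ) where
    constructor stage
    field
      {Z}       : List (Formula 4)
      {g}       : Γ
      equations : All Eq Z
      false-at  : AllFalse Z g

  record _⟶_ (s : Stage) (b : BoolComb 4) : Set (c ⊔ ℓ) where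
    constructor refined
    field
      {next}  : Stage
      sub     : ∀ {x} → AllFalse (Stage.Z next) x → AllFalse (Stage.Z s) x
      decided : AllAtoms (Decided (Stage.Z next)) b

  -- Maximality obtained greedily: an atom that can fail together with `Z` joins `Z`, and any other
  -- holds wherever `Z` fails. Either way its truth value is constant there, and remains so when `Z`
  -- grows.
  refine : ∀ b → AllAtoms Eq b → ∀ s → ¬ ¬ (s ⟶ b)
  refine (atom A) eqA s κ = em {X = ∃ λ x → AllFalse (Stage.Z s) x × ¬ Hat A x} λ
    { (inj₁ (x , fs , ¬Ax)) → κ (refined {next = stage (eqA All.∷ Stage.equations s) (¬Ax All.∷ fs)} All.tail (inj₁ λ _ → All.head))
    ; (inj₂ none) → κ (refined {next = s} id (inj₂ λ x fs ¬Ax → none (x , fs , ¬Ax))) }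
  refine (bneg b) eqs s κ = refine b eqs s λ (refined {s₁} sub d) → κ (refined {next = s₁} sub d)
  refine (band b d) (p , q) s κ = refine b p s λ (refined {s₁} sub₁ d₁) → refine d q s₁ λ (refined {s₂} sub₂ d₂) →
    κ (refined {next = s₂} (sub₁ ∘ sub₂) (AllAtoms-map (Decided-mono sub₂) b d₁ , d₂))
  refine (bor b d) (p , q) s κ = refine b p s λ (refined {s₁} sub₁ d₁) → refine d q s₁ λ (refined {s₂} sub₂ d₂) →
    κ (refined {next = s₂} (sub₁ ∘ sub₂) (AllAtoms-map (Decided-mono sub₂) b d₁ , d₂))

  same-truth : ∀ {Z} b → AllAtoms (Decided Z) b → ∀ {x y} → AllFalse Z x → AllFalse Z y →
    Hat (toFormula b) x → ¬ ¬ Hat (toFormula b) y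
  same-truth (atom A) (inj₁ d) {x} fx fy s κ = d x fx s
  same-truth (atom A) (inj₂ d) {y = y} fx fy s κ = d y fy κ
  same-truth (bneg b) d fx fy ¬s κ = κ λ s → same-truth b d fy fx s ¬s
  same-truth (band b b′) (d , d′) fx fy (s , s′) κ = same-truth b d fx fy s λ t → same-truth b′ d′ fx fy s′ λ t′ → κ (t , t′)
  same-truth (bor b b′) (d , d′) fx fy (inj₁ s) κ = same-truth b d fx fy s (κ ∘ inj₁)
  same-truth (bor b b′) (d , d′) fx fy (inj₂ s) κ = same-truth b′ d′ fx fy s (κ ∘ inj₂)

  -- From `g` one pair leads to a point outside `φ`, and from there another leads to a point inside.
  -- All of `Z` fails at both, so `same-truth` cannot separate them.
  not-boolean : (φ : Formula 4) →
    (∀ g → ∃ λ (y : ℕ → Γ) → ∀ k i → k < i → ¬ Hat φ (y i ∙ y k ⁻¹ ∙ g)) →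
    (∀ g → ∃ λ (y : ℕ → Γ) → ∀ k i → k < i → Hat φ (y i ∙ y k ⁻¹ ∙ g)) →
    ¬ InEqBoolAlg {2} {2} φ
  not-boolean φ leave enter (b , eqs , iff) =
    refine b eqs (stage {g = ε} All.[] All.[]) λ (refined {stage {g = g} eqZ f} _ decided) →
      let L = pairLength eqZ
          (y , out) = leave g in
      all-false-pair eqZ f y (upTo L) (≤-reflexive (≡.sym (Listₚ.length-upTo L))) (sorted L) λ (k , i , k<i , f₁) →
      let g₁ = y i ∙ y k ⁻¹ ∙ g
          (y′ , inside) = enter g₁ in
      all-false-pair eqZ f₁ y′ (upTo L) (≤-reflexive (≡.sym (Listₚ.length-upTo L))) (sorted L) λ (k′ , i′ , k<i′ , f₂) →
      same-truth b decided f₂ f₁ (proj₁ (iff _ _) (inside k′ i′ k<i′)) λ s → out k i k<i (proj₂ (iff _ _) s)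
    where
    sorted : ∀ L → AllPairs _<_ (upTo L)
    sorted L = AllPairsₚ.applyUpTo⁺₁ id L λ i<j _ → i<j

-- A formula for `T` in terms of two frames, and the sequences that leave and enter it

φ₀ : Formula 4
-- The first two equations recover the quotient `x` of the two frames; the others say that it
-- belongs to `T`, with `C` expressed as the centralizer of `p₁`.
φ₀ = ex (ex (ex (conj (q₁ ≐ (x · p₁ · x ⁻)) (conj (q₂ ≐ (x · p₂ · x ⁻))
       (conj ((z · p₁) ≐ (p₁ · z)) (conj (neg (z ≐ one)) (x ≐ (w · z · w ⁻ · p₁ · w))))))))
  where
  z w x p₁ p₂ q₁ q₂ : Term 7
  z  = x₀
  w  = x₁
  x  = x₂
  p₁ = x₃
  p₂ = x₄
  q₁ = x₅
  q₂ = var (Fin.fromℕ 6)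

module Conclusion {a ℓ : Level} (G : Group a ℓ) {k : ℕ} (S : Fin k → Group.Carrier G)
    (gen : Generates G S) (δ : ℕ) (fourPoint : FourPoint G S δ) (tf : TorsionFree G)
    (c : Group.Carrier G) (ax : Hyperbolicity.Axis G S gen δ fourPoint c)
    (commensurating⇒central : GroupLemmas.CentralCommensurator G c)
    (f : Group.Carrier G) (f∉C : ¬ Centralizer.C G S gen δ fourPoint tf c ax commensurating⇒central f) where
  open Avoidance G S gen δ fourPoint tf c ax commensurating⇒central
  open Frames G c f
  open import Relation.Binary.Reasoning.Setoid setoid

  conj-ε : ∀ x → ε ∙ x ∙ ε ⁻¹ ≈ x
  conj-ε x = group! (x ∷ᵥ []ᵥ) (one · x₀ · one ⁻) x₀ refl

  T⇒φ : ∀ {x} → T x → Hat φ₀ x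
  T⇒φ {x} (w , z , z∈C , z≉ε , e) = x , w , z , lift (conj-frame c) , lift (conj-frame f) ,
    lift (≈-trans (∙-congˡ (conj-ε c)) (≈-trans z∈C (∙-congʳ (≈-sym (conj-ε c))))) ,
    (λ (lift e′) → z≉ε e′) , lift (≈-trans e (∙-congʳ (∙-congˡ (≈-sym (conj-ε c)))))
    where
    conj-frame : ∀ y → x ∙ y ∙ x ⁻¹ ≈ x ∙ (ε ∙ y ∙ ε ⁻¹) ∙ x ⁻¹
    conj-frame y = ∙-congʳ (∙-congˡ (≈-sym (conj-ε y)))

  -- The witness `x′` may differ from `x` only by `ζ`, which centralizes `c` and `f`. If `ζ` were
  -- nontrivial, conjugation by `f` would keep it in `C`, against malnormality.
  φ⇒T : ∀ {x} → Hat φ₀ x → ¬ ¬ T x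
  φ⇒T {x} (x′ , w , z , lift e₁ , lift e₂ , lift z∈C , z≉ε , lift e) κ′ = em {X = ζ ≈ ε} λ
    { (inj₁ ζ≈ε) → κ′ (w , z , ≈-trans (∙-congˡ (≈-sym (conj-ε c))) (≈-trans z∈C (∙-congʳ (conj-ε c))) , (λ e′ → z≉ε (lift e′)) ,
        (begin
          x                              ≈⟨ group! (x ∷ᵥ x′ ∷ᵥ []ᵥ) x₀ (x₁ · (x₁ ⁻ · x₀)) refl ⟩
          x′ ∙ ζ                         ≈⟨ ∙-congˡ ζ≈ε ⟩
          x′ ∙ ε                         ≈⟨ identityʳ x′ ⟩
          x′                             ≈⟨ e ⟩
          w ∙ z ∙ w ⁻¹ ∙ (ε ∙ c ∙ ε ⁻¹) ∙ w ≈⟨ ∙-congʳ (∙-congˡ (conj-ε c)) ⟩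
          w ∙ z ∙ w ⁻¹ ∙ c ∙ w           ∎))
    ; (inj₂ ζ≉ε) → malnormal f∉C (commutes c e₁) ζ≉ε (C-resp (begin
          ζ                ≈⟨ group! (f ∷ᵥ ζ ∷ᵥ []ᵥ) x₁ (x₀ ⁻ · (x₀ · x₁)) refl ⟩
          f ⁻¹ ∙ (f ∙ ζ)   ≈⟨ ∙-congˡ (commutes f e₂) ⟨
          f ⁻¹ ∙ (ζ ∙ f)   ≈⟨ assoc _ _ _ ⟨
          f ⁻¹ ∙ ζ ∙ f     ∎) (commutes c e₁)) }
    where
    ζ = x′ ⁻¹ ∙ x
    commutes : ∀ y → x ∙ y ∙ x ⁻¹ ≈ x′ ∙ (ε ∙ y ∙ ε ⁻¹) ∙ x′ ⁻¹ → ζ ∙ y ≈ y ∙ ζ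
    commutes y e = begin
      x′ ⁻¹ ∙ x ∙ y                                   ≈⟨ group! (x ∷ᵥ x′ ∷ᵥ y ∷ᵥ []ᵥ) (x₁ ⁻ · x₀ · x₂) (x₁ ⁻ · (x₀ · x₂ · x₀ ⁻) · x₀) refl ⟩
      x′ ⁻¹ ∙ (x ∙ y ∙ x ⁻¹) ∙ x                      ≈⟨ ∙-congʳ (∙-congˡ e) ⟩
      x′ ⁻¹ ∙ (x′ ∙ (ε ∙ y ∙ ε ⁻¹) ∙ x′ ⁻¹) ∙ x       ≈⟨ group! (x ∷ᵥ x′ ∷ᵥ y ∷ᵥ []ᵥ) (x₁ ⁻ · (x₁ · (one · x₂ · one ⁻) · x₁ ⁻) · x₀) (x₂ · (x₁ ⁻ · x₀)) refl ⟩
      y ∙ (x′ ⁻¹ ∙ x)                                 ∎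

  leave : ∀ g → ∃ λ (y : ℕ → Γ) → ∀ k i → k < i → ¬ Hat φ₀ (y i ∙ y k ⁻¹ ∙ g)
  leave g = y , λ k i k<i s → φ⇒T s λ t → avoids f∉C wf {r = r k} (wl-∙ (wl-⁻¹ (wl-y k)) wg) (grown k i k<i) (T-resp (assoc _ _ _) t)
    where
    lf = proj₁ (gen f)
    wf : WL f lf
    wf = proj₂ (gen f)
    lg = proj₁ (gen g)
    wg : WL g lg
    wg = proj₂ (gen g)
    T-resp : ∀ {x x′} → x ≈ x′ → T x → T x′
    T-resp e (w , z , p , q , e′) = w , z , p , q , ≈-trans (≈-sym e) e′
    -- `r k` bounds the length of `y k ⁻¹ ∙ g`, which takes the place of `g` in `avoids`; `N` must
    -- exceed the threshold for all earlier `r k`.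
    N r : ℕ → ℕ
    N zero    = 0
    N (suc n) = N n + threshold f∉C wf (r n)
    r n = 7 * (lf + N n * λₕ) + lg
    y : ℕ → Γ
    y n = pow G (f ∙ pow G c (N n)) 7
    wl-y : ∀ n → WL (y n) (7 * (lf + N n * λₕ))
    wl-y n = wl-pow 7 (wl-∙ wf (wl-pow (N n) wl-h))
    N-mono : ∀ m d → N m ≤ N (d + m)
    N-mono m zero    = ≤-refl
    N-mono m (suc d) = ≤-trans (N-mono m d) (m≤m+n _ _)
    grown : ∀ k i → k < i → threshold f∉C wf (r k) ≤ N i
    grown k i k<i = ≤-trans (m≤n+m _ (N k)) (≤-trans (N-mono (suc k) (i ∸ suc k)) (≤-reflexive (≡.cong N (ℕₚ.m∸n+n≡m k<i))))

  enter : ∀ g → ∃ λ (y : ℕ → Γ) → ∀ k i → k < i → Hat φ₀ (y i ∙ y k ⁻¹ ∙ g)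
  enter g = y , λ k i k<i → T⇒φ (w , pow G c i ∙ pow G c k ⁻¹ , C-∙ (C-zp (+ i)) (C-⁻¹ (C-zp (+ k))) , nontrivial k i k<i ,
      group! (c ∷ᵥ g ∷ᵥ pow G c i ∷ᵥ pow G c k ∷ᵥ []ᵥ)
        (x₀ ⁻ · x₁ · x₂ · (x₀ ⁻ · x₁) ⁻ · (x₀ ⁻ · x₁ · x₃ · (x₀ ⁻ · x₁) ⁻) ⁻ · x₁)
        (x₀ ⁻ · x₁ · (x₂ · x₃ ⁻) · (x₀ ⁻ · x₁) ⁻ · x₀ · (x₀ ⁻ · x₁)) refl)
    where
    w : Γ
    w = c ⁻¹ ∙ g
    y : ℕ → Γ
    y n = w ∙ pow G c n ∙ w ⁻¹
    nontrivial : ∀ k i → k < i → ¬ pow G c i ∙ pow G c k ⁻¹ ≈ ε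
    nontrivial k i k<i e = ℕₚ.<⇒≱ (ℕₚ.m<n⇒0<n∸m k<i) (linear (i ∸ k) {0} (wl-resp (≈-sym difference) wl-ε , λ _ _ → z≤n))
      where
      difference : pow G c (i ∸ k) ≈ ε
      difference = begin
        pow G c (i ∸ k)                              ≈⟨ group! (pow G c (i ∸ k) ∷ᵥ pow G c k ∷ᵥ []ᵥ) x₀ (x₀ · x₁ · x₁ ⁻) refl ⟩
        pow G c (i ∸ k) ∙ pow G c k ∙ pow G c k ⁻¹   ≈⟨ ∙-congʳ (pow-+ c (i ∸ k) k) ⟨
        pow G c (i ∸ k + k) ∙ pow G c k ⁻¹           ≡⟨ ≡.cong (λ n → pow G c n ∙ pow G c k ⁻¹) (ℕₚ.m∸n+n≡m (ℕₚ.<⇒≤ k<i)) ⟩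
        pow G c i ∙ pow G c k ⁻¹                     ≈⟨ e ⟩
        ε                                            ∎

  contradiction : ¬ BoolSem.InEqBoolAlg G {2} {2} φ₀
  contradiction = not-boolean φ₀ leave enter

theorem8 : ∀ {c ℓ : Level} (G : Group c ℓ) →
    Hyperbolic G → NonElementary G → TorsionFree G →
    Σ ℕ λ n → Σ ℕ λ m → Σ (Formula (n + m)) λ φ →
    ¬ BoolSem.InEqBoolAlg G {n} {m} φ
theorem8 G (k , S , gen , δ , fourPoint) ne tf = 2 , 2 , φ₀ , λ inAlg →
  loxodromic-exists ne λ (h , _ , _ , l₁ , l₂ , gap) →
  Commensurator.central-power G S gen δ fourPoint tf h (axis l₁ l₂ gap) λ (l , comm) →
  let c  = pow G h (suc l)
      ax = Commensurator.pow-axis G S gen δ fourPoint tf h (axis l₁ l₂ gap) l in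
  Centralizer.noncentral-exists G S gen δ fourPoint tf c ax comm ne λ (f , f∉C) →
  Conclusion.contradiction G S gen δ fourPoint tf c ax comm f f∉C inAlg
  where open Hyperbolicity G S gen δ fourPoint
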